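{- Suppose that for every positive integer $n$ the bivariate polynomial \[ \mathrm{simp}_n(s,t)=\sum_{\sigma\in \mathrm{Simp}_n} s^{\mathrm{des}(\sigma)}t^{\mathrm{ides}(\sigma)} \] is gamma-positive (as a bivariate palindromic polynomial of darga $n-1$), where $\mathrm{Simp}_n$ is the set of simple permutations of length $n$. Then for each $n\ge 1$ there exist nonnegative integers $\gamma_{n,i,j}$ $(i,j\ge 0,\ 2i+j\le n-1)$ such that \[ \sum_{\pi\in S_n} s^{\mathrm{des}(\pi)}t^{\mathrm{ides}(\pi)}=\sum_{i,j\ge 0,\ 2i+j\le n-1}\gamma_{n,i,j}(st)^i(s+t)^j(1+st)^{n-1-j-2i}. \]
   Context: For $\pi \in S_n$ (written in one-line notation), $\mathrm{des}(\pi)=|\{i\in\{1,\dots,n-1\} : \pi(i)>\pi(i+1)\}|$ and $\mathrm{ides}(\pi)=\mathrm{des}(\pi^{ -1})$. A block of a permutation $a_1\ldots a_n$ is a nonempty contiguous sequence of entries $a_i a_{i+1}\ldots a_{i+k}$ whose values also form a contiguous sequence of integers. Singletons and the whole permutation are trivial blocks; all other blocks are proper. A permutation is simple if it has no proper blocks (so $1$, $12$, $21$ are simple, and there are no simple permutations of length $3$). A bivariate polynomial $f(s,t)$ is palindromic of darga $n-1$ if $f(s,t)=(st)^{n-1}f(1/s,1/t)$ and $f(s,t)=f(t,s)$ (the zero polynomial is palindromic of every darga). These polynomials form a vector space with basis (the bivariate gamma basis) $\{(st)^i(s+t)^j(1+st)^{n-1-j-2i} : i,j\ge 0,\ 2i+j\le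 n-1\}$. Such a polynomial is gamma-positive if all its coefficients in this basis are nonnegative. -}

module Defs where

open import Algebra.Bundles using (RawSemiring)
open import Data.Bool using (if_then_else_; _∧_)
open import Data.Fin as Fin using (Fin; zero; suc; toℕ; inject₁; punchIn)
open import Data.Fin.Permutation as Perm using (Permutation′; _⟨$⟩ʳ_; insert; remove)
open import Data.Fin.Properties as Finₚ using ()
open import Data.Integer as ℤ using (ℤ; +_; -[1+_])
open import Data.List using (List; []; _∷_; _++_; length; filter; allFin; upTo; concatMap; cartesianProduct; cartesianProductWith)
open import Data.List.Membership.Propositional.Properties using (∈-allFin)
open import Data.List.Relation.Unary.All using ([])
open import Data.List.Relation.Unary.AllPairs using ([]; _∷_)
open import Data.List.Relation.Unary.Any using (Any; here)
import Data.List.Relation.Unary.Any.Properties as Anyₚ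
import Data.List.Relation.Unary.Unique.Propositional.Properties as Uniqueₚ
open import Data.List.Relation.Unary.Unique.Setoid using (Unique)
import Data.List.Relation.Unary.Unique.Setoid.Properties as UniqueSetoidₚ
open import Data.Nat as ℕ using (ℕ; zero; suc; _∸_)
open import Data.Nat.Properties as ℕₚ using ()
open import Data.Product using (∃; _×_; _,_)
open import Data.Rational as ℚ using (ℚ; 0ℚ; 1ℚ; _/_)
open import Level using (0ℓ)
open import Relation.Binary.Bundles using (Setoid)
open import Relation.Binary.PropositionalEquality using (_≡_; _≢_; refl; sym; trans; cong; setoid; module ≡-Reasoning)
open import Relation.Nullary using (¬_; Dec; does)
open import Relation.Nullary.Decidable using (_×-dec_; _→-dec_; ¬?)

-- A polynomial in s and t over ℚ is a finite list of terms (c , a , b), standing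
-- for c s^a t^b. Exponents may repeat and coefficients may be zero, so lists are
-- compared through their coefficients.

Poly : Set
Poly = List (ℚ × ℕ × ℕ)

coeff : Poly → ℕ → ℕ → ℚ
coeff []                a b = 0ℚ
coeff ((c , p , q) ∷ f) a b =
  (if does (p ℕ.≟ a) ∧ does (q ℕ.≟ b) then c else 0ℚ) ℚ.+ coeff f a b

polyRawSemiring : RawSemiring 0ℓ 0ℓ
polyRawSemiring = record
  { Carrier = Poly
  ; _≈_     = λ f g → ∀ a b → coeff f a b ≡ coeff g a b
  ; _+_     = _++_
  ; _*_     = cartesianProductWith
                λ (c , a , b) (c′ , a′ , b′) → c ℚ.* c′ , a ℕ.+ a′ , b ℕ.+ b′
  ; 0#      = []
  ; 1#      = (1ℚ , 0 , 0) ∷ []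
  }

open RawSemiring polyRawSemiring public using (_≈_; _+_; _*_; 1#)
open import Algebra.Definitions.RawSemiring polyRawSemiring public using (_^_)

const : ℚ → Poly
const c = (c , 0 , 0) ∷ []

s t : Poly
s = (1ℚ , 1 , 0) ∷ []
t = (1ℚ , 0 , 1) ∷ []

-- Addition of polynomials is concatenation of lists.
∑ : {A : Set} → List A → (A → Poly) → Poly
∑ xs f = concatMap f xs

-- The coefficient of s^a t^b in f regarded as a Laurent polynomial.
coeffℤ : Poly → ℤ → ℤ → ℚ
coeffℤ f (+ a)    (+ b)    = coeff f a b
coeffℤ f (+ _)    -[1+ _ ] = 0ℚ
coeffℤ f -[1+ _ ] _        = 0ℚ

record Palindromic (N : ℕ) (f : Poly) : Set where
  field
    -- f(s,t) = (st)^N f(1/s,1/t), as Laurent polynomials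
    reciprocal : ∀ a b → coeffℤ f a b ≡ coeffℤ f (+ N ℤ.- a) (+ N ℤ.- b)
    -- f(s,t) = f(t,s)
    symmetric  : ∀ a b → coeff f a b ≡ coeff f b a

gammaBasis : ℕ → ℕ → ℕ → Poly
gammaBasis N i j = (s * t) ^ i * (s + t) ^ j * (1# + s * t) ^ (N ∸ j ∸ 2 ℕ.* i)

gammaIndices : ℕ → List (ℕ × ℕ)
gammaIndices N = filter (λ (i , j) → 2 ℕ.* i ℕ.+ j ℕ.≤? N)
                        (cartesianProduct (upTo (suc N)) (upTo (suc N)))

-- Values of γ at pairs (i , j) with 2i + j > N are not used.
gammaExpansion : ℕ → (ℕ → ℕ → ℚ) → Poly
gammaExpansion N γ = ∑ (gammaIndices N) λ (i , j) → const (γ i j) * gammaBasis N i j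

-- The coefficients in the gamma basis are unique, so asking for some nonnegative
-- family of them is the same as asking that the family be nonnegative.
record GammaPositive (N : ℕ) (f : Poly) : Set where
  field
    palindromic : Palindromic N f
    γ           : ℕ → ℕ → ℚ
    nonnegative : ∀ i j → 2 ℕ.* i ℕ.+ j ℕ.≤ N → 0ℚ ℚ.≤ γ i j
    expansion   : f ≈ gammaExpansion N γ

-- All permutations, listed by the image of the first position. Permutations are
-- functions with inverses, so they are compared pointwise (Perm._≈_); up to this
-- equality each one occurs (permutations-complete) exactly once
-- (permutations-unique).
permutations : ∀ n → List (Permutation′ n)
permutations zero    = Perm.id ∷ []
permutations (suc n) =
  cartesianProductWith (insert zero) (allFin (suc n)) (permutations n)

permSetoid : ℕ → Setoid 0ℓ 0ℓ
permSetoid n = record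
  { Carrier       = Permutation′ n
  ; _≈_           = Perm._≈_
  ; isEquivalence = record
    { refl  = λ _ → refl
    ; sym   = λ p i → sym (p i)
    ; trans = λ p q i → trans (p i) (q i)
    }
  }

permutations-complete : ∀ n (π : Permutation′ n) → Any (Perm._≈ π) (permutations n)
permutations-complete zero    π = here λ ()
permutations-complete (suc n) π =
  Anyₚ.cartesianProductWith⁺ (insert zero) agree
    (∈-allFin (π ⟨$⟩ʳ zero))
    (permutations-complete n (remove zero π))
  where
  open ≡-Reasoning
  agree : ∀ {j} {ρ : Permutation′ n} → π ⟨$⟩ʳ zero ≡ j → ρ Perm.≈ remove zero π →
          insert zero j ρ Perm.≈ π
  agree refl _ zero = refl
  agree {j} {ρ} refl p (suc i) = begin
    insert zero j ρ ⟨$⟩ʳ suc i              ≡⟨ Perm.insert-punchIn zero j ρ i ⟩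
    punchIn j (ρ ⟨$⟩ʳ i)                    ≡⟨ cong (punchIn j) (p i) ⟩
    punchIn j (remove zero π ⟨$⟩ʳ i)        ≡⟨ Perm.punchIn-permute π zero i ⟨
    π ⟨$⟩ʳ suc i                            ∎

permutations-unique : ∀ n → Unique (permSetoid n) (permutations n)
permutations-unique zero    = [] ∷ []
permutations-unique (suc n) =
  UniqueSetoidₚ.cartesianProductWith⁺ (setoid _) (permSetoid n) (permSetoid (suc n))
    (insert zero) (λ {_} {_} {π} {ρ} → injective {π = π} {ρ})
    (Uniqueₚ.allFin⁺ (suc n)) (permutations-unique n)
  where
  open ≡-Reasoning
  injective : ∀ {j k} {π ρ : Permutation′ n} →
              insert zero j π Perm.≈ insert zero k ρ → j ≡ k × π Perm.≈ ρ
  injective {j} {k} {π} {ρ} p with p zero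
  ... | refl = refl , λ i → Finₚ.punchIn-injective j _ _ (begin
    punchIn j (π ⟨$⟩ʳ i)          ≡⟨ Perm.insert-punchIn zero j π i ⟨
    insert zero j π ⟨$⟩ʳ suc i    ≡⟨ p (suc i) ⟩
    insert zero j ρ ⟨$⟩ʳ suc i    ≡⟨ Perm.insert-punchIn zero j ρ i ⟩
    punchIn j (ρ ⟨$⟩ʳ i)          ∎)

-- Positions and values are numbered from 0 by Fin n.
des : ∀ {n} → Permutation′ n → ℕ
des {zero}  π = 0
des {suc m} π =
  length (filter (λ i → π ⟨$⟩ʳ suc i Fin.<? π ⟨$⟩ʳ inject₁ i) (allFin m))

ides : ∀ {n} → Permutation′ n → ℕ
ides π = des (Perm.flip π)

-- The positions from i to j form a block: the set of their values is exactly the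
-- interval of values from l to u, for some l and u.
Block : ∀ {n} → Permutation′ n → Fin n → Fin n → Set
Block {n} π i j = i Fin.≤ j × ∃ λ (l : Fin n) → ∃ λ (u : Fin n) →
    (∀ (x : Fin n) → i Fin.≤ x × x Fin.≤ j → l Fin.≤ π ⟨$⟩ʳ x × π ⟨$⟩ʳ x Fin.≤ u)
  × (∀ (v : Fin n) → l Fin.≤ v × v Fin.≤ u →
       ∃ λ x → (i Fin.≤ x × x Fin.≤ j) × π ⟨$⟩ʳ x ≡ v)

ProperBlock : ∀ {n} → Permutation′ n → Fin n → Fin n → Set
ProperBlock {n} π i j =
  Block π i j × i ≢ j × ¬ (toℕ i ≡ 0 × suc (toℕ j) ≡ n)

Simple : ∀ {n} → Permutation′ n → Set
Simple π = ∀ i j → ¬ ProperBlock π i j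

block? : ∀ {n} (π : Permutation′ n) i j → Dec (Block π i j)
block? π i j = i Fin.≤? j ×-dec Finₚ.any? λ l → Finₚ.any? λ u →
        Finₚ.all? (λ x → (i Fin.≤? x ×-dec x Fin.≤? j)
                   →-dec (l Fin.≤? π ⟨$⟩ʳ x ×-dec π ⟨$⟩ʳ x Fin.≤? u))
  ×-dec Finₚ.all? (λ v → (l Fin.≤? v ×-dec v Fin.≤? u)
                   →-dec Finₚ.any? λ x → (i Fin.≤? x ×-dec x Fin.≤? j)
                                         ×-dec π ⟨$⟩ʳ x Fin.≟ v)

simple? : ∀ {n} (π : Permutation′ n) → Dec (Simple π)
simple? {n} π = Finₚ.all? λ i → Finₚ.all? λ j → ¬?
  (block? π i j ×-dec ¬? (i Fin.≟ j) ×-dec ¬? (toℕ i ℕ.≟ 0 ×-dec suc (toℕ j) ℕ.≟ n))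

simplePermutations : ∀ n → List (Permutation′ n)
simplePermutations n = filter simple? (permutations n)

simp : ℕ → Poly
simp n = ∑ (simplePermutations n) λ σ → s ^ des σ * t ^ ides σ

twoSidedEulerian : ℕ → Poly
twoSidedEulerian n = ∑ (permutations n) λ π → s ^ des π * t ^ ides π

fromℕ : ℕ → ℚ
fromℕ k = + k / 1

{-# OPTIONS --safe #-}
module Submission where

-- Contracting a block to a point writes a permutation π as a permutation σ with one entry
-- replaced by a permutation α, and then des π = des σ + des α and ides π = ides σ + ides α.
--
-- Let A, C, P, M be the generating polynomials of all permutations of size n, of those that are
-- neither direct nor skew sums, of the direct sums and of the skew sums. Splitting off the first
-- component gives P = (C + M) A and M = st (C + P) A (convolutions over the sizes). These have no
-- evident gamma-positive form, but for U = P + M and V = M + st P they become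
--   U = ((1 + st) C + V) A   and   V = st (2 C + U) A,
-- where V has darga n instead of n - 1. So C and the smaller A determine A = C + U positively.
--
-- For C, let D j be the sum over those permutations counted by C in which every proper block
-- starts at position j or later. Contracting the largest proper block starting at j gives
-- D j = sum over m of D (j + 1) A, with factors of sizes n - m and m + 1. Here D 0 is C, and D n
-- counts simple permutations (for n > 2), where the hypothesis applies.
--
-- Finally, the gamma coefficients are integers because the basis is unitriangular.

-- The substitution decomposition writes a permutation as an inflation of a unique simple
-- permutation, with unique blocks unless that simple permutation is 12 or 21. Here several entries
-- are never inflated at once: all identities come from one bijection that replaces a single entry,
-- and D j treats the positions one by one. This needs connectedness: overlapping proper blocks
-- unite to a block, and if their union is everything, the permutation is a direct or skew sum.
--
-- U and V come from symmetry. Reversal turns s^a t^b into s^(n-1-a) t^(n-1-b) and exchanges direct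
-- and skew sums, so neither P nor M need be palindromic, whereas P + M and M + st P are, of dargas
-- n - 1 and n. In a convolution, the dargas of factors of sizes a and b add up to a + b - 2, one
-- too few. The junction of the two summands has weight 1 or st, and only 1 + st has darga 1; what
-- remains after splitting it off is V.

open import Defs
open import Algebra.Bundles using (CommutativeSemiring)
open import Data.Bool using (true; false; T; if_then_else_; _∧_)
open import Data.Empty using (⊥; ⊥-elim)
open import Data.Fin as Fin using (Fin; zero; suc; toℕ; fromℕ<; inject₁)
open import Data.Fin.Permutation as Perm using (Permutation′; _⟨$⟩ʳ_; permutation; flip)
import Data.Fin.Properties as Finₚ
open import Data.Integer as ℤ using (ℤ; +_; -[1+_])
import Data.Integer.Properties as ℤₚ
open import Data.List using (List; []; _∷_; _++_; map; length; filter; tabulate; upTo; cartesianProduct)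
open import Data.List.Membership.Propositional using (_∈_; find)
open import Data.List.Membership.Propositional.Properties using (∈-filter⁺; ∈-filter⁻; ∈-cartesianProduct⁺; ∈-cartesianProduct⁻; ∈-∃++; ∈-upTo⁺; ∈-upTo⁻)
open import Data.List.Properties using (++-assoc; ++-identityʳ; cartesianProductWith-distribʳ-++; filter-all; map-++)
open import Data.List.Relation.Unary.All as All using (All; []; _∷_)
import Data.List.Relation.Unary.All.Properties as Allₚ
open import Data.List.Relation.Unary.AllPairs as AllPairs using (AllPairs; []; _∷_)
import Data.List.Relation.Unary.AllPairs.Properties as AllPairsₚ
open import Data.List.Relation.Unary.Any using (here; there)
open import Data.List.Relation.Unary.Unique.Propositional using (Unique)
import Data.List.Relation.Unary.Unique.Propositional.Properties as Uniqueₚ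
open import Data.Nat as ℕ using (ℕ; zero; suc; _∸_; _⊓_; _≤_; _<_; z≤n; s≤s; s≤s⁻¹; _≟_; _≤?_; _<?_)
import Data.Nat.Divisibility as Div
import Data.Nat.GCD as Gcd
open import Data.Nat.Induction using (<-rec)
open import Data.Nat.Properties hiding (+-comm; *-comm; *-assoc; *-zeroʳ; *-identityˡ; *-distribʳ-+)
import Data.Nat.Properties as ℕₚ
open import Data.Product using (∃; _×_; _,_; proj₁; proj₂)
open import Data.Product.Properties using (≡-dec)
open import Data.Rational as ℚ using (ℚ; 0ℚ; 1ℚ)
import Data.Rational.Properties as ℚₚ
import Data.Rational.Unnormalised as ℚᵘ
import Data.Rational.Unnormalised.Properties as ℚᵘₚ
open import Data.Sum using (_⊎_; inj₁; inj₂)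
open import Data.Unit using (⊤; tt)
open import Function using (_∘_; id; _⇔_; mk⇔; Equivalence)
open import Level using (0ℓ)
open import Relation.Binary.Definitions using (tri<; tri≈; tri>)
open import Relation.Binary.PropositionalEquality hiding ([_])
open import Relation.Nullary using (¬_; Dec; does; yes; no)
open import Relation.Nullary.Decidable using (_×-dec_; _→-dec_; ¬?; map′)
open import Relation.Unary using (Decidable)

-- Polynomials in s and t form a commutative semiring

-- A record, so that Agda can recover the polynomials from a proof of equality.
infix 4 _≋_
record _≋_ (f g : Poly) : Set where
  constructor mk≋
  field coeffs : f ≈ g
open _≋_ public

≋-refl : ∀ {f} → f ≋ f
≋-refl = mk≋ λ _ _ → refl

≋-reflexive : ∀ {f g} → f ≡ g → f ≋ g
≋-reflexive refl = ≋-refl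

≋-sym : ∀ {f g} → f ≋ g → g ≋ f
≋-sym (mk≋ e) = mk≋ λ a b → sym (e a b)

≋-trans : ∀ {f g h} → f ≋ g → g ≋ h → f ≋ h
≋-trans (mk≋ e) (mk≋ e′) = mk≋ λ a b → trans (e a b) (e′ a b)

Term : Set
Term = ℚ × ℕ × ℕ

coeff₁ : Term → ℕ → ℕ → ℚ
coeff₁ (c , p , q) a b = if does (p ℕ.≟ a) ∧ does (q ℕ.≟ b) then c else 0ℚ

coeff-++ : ∀ f g a b → coeff (f ++ g) a b ≡ coeff f a b ℚ.+ coeff g a b
coeff-++ []                g a b = sym (ℚₚ.+-identityˡ _)
coeff-++ (x ∷ f) g a b = trans
  (cong (coeff₁ x a b ℚ.+_) (coeff-++ f g a b))
  (sym (ℚₚ.+-assoc (coeff₁ x a b) (coeff f a b) (coeff g a b)))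

+-cong : ∀ {f f′ g g′} → f ≋ f′ → g ≋ g′ → f + g ≋ f′ + g′
+-cong {f} {f′} {g} {g′} (mk≋ e) (mk≋ e′) = mk≋ λ a b →
  trans (coeff-++ f g a b) (trans (cong₂ ℚ._+_ (e a b) (e′ a b)) (sym (coeff-++ f′ g′ a b)))

+-comm : ∀ f g → f + g ≋ g + f
+-comm f g = mk≋ λ a b →
  trans (coeff-++ f g a b) (trans (ℚₚ.+-comm (coeff f a b) (coeff g a b)) (sym (coeff-++ g f a b)))

infixl 7 _·_
_·_ : Term → Term → Term
(c , a , b) · (c′ , a′ , b′) = c ℚ.* c′ , a ℕ.+ a′ , b ℕ.+ b′

·-comm : ∀ x y → x · y ≡ y · x
·-comm (c , a , b) (c′ , a′ , b′) = cong₂ _,_ (ℚₚ.*-comm c c′) (cong₂ _,_ (ℕₚ.+-comm a a′) (ℕₚ.+-comm b b′))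

·-assoc : ∀ x y z → (x · y) · z ≡ x · (y · z)
·-assoc (c , a , b) (c′ , a′ , b′) (c″ , a″ , b″) =
  cong₂ _,_ (ℚₚ.*-assoc c c′ c″) (cong₂ _,_ (ℕₚ.+-assoc a a′ a″) (ℕₚ.+-assoc b b′ b″))

·-identityˡ : ∀ x → (1ℚ , 0 , 0) · x ≡ x
·-identityˡ (c , a , b) = cong (_, a , b) (ℚₚ.*-identityˡ c)

-- Multiplication by a term shifts exponents. Writing them as `p + a` and `q + b` avoids
-- subtraction; all other exponents fall under `coeff-scale-below`.
coeff-scale : ∀ c p q g a b → coeff (map ((c , p , q) ·_) g) (p ℕ.+ a) (q ℕ.+ b) ≡ c ℚ.* coeff g a b
coeff-scale c p q []                 a b = sym (ℚₚ.*-zeroʳ c)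
coeff-scale c p q ((c′ , i , j) ∷ g) a b = trans
  (cong₂ ℚ._+_ head (coeff-scale c p q g a b))
  (sym (ℚₚ.*-distribˡ-+ c _ (coeff g a b)))
  where
  same : ∀ p i a → does (p ℕ.+ i ℕ.≟ p ℕ.+ a) ≡ does (i ℕ.≟ a)
  same zero    i a = refl
  same (suc p) i a = same p i a
  pick : ∀ d → (if d then c ℚ.* c′ else 0ℚ) ≡ c ℚ.* (if d then c′ else 0ℚ)
  pick true  = refl
  pick false = sym (ℚₚ.*-zeroʳ c)
  head : (if does (p ℕ.+ i ℕ.≟ p ℕ.+ a) ∧ does (q ℕ.+ j ℕ.≟ q ℕ.+ b) then c ℚ.* c′ else 0ℚ)
         ≡ c ℚ.* (if does (i ℕ.≟ a) ∧ does (j ℕ.≟ b) then c′ else 0ℚ)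
  head rewrite same p i a | same q j b = pick (does (i ℕ.≟ a) ∧ does (j ℕ.≟ b))

coeff-scale-below : ∀ c p q g {a b} → ¬ (p ≤ a × q ≤ b) → coeff (map ((c , p , q) ·_) g) a b ≡ 0ℚ
coeff-scale-below c p q []                 ¬le = refl
coeff-scale-below c p q ((c′ , i , j) ∷ g) {a} {b} ¬le
  rewrite coeff-scale-below c p q g ¬le
  with p ℕ.+ i ℕ.≡ᵇ a in eᵃ | q ℕ.+ j ℕ.≡ᵇ b in eᵇ
... | false | _     = refl
... | true  | false = refl
... | true  | true
  with refl ← ℕₚ.≡ᵇ⇒≡ (p ℕ.+ i) a (subst T (sym eᵃ) _)
     | refl ← ℕₚ.≡ᵇ⇒≡ (q ℕ.+ j) b (subst T (sym eᵇ) _)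
  with () ← ¬le (ℕₚ.m≤m+n p i , ℕₚ.m≤m+n q j)

scale-cong : ∀ x {f g} → f ≋ g → map (x ·_) f ≋ map (x ·_) g
scale-cong x@(c , p , q) {f} {g} (mk≋ e) = mk≋ go
  where
  go : ∀ a b → coeff (map (x ·_) f) a b ≡ coeff (map (x ·_) g) a b
  go a b with p ℕ.≤? a | q ℕ.≤? b
  ... | no ¬p | _ = trans (coeff-scale-below c p q f (¬p ∘ proj₁)) (sym (coeff-scale-below c p q g (¬p ∘ proj₁)))
  ... | _ | no ¬q = trans (coeff-scale-below c p q f (¬q ∘ proj₂)) (sym (coeff-scale-below c p q g (¬q ∘ proj₂)))
  ... | yes p≤a | yes q≤b with a ∸ p | ℕₚ.m+[n∸m]≡n p≤a | b ∸ q | ℕₚ.m+[n∸m]≡n q≤b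
  ... | a′ | refl | b′ | refl = begin
    coeff (map (x ·_) f) (p ℕ.+ a′) (q ℕ.+ b′) ≡⟨ coeff-scale c p q f a′ b′ ⟩
    c ℚ.* coeff f a′ b′                        ≡⟨ cong (c ℚ.*_) (e a′ b′) ⟩
    c ℚ.* coeff g a′ b′                        ≡⟨ coeff-scale c p q g a′ b′ ⟨
    coeff (map (x ·_) g) (p ℕ.+ a′) (q ℕ.+ b′) ∎
    where open ≡-Reasoning

*-congˡ : ∀ h {f g} → f ≋ g → h * f ≋ h * g
*-congˡ []      e = ≋-refl
*-congˡ (x ∷ h) e = +-cong (scale-cong x e) (*-congˡ h e)

∷-cong : ∀ {x y f g} → x ≡ y → f ≋ g → x ∷ f ≋ y ∷ g
∷-cong {x} refl (mk≋ e) = mk≋ λ a b → cong (coeff₁ x a b ℚ.+_) (e a b)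

*-∷ : ∀ f x g → f * (x ∷ g) ≋ map (x ·_) f + f * g
*-∷ []      x g = ≋-refl
*-∷ (y ∷ f) x g = ∷-cong (·-comm y x) (≋-trans
  (+-cong (≋-refl {map (y ·_) g}) (*-∷ f x g))
  (≋-trans (≋-reflexive (sym (++-assoc (map (y ·_) g) _ _)))
  (≋-trans (+-cong (+-comm (map (y ·_) g) (map (x ·_) f)) (≋-refl {f * g}))
           (≋-reflexive (++-assoc (map (x ·_) f) _ _)))))

*-zeroʳ : ∀ f → f * [] ≡ []
*-zeroʳ []      = refl
*-zeroʳ (x ∷ f) = *-zeroʳ f

*-comm : ∀ f g → f * g ≋ g * f
*-comm []      g = ≋-reflexive (sym (*-zeroʳ g))
*-comm (x ∷ f) g = ≋-trans (+-cong (≋-refl {map (x ·_) g}) (*-comm f g)) (≋-sym (*-∷ g x f))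

*-cong : ∀ {f f′ g g′} → f ≋ f′ → g ≋ g′ → f * g ≋ f′ * g′
*-cong {f} {f′} {g} {g′} e e′ = ≋-trans (*-congˡ f e′)
  (≋-trans (*-comm f g′) (≋-trans (*-congˡ g′ e) (*-comm g′ f′)))

*-distribʳ : ∀ h f g → (f + g) * h ≋ f * h + g * h
*-distribʳ h f g = ≋-reflexive (cartesianProductWith-distribʳ-++ _·_ f g h)

scale-* : ∀ x g h → map (x ·_) g * h ≡ map (x ·_) (g * h)
scale-* x []      h = refl
scale-* x (y ∷ g) h = trans (cong₂ _++_ (go h) (scale-* x g h)) (sym (map-++ (x ·_) (map (y ·_) h) (g * h)))
  where
  go : ∀ h → map (x · y ·_) h ≡ map (x ·_) (map (y ·_) h)
  go []      = refl
  go (z ∷ h) = cong₂ _∷_ (·-assoc x y z) (go h)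

*-assoc : ∀ f g h → (f * g) * h ≋ f * (g * h)
*-assoc []      g h = ≋-refl
*-assoc (x ∷ f) g h = ≋-trans (*-distribʳ h (map (x ·_) g) (f * g))
  (+-cong (≋-reflexive (scale-* x g h)) (*-assoc f g h))

*-identityˡ : ∀ f → 1# * f ≋ f
*-identityˡ f = ≋-reflexive (trans (++-identityʳ _) (go f))
  where
  go : ∀ f → map ((1ℚ , 0 , 0) ·_) f ≡ f
  go []      = refl
  go (x ∷ f) = cong₂ _∷_ (·-identityˡ x) (go f)

polySemiring : CommutativeSemiring 0ℓ 0ℓ
polySemiring = record
  { Carrier = Poly ; _≈_ = _≋_ ; _+_ = _+_ ; _*_ = _*_ ; 0# = [] ; 1# = 1#
  ; isCommutativeSemiring = record
    { isSemiring = record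
      { isSemiringWithoutAnnihilatingZero = record
        { +-isCommutativeMonoid = record
          { isMonoid = record
            { isSemigroup = record
              { isMagma = record
                { isEquivalence = record { refl = ≋-refl ; sym = ≋-sym ; trans = ≋-trans }
                ; ∙-cong = +-cong }
              ; assoc = λ f g h → ≋-reflexive (++-assoc f g h) }
            ; identity = (λ _ → ≋-refl) , λ f → ≋-reflexive (++-identityʳ f) }
          ; comm = +-comm }
        ; *-cong = *-cong
        ; *-assoc = *-assoc
        ; *-identity = *-identityˡ , λ f → ≋-trans (*-comm f 1#) (*-identityˡ f)
        ; distrib = (λ f g h → ≋-trans (*-comm f (g + h)) (≋-trans (*-distribʳ f g h) (+-cong (*-comm g f) (*-comm h f))))
                  , *-distribʳ }
      ; zero = (λ _ → ≋-refl) , λ f → ≋-reflexive (*-zeroʳ f) }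
    ; *-comm = *-comm } }

-- The cone of gamma-positive polynomials

module Polyₛ = CommutativeSemiring polySemiring

^-homo : ∀ f a b → f ^ (a ℕ.+ b) ≋ f ^ a * f ^ b
^-homo f zero    b = ≋-sym (*-identityˡ (f ^ b))
^-homo f (suc a) b = ≋-trans (*-congˡ f (^-homo f a b)) (≋-sym (*-assoc f (f ^ a) (f ^ b)))

gammaTerm : ℕ → ℕ → ℕ → Poly
gammaTerm i j k = (s * t) ^ i * (s + t) ^ j * (1# + s * t) ^ k

-- Inductive, so that closure under sums and products is structural; a family of coefficients is
-- read off only at the end, by `expand`. Storing `k` with an equation, in place of the truncated
-- difference in `gammaBasis`, lets all three exponents add under products.
data GammaCone (N : ℕ) : Poly → Set where
  cone-0    : GammaCone N []
  cone-term : ∀ c i j k → 0ℚ ℚ.≤ c → 2 ℕ.* i ℕ.+ j ℕ.+ k ≡ N → GammaCone N (const c * gammaTerm i j k)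
  cone-+    : ∀ {f g} → GammaCone N f → GammaCone N g → GammaCone N (f + g)
  cone-≋    : ∀ {f g} → f ≋ g → GammaCone N f → GammaCone N g

*-nonneg : ∀ {p q} → 0ℚ ℚ.≤ p → 0ℚ ℚ.≤ q → 0ℚ ℚ.≤ p ℚ.* q
*-nonneg {p} {q} 0≤p 0≤q = ℚₚ.nonNegative⁻¹ (p ℚ.* q) {{ℚₚ.nonNeg*nonNeg⇒nonNeg p {{ℚ.nonNegative 0≤p}} q {{ℚ.nonNegative 0≤q}}}}

term-* : ∀ c i j k c′ i′ j′ k′ →
  const (c ℚ.* c′) * gammaTerm (i ℕ.+ i′) (j ℕ.+ j′) (k ℕ.+ k′) ≋
  const c * gammaTerm i j k * (const c′ * gammaTerm i′ j′ k′)
term-* c i j k c′ i′ j′ k′ = ≋-trans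
  (*-cong (≋-refl {const (c ℚ.* c′)})
    (*-cong (*-cong (^-homo (s * t) i i′) (^-homo (s + t) j j′)) (^-homo (1# + s * t) k k′)))
  (shuffle (const c) (const c′) ((s * t) ^ i) ((s * t) ^ i′) ((s + t) ^ j) ((s + t) ^ j′)
           ((1# + s * t) ^ k) ((1# + s * t) ^ k′))
  where
  shuffle : ∀ a a′ x x′ y y′ z z′ →
    (a * a′) * ((x * x′) * (y * y′) * (z * z′)) ≋ a * (x * y * z) * (a′ * (x′ * y′ * z′))
  shuffle = solve 8 (λ a a′ x x′ y y′ z z′ →
    ((a ⊕ a′) ⊕ (((x ⊕ x′) ⊕ (y ⊕ y′)) ⊕ (z ⊕ z′))) ⊜ ((a ⊕ ((x ⊕ y) ⊕ z)) ⊕ (a′ ⊕ ((x′ ⊕ y′) ⊕ z′)))) ≋-refl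
    where open import Algebra.Solver.CommutativeMonoid Polyₛ.*-commutativeMonoid

darga-+ : ∀ i j k i′ j′ k′ → 2 ℕ.* (i ℕ.+ i′) ℕ.+ (j ℕ.+ j′) ℕ.+ (k ℕ.+ k′) ≡
  (2 ℕ.* i ℕ.+ j ℕ.+ k) ℕ.+ (2 ℕ.* i′ ℕ.+ j′ ℕ.+ k′)
darga-+ = solve 6 (λ i j k i′ j′ k′ → con 2 :* (i :+ i′) :+ (j :+ j′) :+ (k :+ k′) :=
  (con 2 :* i :+ j :+ k) :+ (con 2 :* i′ :+ j′ :+ k′)) refl
  where open import Data.Nat.Solver using (module +-*-Solver) ; open +-*-Solver

-- The product of two basis elements is again a basis element, with exponents and dargas added, so
-- only coefficients have to be multiplied.
cone-* : ∀ {N M f g} → GammaCone N f → GammaCone M g → GammaCone (N ℕ.+ M) (f * g)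
cone-* cone-0 y = cone-0
cone-* {g = g} (cone-+ {f} {f′} x x′) y = cone-≋ (≋-sym (*-distribʳ g f f′)) (cone-+ (cone-* x y) (cone-* x′ y))
cone-* {g = g} (cone-≋ {f} {f′} e x) y = cone-≋ (*-cong e (≋-refl {g})) (cone-* x y)
cone-* {N} (cone-term c i j k 0≤c refl) y = go y
  where
  go : ∀ {M g} → GammaCone M g → GammaCone (N ℕ.+ M) (const c * gammaTerm i j k * g)
  go cone-0 = cone-≋ (≋-reflexive (sym (*-zeroʳ (const c * gammaTerm i j k)))) cone-0
  go (cone-+ {g} {g′} y y′) = cone-≋ (≋-sym (Polyₛ.distribˡ (const c * gammaTerm i j k) g g′)) (cone-+ (go y) (go y′))
  go (cone-≋ e y) = cone-≋ (*-congˡ (const c * gammaTerm i j k) e) (go y)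
  go (cone-term c′ i′ j′ k′ 0≤c′ refl) = cone-≋ (term-* c i j k c′ i′ j′ k′)
    (cone-term (c ℚ.* c′) (i ℕ.+ i′) (j ℕ.+ j′) (k ℕ.+ k′) (*-nonneg 0≤c 0≤c′) (darga-+ i j k i′ j′ k′))

0≤1 : 0ℚ ℚ.≤ 1ℚ
0≤1 = ℚₚ.nonNegative⁻¹ 1ℚ

cone-st : GammaCone 2 (s * t)
cone-st = cone-≋ (mk≋ λ _ _ → refl) (cone-term 1ℚ 1 0 0 0≤1 refl)

cone-1+st : GammaCone 1 (1# + s * t)
cone-1+st = cone-≋ (mk≋ λ _ _ → refl) (cone-term 1ℚ 0 0 1 0≤1 refl)

cone-1 : GammaCone 0 1#
cone-1 = cone-≋ (mk≋ λ _ _ → refl) (cone-term 1ℚ 0 0 0 0≤1 refl)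

-- Finite sums and coefficients in the gamma basis

∑-cong : ∀ {A : Set} (xs : List A) {f g : A → Poly} → (∀ x → x ∈ xs → f x ≋ g x) → ∑ xs f ≋ ∑ xs g
∑-cong []       e = ≋-refl
∑-cong (x ∷ xs) e = +-cong (e x (here refl)) (∑-cong xs λ y y∈ → e y (there y∈))

∑-zero : ∀ {A : Set} (xs : List A) {f : A → Poly} → (∀ x → x ∈ xs → f x ≋ []) → ∑ xs f ≋ []
∑-zero []       e = ≋-refl
∑-zero (x ∷ xs) e = +-cong (e x (here refl)) (∑-zero xs λ y y∈ → e y (there y∈))

interchange : ∀ a b c d → (a + b) + (c + d) ≋ (a + c) + (b + d)
interchange = solve 4 (λ a b c d → ((a ⊕ b) ⊕ (c ⊕ d)) ⊜ ((a ⊕ c) ⊕ (b ⊕ d))) ≋-refl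
  where open import Algebra.Solver.CommutativeMonoid Polyₛ.+-commutativeMonoid

∑-+ : ∀ {A : Set} (xs : List A) (f g : A → Poly) → ∑ xs (λ x → f x + g x) ≋ ∑ xs f + ∑ xs g
∑-+ []       f g = ≋-refl
∑-+ (x ∷ xs) f g = ≋-trans (+-cong (≋-refl {f x + g x}) (∑-+ xs f g)) (interchange (f x) (g x) (∑ xs f) (∑ xs g))

∑-single : ∀ {A : Set} {xs : List A} {f : A → Poly} {x} → Unique xs → x ∈ xs →
  (∀ y → y ≢ x → f y ≋ []) → ∑ xs f ≋ f x
∑-single {xs = x ∷ xs} {f} (x∉ ∷ _) (here refl) e =
  ≋-trans (+-cong (≋-refl {f x}) (∑-zero xs λ y y∈ → e y λ y≡x → All.lookup x∉ y∈ (sym y≡x)))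
          (≋-reflexive (++-identityʳ (f x)))
∑-single {xs = z ∷ xs} (z∉ ∷ u) (there x∈) e =
  +-cong (e z (All.lookup z∉ x∈)) (∑-single u x∈ e)

withinDarga? : ∀ N (ij : ℕ × ℕ) → Dec (2 ℕ.* proj₁ ij ℕ.+ proj₂ ij ≤ N)
withinDarga? N (i , j) = 2 ℕ.* i ℕ.+ j ℕ.≤? N

gammaIndices-unique : ∀ N → Unique (gammaIndices N)
gammaIndices-unique N = Uniqueₚ.filter⁺ (withinDarga? N) (Uniqueₚ.cartesianProduct⁺ (Uniqueₚ.upTo⁺ (suc N)) (Uniqueₚ.upTo⁺ (suc N)))

∈-gammaIndices⁺ : ∀ {N i j} → 2 ℕ.* i ℕ.+ j ≤ N → (i , j) ∈ gammaIndices N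
∈-gammaIndices⁺ {N} {i} {j} le = ∈-filter⁺ (withinDarga? N)
  (∈-cartesianProduct⁺ (∈-upTo⁺ (ℕ.s≤s (ℕₚ.≤-trans (ℕₚ.≤-trans (ℕₚ.m≤m+n i _) (ℕₚ.m≤m+n _ j)) le)))
                       (∈-upTo⁺ (ℕ.s≤s (ℕₚ.≤-trans (ℕₚ.m≤n+m j _) le)))) le

∈-gammaIndices⁻ : ∀ {N i j} → (i , j) ∈ gammaIndices N → 2 ℕ.* i ℕ.+ j ≤ N
∈-gammaIndices⁻ {N} ∈N = proj₂ (∈-filter⁻ (withinDarga? N) {xs = cartesianProduct (upTo (suc N)) (upTo (suc N))} ∈N)

2i+j+k≡N⇒k : ∀ i j k → 2 ℕ.* i ℕ.+ j ℕ.+ k ∸ j ∸ 2 ℕ.* i ≡ k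
2i+j+k≡N⇒k i j k = begin
  2 ℕ.* i ℕ.+ j ℕ.+ k ∸ j ∸ 2 ℕ.* i ≡⟨ ℕₚ.∸-+-assoc (2 ℕ.* i ℕ.+ j ℕ.+ k) j (2 ℕ.* i) ⟩
  2 ℕ.* i ℕ.+ j ℕ.+ k ∸ (j ℕ.+ 2 ℕ.* i) ≡⟨ cong (λ u → 2 ℕ.* i ℕ.+ j ℕ.+ k ∸ u) (ℕₚ.+-comm j (2 ℕ.* i)) ⟩
  2 ℕ.* i ℕ.+ j ℕ.+ k ∸ (2 ℕ.* i ℕ.+ j) ≡⟨ ℕₚ.m+n∸m≡n (2 ℕ.* i ℕ.+ j) k ⟩
  k ∎
  where open ≡-Reasoning

k≡N∸j∸2i : ∀ {N} i j → 2 ℕ.* i ℕ.+ j ≤ N → 2 ℕ.* i ℕ.+ j ℕ.+ (N ∸ j ∸ 2 ℕ.* i) ≡ N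
k≡N∸j∸2i {N} i j le with N ∸ (2 ℕ.* i ℕ.+ j) | ℕₚ.m+[n∸m]≡n le
... | k | refl = cong (2 ℕ.* i ℕ.+ j ℕ.+_) (2i+j+k≡N⇒k i j k)

const-0 : const 0ℚ ≋ []
const-0 = mk≋ go
  where
  go : ∀ a b → coeff (const 0ℚ) a b ≡ 0ℚ
  go zero    zero    = refl
  go zero    (suc b) = refl
  go (suc a) b       = refl

const-+ : ∀ c c′ → const (c ℚ.+ c′) ≋ const c + const c′
const-+ c c′ = mk≋ go
  where
  go : ∀ a b → coeff (const (c ℚ.+ c′)) a b ≡ coeff (const c + const c′) a b
  go zero    zero    = ℚₚ.+-assoc c c′ 0ℚ
  go zero    (suc b) = refl
  go (suc a) b       = refl

expand : ∀ {N f} → GammaCone N f → ∃ λ (γ : ℕ → ℕ → ℚ) → (∀ i j → 0ℚ ℚ.≤ γ i j) × f ≋ gammaExpansion N γ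
expand {N} cone-0 = (λ _ _ → 0ℚ) , (λ _ _ → ℚₚ.≤-refl) ,
  ≋-sym (∑-zero (gammaIndices N) λ (i , j) _ → *-cong const-0 (≋-refl {gammaBasis N i j}))
expand {N} (cone-+ x y) with expand x | expand y
... | γ , 0≤γ , e | γ′ , 0≤γ′ , e′ = (λ i j → γ i j ℚ.+ γ′ i j) , (λ i j → ℚₚ.+-mono-≤ (0≤γ i j) (0≤γ′ i j)) ,
  ≋-trans (+-cong e e′) (≋-sym (≋-trans
    (∑-cong (gammaIndices N) λ (i , j) _ → ≋-trans (*-cong (const-+ (γ i j) (γ′ i j)) (≋-refl {gammaBasis N i j}))
                                                   (*-distribʳ (gammaBasis N i j) (const (γ i j)) (const (γ′ i j))))
    (∑-+ (gammaIndices N) (λ (i , j) → const (γ i j) * gammaBasis N i j) (λ (i , j) → const (γ′ i j) * gammaBasis N i j))))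
expand (cone-≋ e x) with expand x
... | γ , 0≤γ , e′ = γ , 0≤γ , ≋-trans (≋-sym e) e′
expand {N} (cone-term c i j k 0≤c refl) = γ , 0≤γ , ≋-sym (≋-trans
    (∑-single {f = λ (i , j) → const (γ i j) * gammaBasis N i j} (gammaIndices-unique N)
       (∈-gammaIndices⁺ (ℕₚ.m≤m+n (2 ℕ.* i ℕ.+ j) k))
       λ (i′ , j′) ≢ij → *-cong (≋-trans (≋-reflexive (cong const (γ-off i′ j′ ≢ij))) const-0) (≋-refl {gammaBasis N i′ j′}))
    (*-cong (≋-reflexive (cong const γ-on)) (≋-reflexive (cong (gammaTerm i j) (2i+j+k≡N⇒k i j k)))))
  where
  _≟²_ = ≡-dec ℕ._≟_ ℕ._≟_
  γ : ℕ → ℕ → ℚ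
  γ i′ j′ with (i′ , j′) ≟² (i , j)
  ... | yes _ = c
  ... | no  _ = 0ℚ
  0≤γ : ∀ i′ j′ → 0ℚ ℚ.≤ γ i′ j′
  0≤γ i′ j′ with (i′ , j′) ≟² (i , j)
  ... | yes _ = 0≤c
  ... | no  _ = ℚₚ.≤-refl
  γ-on : γ i j ≡ c
  γ-on with (i , j) ≟² (i , j)
  ... | yes _ = refl
  ... | no ≢ij = ⊥-elim (≢ij refl)
  γ-off : ∀ i′ j′ → (i′ , j′) ≢ (i , j) → γ i′ j′ ≡ 0ℚ
  γ-off i′ j′ ≢ij with (i′ , j′) ≟² (i , j)
  ... | yes ≡ij = ⊥-elim (≢ij ≡ij)
  ... | no  _   = refl

gammaPositive⇒cone : ∀ {N f} → GammaPositive N f → GammaCone N f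
gammaPositive⇒cone {N} gp = cone-≋ (≋-sym (mk≋ expansion)) (go (gammaIndices N) ∈-gammaIndices⁻)
  where
  open GammaPositive gp
  go : ∀ xs → (∀ {i j} → (i , j) ∈ xs → 2 ℕ.* i ℕ.+ j ≤ N) → GammaCone N (∑ xs λ (i , j) → const (γ i j) * gammaBasis N i j)
  go []             _  = cone-0
  go ((i , j) ∷ xs) le = cone-+
    (cone-term (γ i j) i j (N ∸ j ∸ 2 ℕ.* i) (nonnegative i j (le (here refl))) (k≡N∸j∸2i i j (le (here refl))))
    (go xs (le ∘ there))

-- Integrality of gamma coefficients

IsInteger : ℚ → Set
IsInteger p = ∃ λ z → p ≡ z ℚ./ 1

toℚᵘ-/1 : ∀ z → ℚ.toℚᵘ (z ℚ./ 1) ℚᵘ.≃ ℚᵘ.mkℚᵘ z 0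
toℚᵘ-/1 z = ℚₚ.toℚᵘ-fromℚᵘ (ℚᵘ.mkℚᵘ z 0)

/1-+ : ∀ y z → y ℚ./ 1 ℚ.+ z ℚ./ 1 ≡ (y ℤ.+ z) ℚ./ 1
/1-+ y z = ℚₚ.toℚᵘ-injective (begin
  ℚ.toℚᵘ (y ℚ./ 1 ℚ.+ z ℚ./ 1)               ≈⟨ ℚₚ.toℚᵘ-homo-+ (y ℚ./ 1) (z ℚ./ 1) ⟩
  ℚ.toℚᵘ (y ℚ./ 1) ℚᵘ.+ ℚ.toℚᵘ (z ℚ./ 1)     ≈⟨ ℚᵘₚ.+-cong (toℚᵘ-/1 y) (toℚᵘ-/1 z) ⟩
  ℚᵘ.mkℚᵘ y 0 ℚᵘ.+ ℚᵘ.mkℚᵘ z 0               ≈⟨ ℚᵘ.*≡* (cong (ℤ._* + 1) (cong₂ ℤ._+_ (ℤₚ.*-identityʳ y) (ℤₚ.*-identityʳ z))) ⟩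
  ℚᵘ.mkℚᵘ (y ℤ.+ z) 0                        ≈⟨ toℚᵘ-/1 (y ℤ.+ z) ⟨
  ℚ.toℚᵘ ((y ℤ.+ z) ℚ./ 1)                   ∎)
  where open ℚᵘₚ.≃-Reasoning

/1-* : ∀ y z → (y ℚ./ 1) ℚ.* (z ℚ./ 1) ≡ (y ℤ.* z) ℚ./ 1
/1-* y z = ℚₚ.toℚᵘ-injective (begin
  ℚ.toℚᵘ ((y ℚ./ 1) ℚ.* (z ℚ./ 1))           ≈⟨ ℚₚ.toℚᵘ-homo-* (y ℚ./ 1) (z ℚ./ 1) ⟩
  ℚ.toℚᵘ (y ℚ./ 1) ℚᵘ.* ℚ.toℚᵘ (z ℚ./ 1)     ≈⟨ ℚᵘₚ.*-cong (toℚᵘ-/1 y) (toℚᵘ-/1 z) ⟩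
  ℚᵘ.mkℚᵘ (y ℤ.* z) 0                        ≈⟨ toℚᵘ-/1 (y ℤ.* z) ⟨
  ℚ.toℚᵘ ((y ℤ.* z) ℚ./ 1)                   ∎)
  where open ℚᵘₚ.≃-Reasoning

int-0 : IsInteger 0ℚ
int-0 = + 0 , refl

int-1 : IsInteger 1ℚ
int-1 = + 1 , refl

int-+ : ∀ {p q} → IsInteger p → IsInteger q → IsInteger (p ℚ.+ q)
int-+ (y , refl) (z , refl) = y ℤ.+ z , /1-+ y z

int-* : ∀ {p q} → IsInteger p → IsInteger q → IsInteger (p ℚ.* q)
int-* (y , refl) (z , refl) = y ℤ.* z , /1-* y z

int-cancelˡ : ∀ p q → IsInteger p → IsInteger (p ℚ.+ q) → IsInteger q
int-cancelˡ p q (y , refl) i = subst IsInteger eq (int-+ (ℤ.- y , refl) i)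
  where
  open ≡-Reasoning
  eq : (ℤ.- y) ℚ./ 1 ℚ.+ (y ℚ./ 1 ℚ.+ q) ≡ q
  eq = begin
    (ℤ.- y) ℚ./ 1 ℚ.+ (y ℚ./ 1 ℚ.+ q) ≡⟨ ℚₚ.+-assoc ((ℤ.- y) ℚ./ 1) (y ℚ./ 1) q ⟨
    (ℤ.- y) ℚ./ 1 ℚ.+ y ℚ./ 1 ℚ.+ q   ≡⟨ cong (ℚ._+ q) (/1-+ (ℤ.- y) y) ⟩
    (ℤ.- y ℤ.+ y) ℚ./ 1 ℚ.+ q         ≡⟨ cong (λ z → z ℚ./ 1 ℚ.+ q) (ℤₚ.+-inverseˡ y) ⟩
    0ℚ ℚ.+ q                          ≡⟨ ℚₚ.+-identityˡ q ⟩
    q                                 ∎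

IntegerPoly : Poly → Set
IntegerPoly f = All (IsInteger ∘ proj₁) f

integer-coeff : ∀ {f} → IntegerPoly f → ∀ a b → IsInteger (coeff f a b)
integer-coeff []       a b = int-0
integer-coeff {(c , p , q) ∷ f} (i ∷ is) a b = int-+ (pick (does (p ℕ.≟ a) ∧ does (q ℕ.≟ b))) (integer-coeff is a b)
  where
  pick : ∀ d → IsInteger (if d then c else 0ℚ)
  pick true  = i
  pick false = int-0

integer-* : ∀ {f g} → IntegerPoly f → IntegerPoly g → IntegerPoly (f * g)
integer-* []       js = []
integer-* (i ∷ is) js = Allₚ.++⁺ (Allₚ.map⁺ (All.map (int-* i) js)) (integer-* is js)

integer-^ : ∀ {f} n → IntegerPoly f → IntegerPoly (f ^ n)
integer-^ zero    i = int-1 ∷ []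
integer-^ (suc n) i = integer-* i (integer-^ n i)

integer-∑ : ∀ {A : Set} (xs : List A) {f : A → Poly} → (∀ x → IntegerPoly (f x)) → IntegerPoly (∑ xs f)
integer-∑ []       i = []
integer-∑ (x ∷ xs) i = Allₚ.++⁺ (i x) (integer-∑ xs i)

integer-s : IntegerPoly s
integer-s = int-1 ∷ []

integer-t : IntegerPoly t
integer-t = int-1 ∷ []

integer-gammaTerm : ∀ i j k → IntegerPoly (gammaTerm i j k)
integer-gammaTerm i j k = integer-* (integer-* (integer-^ i st) (integer-^ j (int-1 ∷ int-1 ∷ []))) (integer-^ k (int-1 ∷ st))
  where st = integer-* integer-s integer-t

singleton-* : ∀ x f → (x ∷ []) * f ≡ map (x ·_) f
singleton-* x f = ++-identityʳ (map (x ·_) f)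

coeff-const-* : ∀ c f a b → coeff (const c * f) a b ≡ c ℚ.* coeff f a b
coeff-const-* c f a b = trans (cong (λ g → coeff g a b) (singleton-* (c , 0 , 0) f)) (coeff-scale c 0 0 f a b)

-- The total minus the other terms. This is the step that solves the triangular system in
-- `γ-integer`.
integer-single : ∀ {A : Set} {xs : List A} {f : A → Poly} {x} a b → Unique xs → x ∈ xs →
  (∀ y → y ∈ xs → y ≢ x → IsInteger (coeff (f y) a b)) →
  IsInteger (coeff (∑ xs f) a b) → IsInteger (coeff (f x) a b)
integer-single {xs = x ∷ xs} {f} a b (x∉ ∷ _) (here refl) others i =
  int-cancelˡ (coeff (∑ xs f) a b) (coeff (f x) a b) (go xs λ y y∈ → others y (there y∈) λ y≡x → All.lookup x∉ y∈ (sym y≡x))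
    (subst IsInteger (trans (coeff-++ (f x) (∑ xs f) a b) (ℚₚ.+-comm (coeff (f x) a b) (coeff (∑ xs f) a b))) i)
  where
  go : ∀ ys → (∀ y → y ∈ ys → IsInteger (coeff (f y) a b)) → IsInteger (coeff (∑ ys f) a b)
  go []       _ = int-0
  go (y ∷ ys) h = subst IsInteger (sym (coeff-++ (f y) (∑ ys f) a b)) (int-+ (h y (here refl)) (go ys λ z z∈ → h z (there z∈)))
integer-single {xs = z ∷ xs} {f} a b (z∉ ∷ u) (there x∈) others i =
  integer-single a b u x∈ (λ y y∈ → others y (there y∈))
    (int-cancelˡ (coeff (f z) a b) (coeff (∑ xs f) a b) (others z (here refl) (All.lookup z∉ x∈))
      (subst IsInteger (coeff-++ (f z) (∑ xs f) a b) i))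

infix 4 _≋₀_
-- Equality after setting t = 0, which is compatible with products. It isolates the lowest power of
-- t in a basis element.
record _≋₀_ (f g : Poly) : Set where
  constructor mk≋₀
  field coeffs₀ : ∀ a → coeff f a 0 ≡ coeff g a 0
open _≋₀_

≋⇒≋₀ : ∀ {f g} → f ≋ g → f ≋₀ g
≋⇒≋₀ (mk≋ e) = mk≋₀ λ a → e a 0

≋₀-trans : ∀ {f g h} → f ≋₀ g → g ≋₀ h → f ≋₀ h
≋₀-trans (mk≋₀ e) (mk≋₀ e′) = mk≋₀ λ a → trans (e a) (e′ a)

*-congˡ₀ : ∀ h {f g} → f ≋₀ g → h * f ≋₀ h * g
*-congˡ₀ []      e = mk≋₀ λ _ → refl
*-congˡ₀ (x@(c , p , q) ∷ h) {f} {g} (mk≋₀ e) = mk≋₀ λ a →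
  trans (coeff-++ (map (x ·_) f) (h * f) a 0)
    (trans (cong₂ ℚ._+_ (head q a) (coeffs₀ (*-congˡ₀ h (mk≋₀ e)) a))
      (sym (coeff-++ (map (x ·_) g) (h * g) a 0)))
  where
  head : ∀ q a → coeff (map ((c , p , q) ·_) f) a 0 ≡ coeff (map ((c , p , q) ·_) g) a 0
  head (suc q) a = trans (coeff-scale-below c p (suc q) f λ ()) (sym (coeff-scale-below c p (suc q) g λ ()))
  head zero a with p ℕ.≤? a
  ... | no ¬p = trans (coeff-scale-below c p 0 f (¬p ∘ proj₁)) (sym (coeff-scale-below c p 0 g (¬p ∘ proj₁)))
  ... | yes p≤a with a ∸ p | ℕₚ.m+[n∸m]≡n p≤a
  ... | a′ | refl = trans (coeff-scale c p 0 f a′ 0) (trans (cong (c ℚ.*_) (e a′)) (sym (coeff-scale c p 0 g a′ 0)))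

*-cong₀ : ∀ {f f′ g g′} → f ≋₀ f′ → g ≋₀ g′ → f * g ≋₀ f′ * g′
*-cong₀ {f} {f′} {g} {g′} e e′ = ≋₀-trans (*-congˡ₀ f e′)
  (≋₀-trans (≋⇒≋₀ (*-comm f g′)) (≋₀-trans (*-congˡ₀ g′ e) (≋⇒≋₀ (*-comm g′ f′))))

^-cong₀ : ∀ {f g} n → f ≋₀ g → f ^ n ≋₀ g ^ n
^-cong₀ zero    e = mk≋₀ λ _ → refl
^-cong₀ (suc n) e = *-cong₀ e (^-cong₀ n e)

s+t≋₀s : s + t ≋₀ s
s+t≋₀s = mk≋₀ λ { zero → refl ; (suc zero) → refl ; (suc (suc a)) → refl }

1+st≋₀1 : 1# + s * t ≋₀ 1#
1+st≋₀1 = mk≋₀ λ { zero → refl ; (suc zero) → refl ; (suc (suc a)) → refl }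

1^n : ∀ n → 1# ^ n ≋ 1#
1^n zero    = ≋-refl
1^n (suc n) = ≋-trans (*-identityˡ (1# ^ n)) (1^n n)

coeff-s^ : ∀ m → coeff (s ^ m) m 0 ≡ 1ℚ
coeff-s^ zero    = refl
coeff-s^ (suc m) = trans (cong (λ g → coeff g (suc m) 0) (singleton-* (1ℚ , 1 , 0) (s ^ m)))
  (trans (coeff-scale 1ℚ 1 0 (s ^ m) m 0) (trans (ℚₚ.*-identityˡ _) (coeff-s^ m)))

coeff-s^-≢ : ∀ m a → m ≢ a → coeff (s ^ m) a 0 ≡ 0ℚ
coeff-s^-≢ zero    zero    ≢ = ⊥-elim (≢ refl)
coeff-s^-≢ zero    (suc a) ≢ = refl
coeff-s^-≢ (suc m) zero    ≢ = trans (cong (λ g → coeff g 0 0) (singleton-* (1ℚ , 1 , 0) (s ^ m))) (coeff-scale-below 1ℚ 1 0 (s ^ m) λ ())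
coeff-s^-≢ (suc m) (suc a) ≢ = trans (cong (λ g → coeff g (suc a) 0) (singleton-* (1ℚ , 1 , 0) (s ^ m)))
  (trans (coeff-scale 1ℚ 1 0 (s ^ m) a 0) (trans (ℚₚ.*-identityˡ _) (coeff-s^-≢ m a (≢ ∘ cong suc))))

st^ : ∀ i → (s * t) ^ i ≡ (1ℚ , i , i) ∷ []
st^ zero    = refl
st^ (suc i) rewrite st^ i = refl

-- The factor (st)^i shifts both exponents by i, so the coefficients of t^i are those of the other
-- factors at t = 0, where s + t becomes s and 1 + st becomes 1.
gammaTerm-coeff : ∀ i j k a → coeff (gammaTerm i j k) (i ℕ.+ a) i ≡ coeff (s ^ j) a 0
gammaTerm-coeff i j k a = begin
  coeff ((s * t) ^ i * (s + t) ^ j * (1# + s * t) ^ k) (i ℕ.+ a) i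
    ≡⟨ coeffs (*-assoc ((s * t) ^ i) ((s + t) ^ j) ((1# + s * t) ^ k)) (i ℕ.+ a) i ⟩
  coeff ((s * t) ^ i * h) (i ℕ.+ a) i
    ≡⟨ cong (λ g → coeff (g * h) (i ℕ.+ a) i) (st^ i) ⟩
  coeff (map ((1ℚ , i , i) ·_) h ++ []) (i ℕ.+ a) i
    ≡⟨ cong₂ (λ g b → coeff g (i ℕ.+ a) b) (singleton-* (1ℚ , i , i) h) (sym (ℕₚ.+-identityʳ i)) ⟩
  coeff (map ((1ℚ , i , i) ·_) h) (i ℕ.+ a) (i ℕ.+ 0)
    ≡⟨ coeff-scale 1ℚ i i h a 0 ⟩
  1ℚ ℚ.* coeff h a 0
    ≡⟨ ℚₚ.*-identityˡ _ ⟩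
  coeff h a 0
    ≡⟨ coeffs₀ (*-cong₀ (^-cong₀ j s+t≋₀s) (≋₀-trans (^-cong₀ k 1+st≋₀1) (≋⇒≋₀ (1^n k)))) a ⟩
  coeff (s ^ j * 1#) a 0
    ≡⟨ coeffs (Polyₛ.*-identityʳ (s ^ j)) a 0 ⟩
  coeff (s ^ j) a 0 ∎
  where
  open ≡-Reasoning
  h = (s + t) ^ j * (1# + s * t) ^ k

gammaTerm-coeff-below : ∀ i j k a {b} → b < i → coeff (gammaTerm i j k) a b ≡ 0ℚ
gammaTerm-coeff-below i j k a {b} b<i = begin
  coeff ((s * t) ^ i * (s + t) ^ j * (1# + s * t) ^ k) a b
    ≡⟨ coeffs (*-assoc ((s * t) ^ i) ((s + t) ^ j) ((1# + s * t) ^ k)) a b ⟩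
  coeff ((s * t) ^ i * h) a b
    ≡⟨ cong (λ g → coeff (g * h) a b) (st^ i) ⟩
  coeff (map ((1ℚ , i , i) ·_) h ++ []) a b
    ≡⟨ cong (λ g → coeff g a b) (singleton-* (1ℚ , i , i) h) ⟩
  coeff (map ((1ℚ , i , i) ·_) h) a b
    ≡⟨ coeff-scale-below 1ℚ i i h (ℕₚ.<⇒≱ b<i ∘ proj₂) ⟩
  0ℚ ∎
  where
  open ≡-Reasoning
  h = (s + t) ^ j * (1# + s * t) ^ k

-- In the coefficient of s^(i+j) t^i only γ i j, with factor 1, and the γ i′ j′ with i′ < i occur.
γ-integer : ∀ {N} (γ : ℕ → ℕ → ℚ) (L : List (ℕ × ℕ)) → Unique L →
  (∀ {i j} → 2 ℕ.* i ℕ.+ j ≤ N → (i , j) ∈ L) → (∀ {i j} → (i , j) ∈ L → 2 ℕ.* i ℕ.+ j ≤ N) →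
  (∀ a b → IsInteger (coeff (∑ L λ (i , j) → const (γ i j) * gammaBasis N i j) a b)) →
  ∀ i j → 2 ℕ.* i ℕ.+ j ≤ N → IsInteger (γ i j)
γ-integer {N} γ L unique complete sound int = <-rec (λ i → ∀ j → 2 ℕ.* i ℕ.+ j ≤ N → IsInteger (γ i j)) step
  where
  F : ℕ × ℕ → Poly
  F (i , j) = const (γ i j) * gammaBasis N i j
  F-coeff : ∀ i j a b → coeff (F (i , j)) a b ≡ γ i j ℚ.* coeff (gammaBasis N i j) a b
  F-coeff i j = coeff-const-* (γ i j) (gammaBasis N i j)
  step : ∀ i → (∀ {i′} → i′ < i → ∀ j → 2 ℕ.* i′ ℕ.+ j ≤ N → IsInteger (γ i′ j)) →
         ∀ j → 2 ℕ.* i ℕ.+ j ≤ N → IsInteger (γ i j)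
  step i rec j le = subst IsInteger top
    (integer-single {xs = L} {f = F} {x = i , j} (i ℕ.+ j) i unique (complete le) others (int (i ℕ.+ j) i))
    where
    top : coeff (F (i , j)) (i ℕ.+ j) i ≡ γ i j
    top = trans (F-coeff i j (i ℕ.+ j) i) (trans
      (cong (γ i j ℚ.*_) (trans (gammaTerm-coeff i j (N ∸ j ∸ 2 ℕ.* i) j) (coeff-s^ j)))
      (ℚₚ.*-identityʳ (γ i j)))
    vanish : ∀ i′ j′ → coeff (gammaBasis N i′ j′) (i ℕ.+ j) i ≡ 0ℚ → IsInteger (coeff (F (i′ , j′)) (i ℕ.+ j) i)
    vanish i′ j′ e = + 0 , trans (F-coeff i′ j′ (i ℕ.+ j) i) (trans (cong (γ i′ j′ ℚ.*_) e) (ℚₚ.*-zeroʳ (γ i′ j′)))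
    others : ∀ y → y ∈ L → y ≢ (i , j) → IsInteger (coeff (F y) (i ℕ.+ j) i)
    others (i′ , j′) y∈ y≢ with ℕₚ.<-cmp i′ i
    ... | tri< i′<i _ _ = subst IsInteger (sym (F-coeff i′ j′ (i ℕ.+ j) i))
      (int-* (rec i′<i j′ (sound y∈)) (integer-coeff (integer-gammaTerm i′ j′ (N ∸ j′ ∸ 2 ℕ.* i′)) (i ℕ.+ j) i))
    ... | tri> _ _ i<i′ = vanish i′ j′ (gammaTerm-coeff-below i′ j′ (N ∸ j′ ∸ 2 ℕ.* i′) (i ℕ.+ j) i<i′)
    ... | tri≈ _ refl _ = vanish i j′ (trans (gammaTerm-coeff i j′ (N ∸ j′ ∸ 2 ℕ.* i) j)
      (coeff-s^-≢ j′ j (λ e → y≢ (cong (i ,_) e))))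

-- Normalising `z / 1` cancels the gcd of |z| and 1, which divides 1.
numerator : ∀ z → ℚ.↥ (z ℚ./ 1) ≡ z
numerator z = unit-factor (ℚₚ.↥-/ z 1) (cong +_ (Div.∣1⇒≡1 (Gcd.gcd[m,n]∣n ℤ.∣ z ∣ 1)))
  where
  unit-factor : ∀ {x y g} → x ℤ.* g ≡ y → g ≡ + 1 → x ≡ y
  unit-factor {x} e refl = trans (sym (ℤₚ.*-identityʳ x)) e

nonneg-numerator : ∀ z → 0ℚ ℚ.≤ z ℚ./ 1 → + ℤ.∣ z ∣ ≡ z
nonneg-numerator (+ n)    _   = refl
nonneg-numerator -[1+ n ] 0≤z = ⊥-elim (negative (ℚᵘₚ.≤-respʳ-≃ {x = ℚ.toℚᵘ 0ℚ} (toℚᵘ-/1 -[1+ n ]) (ℚₚ.toℚᵘ-mono-≤ 0≤z)))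
  where
  negative : ¬ ℚ.toℚᵘ 0ℚ ℚᵘ.≤ ℚᵘ.mkℚᵘ -[1+ n ] 0
  negative (ℚᵘ.*≤* ())

nonneg-integer : ∀ {p} → 0ℚ ℚ.≤ p → IsInteger p → p ≡ fromℕ ℤ.∣ ℚ.↥ p ∣
nonneg-integer {p} 0≤p (z , e) = begin
  p                    ≡⟨ e ⟩
  z ℚ./ 1              ≡⟨ cong (ℚ._/ 1) (nonneg-numerator z (subst (0ℚ ℚ.≤_) e 0≤p)) ⟨
  fromℕ ℤ.∣ z ∣        ≡⟨ cong (λ y → fromℕ ℤ.∣ y ∣) (trans (cong ℚ.↥_ e) (numerator z)) ⟨
  fromℕ ℤ.∣ ℚ.↥ p ∣    ∎
  where open ≡-Reasoning

-- The cone supplies nonnegative rational coefficients; the integer coefficients of `f` then force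
-- them to be integers, and the absolute value of the numerator is the natural number sought.
integral-expansion : ∀ {N f} → GammaCone N f → IntegerPoly f →
  ∃ λ (γ : ℕ → ℕ → ℕ) → f ≈ gammaExpansion N (λ i j → fromℕ (γ i j))
integral-expansion {N} {f} cone int with expand cone
... | γ , 0≤γ , e = (λ i j → ℤ.∣ ℚ.↥ (γ i j) ∣) , coeffs (≋-trans e (∑-cong (gammaIndices N) λ (i , j) ij∈ →
  ≋-reflexive (cong (λ c → const c * gammaBasis N i j) (nonneg-integer (0≤γ i j)
    (γ-integer {N} γ (gammaIndices N) (gammaIndices-unique N) ∈-gammaIndices⁺ (∈-gammaIndices⁻ {N}) (λ a b → subst IsInteger (coeffs e a b) (integer-coeff int a b)) i j (∈-gammaIndices⁻ {N} ij∈))))))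

-- Substituting a permutation for one entry of a permutation

-- Contracting the positions j, …, j + m to the position j, and the section of this map that
-- sends j to itself.
opaque
  collapse spread : ℕ → ℕ → ℕ → ℕ
  collapse j m x = x ⊓ j ℕ.+ (x ∸ (j ℕ.+ m))
  spread j m y with y ≤? j
  ... | yes _ = y
  ... | no  _ = y ℕ.+ m

data Position (j m : ℕ) : ℕ → Set where
  before : ∀ {x} → x < j → Position j m x
  within : ∀ {z} → z ≤ m → Position j m (j ℕ.+ z)
  after  : ∀ y → Position j m (j ℕ.+ m ℕ.+ suc y)

position : ∀ j m x → Position j m x
position j m x with x <? j
... | yes x<j = before x<j
... | no x≮j with x ∸ j | m+[n∸m]≡n (≮⇒≥ x≮j)
... | z | refl with z ≤? m
...   | yes z≤m = within z≤m
...   | no  z≰m with z ∸ suc m | m+[n∸m]≡n (≰⇒> z≰m)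
...     | y | refl = subst (Position j m) (trans (+-assoc j m (suc y)) (cong (j ℕ.+_) (+-suc m y))) (after y)

module _ (j m : ℕ) where

  opaque
    unfolding collapse
    collapse-before : ∀ {x} → x ≤ j → collapse j m x ≡ x
    collapse-before {x} x≤j = trans (cong₂ ℕ._+_ (m≤n⇒m⊓n≡m x≤j) (m≤n⇒m∸n≡0 (≤-trans x≤j (m≤m+n j m)))) (+-identityʳ x)

    collapse-within : ∀ {z} → z ≤ m → collapse j m (j ℕ.+ z) ≡ j
    collapse-within {z} z≤m = trans (cong₂ ℕ._+_ (m≥n⇒m⊓n≡n (m≤m+n j z)) (m≤n⇒m∸n≡0 (+-monoʳ-≤ j z≤m))) (+-identityʳ j)

    collapse-after : ∀ y → collapse j m (j ℕ.+ m ℕ.+ y) ≡ j ℕ.+ y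
    collapse-after y = cong₂ ℕ._+_ (m≥n⇒m⊓n≡n (≤-trans (m≤m+n j m) (m≤m+n (j ℕ.+ m) y))) (m+n∸m≡n (j ℕ.+ m) y)

    collapse-mono : ∀ {x y} → x ≤ y → collapse j m x ≤ collapse j m y
    collapse-mono x≤y = +-mono-≤ (⊓-monoˡ-≤ j x≤y) (∸-monoˡ-≤ (j ℕ.+ m) x≤y)

  collapse-reflects-< : ∀ {x y} → collapse j m x < collapse j m y → x < y
  collapse-reflects-< lt = ≰⇒> λ y≤x → <⇒≱ lt (collapse-mono y≤x)

  opaque
    unfolding spread
    spread-before : ∀ {y} → y ≤ j → spread j m y ≡ y
    spread-before {y} y≤j with y ≤? j
    ... | yes _  = refl
    ... | no y≰j = ⊥-elim (y≰j y≤j)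

    spread-after : ∀ {y} → j < y → spread j m y ≡ y ℕ.+ m
    spread-after {y} j<y with y ≤? j
    ... | yes y≤j = ⊥-elim (<⇒≱ j<y y≤j)
    ... | no _    = refl

    collapse-spread : ∀ y → collapse j m (spread j m y) ≡ y
    collapse-spread y with y ≤? j
    ... | yes y≤j = collapse-before y≤j
    ... | no  y≰j with y ∸ j | m+[n∸m]≡n (<⇒≤ (≰⇒> y≰j))
    ...   | z | refl = trans (cong (collapse j m) (swap j z m)) (collapse-after z)
      where
      swap : ∀ j z m → j ℕ.+ z ℕ.+ m ≡ j ℕ.+ m ℕ.+ z
      swap j z m = trans (+-assoc j z m) (trans (cong (j ℕ.+_) (ℕₚ.+-comm z m)) (sym (+-assoc j m z)))

  -- Only the fibre of `collapse` over j can have more than one element.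
  spread-collapse : ∀ x → collapse j m x ≢ j → spread j m (collapse j m x) ≡ x
  spread-collapse x ≢j with position j m x
  ... | before x<j = trans (cong (spread j m) (collapse-before (<⇒≤ x<j))) (spread-before (<⇒≤ x<j))
  ... | within z≤m = ⊥-elim (≢j (collapse-within z≤m))
  ... | after y    = trans (cong (spread j m) (collapse-after (suc y)))
    (trans (spread-after (m<m+n j (s≤s z≤n)))
      (trans (+-assoc j (suc y) m) (trans (cong (j ℕ.+_) (ℕₚ.+-comm (suc y) m)) (sym (+-assoc j m (suc y))))))

  collapse≡⇒within : ∀ {x} → collapse j m x ≡ j → j ≤ x × x ≤ j ℕ.+ m
  collapse≡⇒within {x} e with position j m x
  ... | before x<j = ⊥-elim (<⇒≢ x<j (trans (sym (collapse-before (<⇒≤ x<j))) e))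
  ... | within z≤m = m≤m+n j _ , +-monoʳ-≤ j z≤m
  ... | after y    = ⊥-elim (m+1+n≢m j (trans (sym (collapse-after (suc y))) e))

  within⇒collapse≡ : ∀ {x} → j ≤ x → x ≤ j ℕ.+ m → collapse j m x ≡ j
  within⇒collapse≡ {x} j≤x x≤j+m with x ∸ j | m+[n∸m]≡n j≤x
  ... | z | refl = collapse-within (+-cancelˡ-≤ j z m x≤j+m)

  opaque
    unfolding spread
    spread-bound : ∀ {k y} → y ≤ k → spread j m y ≤ k ℕ.+ m
    spread-bound {k} {y} y≤k with y ≤? j
    ... | yes _ = ≤-trans y≤k (m≤m+n k m)
    ... | no  _ = +-monoˡ-≤ m y≤k

  collapse-bound : ∀ {k x} → j ≤ k → x ≤ k ℕ.+ m → collapse j m x ≤ k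
  collapse-bound {k} {x} j≤k x≤k+m with position j m x
  ... | before x<j = ≤-trans (≤-reflexive (collapse-before (<⇒≤ x<j))) (≤-trans (<⇒≤ x<j) j≤k)
  ... | within z≤m = ≤-trans (≤-reflexive (collapse-within z≤m)) j≤k
  ... | after y    = ≤-trans (≤-reflexive (collapse-after (suc y))) (+-cancelʳ-≤ m (j ℕ.+ suc y) k
    (≤-trans (≤-reflexive (trans (+-assoc j (suc y) m) (trans (cong (j ℕ.+_) (ℕₚ.+-comm (suc y) m)) (sym (+-assoc j m (suc y)))))) x≤k+m))

-- Permutations as functions on the natural numbers

infixl 8 _at_
opaque
  -- Positions and values get shifted, collapsed and spread, which changes their range. The identity
  -- outside the range lets `at-flip` and `at-injective` hold for all numbers, without bounds.
  _at_ : ∀ {n} → Permutation′ n → ℕ → ℕ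
  _at_ {n} π x with x <? n
  ... | yes x<n = toℕ (π ⟨$⟩ʳ fromℕ< x<n)
  ... | no  _   = x

module _ {n} (π : Permutation′ n) where

  opaque
    unfolding _at_
    at-toℕ : ∀ i → π at toℕ i ≡ toℕ (π ⟨$⟩ʳ i)
    at-toℕ i with toℕ i <? n
    ... | yes i<n = cong (λ y → toℕ (π ⟨$⟩ʳ y)) (Finₚ.fromℕ<-toℕ i i<n)
    ... | no  i≮n = ⊥-elim (i≮n (Finₚ.toℕ<n i))

  at-fromℕ< : ∀ {x} (x<n : x < n) → π at x ≡ toℕ (π ⟨$⟩ʳ fromℕ< x<n)
  at-fromℕ< {x} x<n = trans (cong (π at_) (sym (Finₚ.toℕ-fromℕ< x<n))) (at-toℕ (fromℕ< x<n))

  opaque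
    unfolding _at_
    at-outside : ∀ {x} → ¬ x < n → π at x ≡ x
    at-outside {x} x≮n with x <? n
    ... | yes x<n = ⊥-elim (x≮n x<n)
    ... | no  _   = refl

  at-< : ∀ {x} → x < n → π at x < n
  at-< x<n = subst (_< n) (sym (at-fromℕ< x<n)) (Finₚ.toℕ<n _)

at-flip : ∀ {n} (π : Permutation′ n) x → flip π at (π at x) ≡ x
at-flip {n} π x = case-< (x <? n)
  where
  case-< : Dec (x < n) → flip π at (π at x) ≡ x
  case-< (no x≮n)  = trans (cong (flip π at_) (at-outside π x≮n)) (at-outside (flip π) x≮n)
  case-< (yes x<n) = begin
    flip π at (π at x)                             ≡⟨ cong (flip π at_) (at-fromℕ< π x<n) ⟩
    flip π at toℕ (π ⟨$⟩ʳ fromℕ< x<n)              ≡⟨ at-toℕ (flip π) _ ⟩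
    toℕ (flip π ⟨$⟩ʳ (π ⟨$⟩ʳ fromℕ< x<n))          ≡⟨ cong toℕ (Perm.inverseˡ π) ⟩
    toℕ (fromℕ< x<n)                               ≡⟨ Finₚ.toℕ-fromℕ< x<n ⟩
    x                                              ∎
    where open ≡-Reasoning

at-flip′ : ∀ {n} (π : Permutation′ n) x → π at (flip π at x) ≡ x
at-flip′ {n} π = at-flip (flip π)

at-injective : ∀ {n} (π : Permutation′ n) {x y} → π at x ≡ π at y → x ≡ y
at-injective π {x} {y} e = trans (sym (at-flip π x)) (trans (cong (flip π at_) e) (at-flip π y))

at-≈ : ∀ {n} {π ρ : Permutation′ n} → (∀ {x} → x < n → π at x ≡ ρ at x) → π Perm.≈ ρ
at-≈ {π = π} {ρ} e i = Finₚ.toℕ-injective (trans (sym (at-toℕ π i)) (trans (e (Finₚ.toℕ<n i)) (at-toℕ ρ i)))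

opaque
  unfolding _at_
  ≈-at : ∀ {n} {π ρ : Permutation′ n} → π Perm.≈ ρ → ∀ x → π at x ≡ ρ at x
  ≈-at {n} {π} {ρ} e x with x <? n
  ... | yes x<n = cong toℕ (e (fromℕ< x<n))
  ... | no  _   = refl

module FromFunctions {n} (p q : ℕ → ℕ) (p< : ∀ {x} → x < n → p x < n) (q< : ∀ {x} → x < n → q x < n)
                     (qp : ∀ {x} → x < n → q (p x) ≡ x) (pq : ∀ {x} → x < n → p (q x) ≡ x) where

  private
    restrict : (f : ℕ → ℕ) → (∀ {x} → x < n → f x < n) → Fin n → Fin n
    restrict f f< i = fromℕ< (f< (Finₚ.toℕ<n i))

    cancel : ∀ f (f< : ∀ {x} → x < n → f x < n) g (g< : ∀ {x} → x < n → g x < n) →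
             (∀ {x} → x < n → g (f x) ≡ x) → ∀ i → restrict g g< (restrict f f< i) ≡ i
    cancel f f< g g< gf i = Finₚ.toℕ-injective (begin
      toℕ (restrict g g< (restrict f f< i)) ≡⟨ Finₚ.toℕ-fromℕ< _ ⟩
      g (toℕ (restrict f f< i))             ≡⟨ cong g (Finₚ.toℕ-fromℕ< _) ⟩
      g (f (toℕ i))                         ≡⟨ gf (Finₚ.toℕ<n i) ⟩
      toℕ i                                 ∎)
      where open ≡-Reasoning

  perm : Permutation′ n
  perm = permutation (restrict p p<) (restrict q q<) (cancel q q< p p< pq) (cancel p p< q q< qp)

  perm-at : ∀ {x} → x < n → perm at x ≡ p x
  perm-at {x} x<n = trans (at-fromℕ< perm x<n) (trans (Finₚ.toℕ-fromℕ< _) (cong p (Finₚ.toℕ-fromℕ< x<n)))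

-- π is σ with its entry at position j inflated by α. Being a relation, it serves both to build π
-- and to take it apart. Positions and values enter alike: `outer` is a commuting square, and the
-- block starts at position j and at value `σ at j`. So the inverses satisfy it again, and
-- statements on `des` yield those on `ides`.
record Substitution (j m : ℕ) {n k : ℕ} (π : Permutation′ n) (σ : Permutation′ (suc k)) (α : Permutation′ (suc m)) : Set where
  field
    outer : ∀ {x} → x < n → collapse (σ at j) m (π at x) ≡ σ at collapse j m x
    inner : ∀ {z} → z ≤ m → π at (j ℕ.+ z) ≡ σ at j ℕ.+ α at z

at-≤ : ∀ {k} (π : Permutation′ (suc k)) {x} → x ≤ k → π at x ≤ k
at-≤ π x≤k = s≤s⁻¹ (at-< π (s≤s x≤k))

Substitution-flip : ∀ {j m n k} {π : Permutation′ n} {σ : Permutation′ (suc k)} {α : Permutation′ (suc m)} →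
  Substitution j m π σ α → Substitution (σ at j) m (flip π) (flip σ) (flip α)
Substitution-flip {j} {m} {π = π} {σ} {α} S = record
  { outer = λ {y} y<n → begin
      collapse (flip σ at (σ at j)) m (flip π at y)             ≡⟨ cong (λ i → collapse i m (flip π at y)) (at-flip σ j) ⟩
      collapse j m (flip π at y)                                ≡⟨ at-flip σ _ ⟨
      flip σ at (σ at collapse j m (flip π at y))               ≡⟨ cong (flip σ at_) (outer (at-< (flip π) y<n)) ⟨
      flip σ at collapse (σ at j) m (π at (flip π at y))        ≡⟨ cong (λ w → flip σ at collapse (σ at j) m w) (at-flip′ π y) ⟩
      flip σ at collapse (σ at j) m y                           ∎
  ; inner = λ {w} w≤m → at-injective π (begin
      π at (flip π at (σ at j ℕ.+ w))                             ≡⟨ at-flip′ π _ ⟩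
      σ at j ℕ.+ w                                                ≡⟨ cong (σ at j ℕ.+_) (at-flip′ α w) ⟨
      σ at j ℕ.+ α at (flip α at w)                               ≡⟨ inner (at-≤ (flip α) w≤m) ⟨
      π at (j ℕ.+ flip α at w)                                    ≡⟨ cong (λ i → π at (i ℕ.+ flip α at w)) (at-flip σ j) ⟨
      π at (flip σ at (σ at j) ℕ.+ flip α at w)                   ∎)
  }
  where
  open Substitution S
  open ≡-Reasoning

-- `v` stands for the value of σ at j. With `v` as a parameter, the inverse is the same formula with
-- `j` and `v` exchanged and σ, α inverted, so `inflate-inverse` serves both directions.
inflate : ℕ → ℕ → ℕ → (ℕ → ℕ) → (ℕ → ℕ) → ℕ → ℕ
inflate m j v σ α x with collapse j m x ≟ j
... | yes _ = v ℕ.+ α (x ∸ j)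
... | no  _ = spread v m (σ (collapse j m x))

module _ (m j v : ℕ) (σ α : ℕ → ℕ) where

  inflate-within : ∀ {x} → collapse j m x ≡ j → inflate m j v σ α x ≡ v ℕ.+ α (x ∸ j)
  inflate-within {x} e with collapse j m x ≟ j
  ... | yes _ = refl
  ... | no ¬e = ⊥-elim (¬e e)

  inflate-outside : ∀ {x} → collapse j m x ≢ j → inflate m j v σ α x ≡ spread v m (σ (collapse j m x))
  inflate-outside {x} ¬e with collapse j m x ≟ j
  ... | yes e = ⊥-elim (¬e e)
  ... | no _  = refl

within-offset : ∀ j m {x} → collapse j m x ≡ j → j ℕ.+ (x ∸ j) ≡ x × x ∸ j ≤ m
within-offset j m {x} e with collapse≡⇒within j m e
... | j≤x , x≤j+m = m+[n∸m]≡n j≤x , m≤n+o⇒m∸n≤o x j x≤j+m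

inflate-inverse : ∀ m {j v} (σ τ α β : ℕ → ℕ) → (∀ y → τ (σ y) ≡ y) → σ j ≡ v →
  (∀ z → β (α z) ≡ z) → (∀ {z} → z ≤ m → α z ≤ m) → ∀ x → inflate m v j τ β (inflate m j v σ α x) ≡ x
inflate-inverse m {j} {v} σ τ α β τσ σj βα α≤ x with collapse j m x ≟ j
... | yes e = begin
    inflate m v j τ β (v ℕ.+ α (x ∸ j))  ≡⟨ inflate-within m v j τ β (collapse-within v m (α≤ (proj₂ (within-offset j m e)))) ⟩
    j ℕ.+ β (v ℕ.+ α (x ∸ j) ∸ v)          ≡⟨ cong (λ z → j ℕ.+ β z) (m+n∸m≡n v _) ⟩
    j ℕ.+ β (α (x ∸ j))                  ≡⟨ cong (j ℕ.+_) (βα _) ⟩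
    j ℕ.+ (x ∸ j)                        ≡⟨ proj₁ (within-offset j m e) ⟩
    x                                  ∎
  where open ≡-Reasoning
... | no ¬e = begin
    inflate m v j τ β (spread v m (σ (collapse j m x)))
      ≡⟨ inflate-outside m v j τ β (λ e → ¬e (σ-injective (trans (sym (collapse-spread v m _)) (trans e (sym σj))))) ⟩
    spread j m (τ (collapse v m (spread v m (σ (collapse j m x)))))
      ≡⟨ cong (λ w → spread j m (τ w)) (collapse-spread v m _) ⟩
    spread j m (τ (σ (collapse j m x)))   ≡⟨ cong (spread j m) (τσ _) ⟩
    spread j m (collapse j m x)           ≡⟨ spread-collapse j m x ¬e ⟩
    x                                     ∎
  where
  open ≡-Reasoning
  σ-injective : ∀ {y y′} → σ y ≡ σ y′ → y ≡ y′
  σ-injective {y} {y′} e = trans (sym (τσ y)) (trans (cong τ e) (τσ y′))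

inflate-< : ∀ {m j v k} (σ α : ℕ → ℕ) → j ≤ k → v ≤ k → (∀ {y} → y ≤ k → σ y ≤ k) → (∀ {z} → z ≤ m → α z ≤ m) →
  ∀ {x} → x < suc (k ℕ.+ m) → inflate m j v σ α x < suc (k ℕ.+ m)
inflate-< {m} {j} {v} σ α j≤k v≤k σ≤ α≤ {x} (s≤s x≤) with collapse j m x ≟ j
... | yes e = s≤s (+-mono-≤ v≤k (α≤ (proj₂ (within-offset j m e))))
... | no _  = s≤s (spread-bound v m (σ≤ (collapse-bound j m j≤k x≤)))

abstract
  substitute : ∀ {j m k} → j ≤ k → (σ : Permutation′ (suc k)) (α : Permutation′ (suc m)) →
    ∃ λ (π : Permutation′ (suc (k ℕ.+ m))) → Substitution j m π σ α
  substitute {j} {m} {k} j≤k σ α = perm , record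
    { outer = λ {x} x<n → trans (cong (collapse v m) (perm-at x<n)) (outer x)
    ; inner = λ {z} z≤m → trans (perm-at (s≤s (+-mono-≤ j≤k z≤m)))
        (trans (inflate-within m j v (σ at_) (α at_) (collapse-within j m z≤m)) (cong (λ z → v ℕ.+ α at z) (m+n∸m≡n j z)))
    }
    where
    v : ℕ
    v = σ at j
    v≤k : v ≤ k
    v≤k = at-≤ σ j≤k
    open FromFunctions {suc (k ℕ.+ m)} (inflate m j v (σ at_) (α at_)) (inflate m v j (flip σ at_) (flip α at_))
      (inflate-< (σ at_) (α at_) j≤k v≤k (at-≤ σ) (at-≤ α))
      (inflate-< (flip σ at_) (flip α at_) v≤k j≤k (at-≤ (flip σ)) (at-≤ (flip α)))
      (λ _ → inflate-inverse m (σ at_) (flip σ at_) (α at_) (flip α at_) (at-flip σ) refl (at-flip α) (at-≤ α) _)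
      (λ _ → inflate-inverse m (flip σ at_) (σ at_) (flip α at_) (α at_) (at-flip′ σ) (at-flip σ j) (at-flip′ α) (at-≤ (flip α)) _)
    outer : ∀ x → collapse v m (inflate m j v (σ at_) (α at_) x) ≡ σ at collapse j m x
    outer x with collapse j m x ≟ j
    ... | yes e = trans (collapse-within v m (at-≤ α (proj₂ (within-offset j m e)))) (cong (σ at_) (sym e))
    ... | no _  = collapse-spread v m _

-- The positions j, …, j + m carry the values v, …, v + m.
IntervalBlock : ∀ {n} → ℕ → ℕ → ℕ → Permutation′ n → Set
IntervalBlock {n} j v m π = ∀ {x} → x < n →
  (collapse j m x ≡ j → collapse v m (π at x) ≡ v) × (collapse v m (π at x) ≡ v → collapse j m x ≡ j)

IntervalBlock-flip : ∀ {n j v m} {π : Permutation′ n} → IntervalBlock j v m π → IntervalBlock v j m (flip π)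
IntervalBlock-flip {π = π} B {y} y<n with B (at-< (flip π) y<n)
... | f , g rewrite at-flip′ π y = g , f

module _ {j v m k} (v≤k : v ≤ k) (j≤k : j ≤ k) (π : Permutation′ (suc (k ℕ.+ m))) (B : IntervalBlock j v m π) where

  private
    inside : ∀ {z} → z ≤ m → collapse v m (π at (j ℕ.+ z)) ≡ v
    inside z≤m = proj₁ (B (s≤s (+-mono-≤ j≤k z≤m))) (collapse-within j m z≤m)

  -- These become σ and α in `decompose`. `spread` represents the block by its first position; by
  -- `B` any other position of the block would do, which is why `quotient-outer` holds.
  quotient part : ℕ → ℕ
  quotient y = collapse v m (π at spread j m y)
  part z      = π at (j ℕ.+ z) ∸ v

  quotient≤ : ∀ {y} → y ≤ k → quotient y ≤ k
  quotient≤ y≤k = collapse-bound v m v≤k (at-≤ π (spread-bound j m y≤k))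

  part≤ : ∀ {z} → z ≤ m → part z ≤ m
  part≤ z≤m = proj₂ (within-offset v m (inside z≤m))

  quotient-j : quotient j ≡ v
  quotient-j rewrite spread-before j m (≤-refl {j}) =
    subst (λ i → collapse v m (π at i) ≡ v) (+-identityʳ j) (inside z≤n)

  part-inner : ∀ {z} → z ≤ m → π at (j ℕ.+ z) ≡ v ℕ.+ part z
  part-inner z≤m = sym (proj₁ (within-offset v m (inside z≤m)))

  quotient-outer : ∀ {x} → x < suc (k ℕ.+ m) → collapse v m (π at x) ≡ quotient (collapse j m x)
  quotient-outer {x} x<n with collapse j m x ≟ j
  ... | yes e = trans (proj₁ (B x<n) e) (trans (sym quotient-j) (cong quotient (sym e)))
  ... | no ¬e = cong (λ i → collapse v m (π at i)) (sym (spread-collapse j m x ¬e))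

quotient-inverse : ∀ {j v m k} (v≤k : v ≤ k) (j≤k : j ≤ k) (π : Permutation′ (suc (k ℕ.+ m))) (B : IntervalBlock j v m π) →
  ∀ {y} → y ≤ k →
  quotient j≤k v≤k (flip π) (IntervalBlock-flip {π = π} B) (quotient v≤k j≤k π B y) ≡ y
quotient-inverse {j} {v} {m} v≤k j≤k π B {y} y≤k with y ≟ j
... | yes refl rewrite quotient-j v≤k j≤k π B = quotient-j j≤k v≤k (flip π) (IntervalBlock-flip {π = π} B)
... | no y≢j = begin
    collapse j m (flip π at spread v m (collapse v m (π at spread j m y)))
      ≡⟨ cong (λ w → collapse j m (flip π at w)) (spread-collapse v m _ (λ e → y≢j
           (trans (sym (collapse-spread j m y)) (proj₂ (B (s≤s (spread-bound j m y≤k))) e)))) ⟩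
    collapse j m (flip π at (π at spread j m y)) ≡⟨ cong (collapse j m) (at-flip π _) ⟩
    collapse j m (spread j m y)                  ≡⟨ collapse-spread j m y ⟩
    y                                            ∎
  where open ≡-Reasoning

part-inverse : ∀ {j v m k} (v≤k : v ≤ k) (j≤k : j ≤ k) (π : Permutation′ (suc (k ℕ.+ m))) (B : IntervalBlock j v m π) →
  ∀ {z} → z ≤ m →
  part j≤k v≤k (flip π) (IntervalBlock-flip {π = π} B) (part v≤k j≤k π B z) ≡ z
part-inverse {j} {v} v≤k j≤k π B {z} z≤m = begin
  flip π at (v ℕ.+ part v≤k j≤k π B z) ∸ j ≡⟨ cong (λ w → flip π at w ∸ j) (part-inner v≤k j≤k π B z≤m) ⟨
  flip π at (π at (j ℕ.+ z)) ∸ j            ≡⟨ cong (_∸ j) (at-flip π _) ⟩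
  j ℕ.+ z ∸ j                               ≡⟨ m+n∸m≡n j z ⟩
  z                                       ∎
  where open ≡-Reasoning

abstract
  decompose : ∀ {j v m k} → v ≤ k → j ≤ k → (π : Permutation′ (suc (k ℕ.+ m))) → IntervalBlock j v m π →
    ∃ λ (σ : Permutation′ (suc k)) → ∃ λ (α : Permutation′ (suc m)) → Substitution j m π σ α
  decompose {j} {v} {m} {k} v≤k j≤k π B = σ.perm , α.perm , record
    { outer = λ {x} x<n → trans (cong (λ i → collapse i m (π at x)) σj)
        (trans (quotient-outer v≤k j≤k π B x<n) (sym (σ.perm-at (s≤s (collapse-bound j m j≤k (s≤s⁻¹ x<n))))))
    ; inner = λ {z} z≤m → trans (part-inner v≤k j≤k π B z≤m) (cong₂ ℕ._+_ (sym σj) (sym (α.perm-at (s≤s z≤m))))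
    }
    where
    B⁻¹ : IntervalBlock v j m (flip π)
    B⁻¹ = IntervalBlock-flip {π = π} B
    module σ = FromFunctions {suc k} (quotient v≤k j≤k π B) (quotient j≤k v≤k (flip π) B⁻¹)
      (λ y< → s≤s (quotient≤ v≤k j≤k π B (s≤s⁻¹ y<))) (λ y< → s≤s (quotient≤ j≤k v≤k (flip π) B⁻¹ (s≤s⁻¹ y<)))
      (λ y< → quotient-inverse v≤k j≤k π B (s≤s⁻¹ y<)) (λ y< → quotient-inverse j≤k v≤k (flip π) B⁻¹ (s≤s⁻¹ y<))
    module α = FromFunctions {suc m} (part v≤k j≤k π B) (part j≤k v≤k (flip π) B⁻¹)
      (λ z< → s≤s (part≤ v≤k j≤k π B (s≤s⁻¹ z<))) (λ z< → s≤s (part≤ j≤k v≤k (flip π) B⁻¹ (s≤s⁻¹ z<)))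
      (λ z< → part-inverse v≤k j≤k π B (s≤s⁻¹ z<)) (λ z< → part-inverse j≤k v≤k (flip π) B⁻¹ (s≤s⁻¹ z<))
    σj : σ.perm at j ≡ v
    σj = trans (σ.perm-at (s≤s j≤k)) (quotient-j v≤k j≤k π B)

-- Reindexing sums

module _ {A B : Set} (R : A → B → Set) where

  private
    remove : ∀ {y} as {bs : List B} → AllPairs (λ y y′ → ∀ x → R x y → ¬ R x y′) (as ++ y ∷ bs) →
      AllPairs (λ y y′ → ∀ x → R x y → ¬ R x y′) (as ++ bs) × All (λ y′ → ∀ x → R x y → ¬ R x y′) (as ++ bs)
    remove []       (y∉ ∷ u) = u , y∉
    remove (a ∷ as) (a∉ ∷ u) with remove as u | Allₚ.++⁻ as a∉
    ... | u′ , y∉ | a∉as , (a≁y ∷ a∉bs) = Allₚ.++⁺ a∉as a∉bs ∷ u′ , (λ x Rxy Rxa → a≁y x Rxa Rxy) ∷ y∉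

    ∈-remove : ∀ {y z : B} as {bs} → z ∈ as ++ y ∷ bs → z ≡ y ⊎ z ∈ as ++ bs
    ∈-remove []       (here e)   = inj₁ e
    ∈-remove []       (there z∈) = inj₂ z∈
    ∈-remove (a ∷ as) (here e)   = inj₂ (here e)
    ∈-remove (a ∷ as) (there z∈) with ∈-remove as z∈
    ... | inj₁ e   = inj₁ e
    ... | inj₂ z∈′ = inj₂ (there z∈′)

    ∈-insert : ∀ {y z : B} as {bs} → z ∈ as ++ bs → z ∈ as ++ y ∷ bs
    ∈-insert []       z∈         = there z∈
    ∈-insert (a ∷ as) (here e)   = here e
    ∈-insert (a ∷ as) (there z∈) = there (∈-insert as z∈)

    ∑-remove : ∀ {y} as {bs} (g : B → Poly) → ∑ (as ++ y ∷ bs) g ≋ g y + ∑ (as ++ bs) g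
    ∑-remove []       g = ≋-refl
    ∑-remove {y} (a ∷ as) {bs} g = ≋-trans (+-cong (≋-refl {g a}) (∑-remove as g))
      (x∙yz≈y∙xz (g a) (g y) (∑ (as ++ bs) g))
      where open import Algebra.Properties.CommutativeSemigroup (CommutativeSemiring.+-commutativeSemigroup polySemiring)

  -- A relation in place of a function, because permutations are compared only by `Perm._≈_`. The
  -- first two hypotheses say that no two entries of one list share a partner; each induction step
  -- removes a pair of partners.
  ∑-bijection : ∀ {f : A → Poly} {g : B → Poly} xs ys →
    AllPairs (λ x x′ → ∀ y → R x y → ¬ R x′ y) xs →
    AllPairs (λ y y′ → ∀ x → R x y → ¬ R x y′) ys →
    (∀ {x} → x ∈ xs → ∃ λ y → y ∈ ys × R x y) →
    (∀ {y} → y ∈ ys → ∃ λ x → x ∈ xs × R x y) →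
    (∀ {x y} → R x y → f x ≋ g y) →
    ∑ xs f ≋ ∑ ys g
  ∑-bijection []       []       _ _ _ _   _ = ≋-refl
  ∑-bijection []       (y ∷ ys) _ _ _ sur _ with sur (here refl)
  ... | _ , () , _
  ∑-bijection {f} {g} (x ∷ xs) ys (x∉ ∷ ux) uy tot sur fg with tot (here refl)
  ... | y , y∈ , Rxy with ∈-∃++ y∈
  ... | as , bs , refl with remove as uy
  ... | uy′ , y∉ = ≋-trans
    (+-cong (fg Rxy) (∑-bijection xs (as ++ bs) ux uy′ tot′ sur′ fg))
    (≋-sym (∑-remove as g))
    where
    tot′ : ∀ {x′} → x′ ∈ xs → ∃ λ y′ → y′ ∈ as ++ bs × R x′ y′
    tot′ x′∈ with tot (there x′∈)
    ... | y′ , y′∈ , Rx′y′ with ∈-remove as y′∈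
    ... | inj₁ refl = ⊥-elim (All.lookup x∉ x′∈ y Rxy Rx′y′)
    ... | inj₂ y′∈′ = y′ , y′∈′ , Rx′y′
    sur′ : ∀ {y′} → y′ ∈ as ++ bs → ∃ λ x′ → x′ ∈ xs × R x′ y′
    sur′ y′∈ with sur (∈-insert as y′∈)
    ... | x′ , there x′∈ , Rx′y′ = x′ , x′∈ , Rx′y′
    ... | x′ , here refl , Rxy′ = ⊥-elim (All.lookup y∉ y′∈ x Rxy Rxy′)

∑-product : ∀ {A B : Set} (xs : List A) (ys : List B) (f : A → Poly) (g : B → Poly) →
  ∑ (cartesianProduct xs ys) (λ (x , y) → f x * g y) ≋ ∑ xs f * ∑ ys g
∑-product []       ys f g = ≋-refl
∑-product (x ∷ xs) ys f g = ≋-trans (≋-reflexive (∑-++ (map (x ,_) ys) (cartesianProduct xs ys)))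
  (≋-trans (+-cong (row ys) (∑-product xs ys f g)) (≋-sym (*-distribʳ (∑ ys g) (f x) (∑ xs f))))
  where
  open import Data.List.Properties using (++-assoc)
  h = λ (x , y) → f x * g y
  ∑-++ : ∀ as bs → ∑ (as ++ bs) h ≡ ∑ as h ++ ∑ bs h
  ∑-++ []       bs = refl
  ∑-++ (a ∷ as) bs = trans (cong (h a ++_) (∑-++ as bs)) (sym (++-assoc (h a) (∑ as h) (∑ bs h)))
  row : ∀ ys → ∑ (map (x ,_) ys) h ≋ f x * ∑ ys g
  row []       = ≋-reflexive (sym (*-zeroʳ (f x)))
  row (y ∷ ys) = ≋-trans (+-cong (≋-refl {f x * g y}) (row ys)) (≋-sym (Polyₛ.distribˡ (f x) (g y) (∑ ys g)))

allPairs-cartesianProduct : ∀ {A B : Set} {P : A → A → Set} {Q : B → B → Set} {xs ys} → AllPairs P xs → AllPairs Q ys →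
  AllPairs (λ (x , y) (x′ , y′) → P x x′ ⊎ Q y y′) (cartesianProduct xs ys)
allPairs-cartesianProduct []                    uy = []
allPairs-cartesianProduct {xs = x ∷ xs} {ys} (x∉ ∷ ux) uy = AllPairsₚ.++⁺
  (AllPairsₚ.map⁺ (AllPairs.map inj₂ uy))
  (allPairs-cartesianProduct ux uy)
  (Allₚ.map⁺ (All.tabulate λ _ → All.tabulate λ xy∈ → inj₁ (All.lookup x∉ (proj₁ (∈-cartesianProduct⁻ xs ys xy∈)))))

-- Descents and weights under substitution

indicator : ∀ {P : Set} → Dec P → ℕ
indicator P? = if does P? then 1 else 0

indicator-cong : ∀ {P Q : Set} (P? : Dec P) (Q? : Dec Q) → P ⇔ Q → indicator P? ≡ indicator Q?
indicator-cong (yes p) (yes q) e = refl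
indicator-cong (yes p) (no ¬q) e = ⊥-elim (¬q (Equivalence.to e p))
indicator-cong (no ¬p) (yes q) e = ⊥-elim (¬p (Equivalence.from e q))
indicator-cong (no ¬p) (no ¬q) e = refl

-- On functions of natural numbers, so that `descents-+` can cut the range at the ends of a block.
descents : ℕ → (ℕ → ℕ) → ℕ
descents zero    f = 0
descents (suc m) f = indicator (f 1 <? f 0) ℕ.+ descents m (f ∘ suc)

descents-cong : ∀ m {f g} → (∀ {i} → i < m → f (suc i) < f i ⇔ g (suc i) < g i) → descents m f ≡ descents m g
descents-cong zero    e = refl
descents-cong (suc m) {f} {g} e = cong₂ ℕ._+_ (indicator-cong (f 1 <? f 0) (g 1 <? g 0) (e (s≤s z≤n))) (descents-cong m (λ i<m → e (s≤s i<m)))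

descents-+ : ∀ a b f → descents (a ℕ.+ b) f ≡ descents a f ℕ.+ descents b (λ i → f (a ℕ.+ i))
descents-+ zero    b f = refl
descents-+ (suc a) b f = trans (cong (indicator (f 1 <? f 0) ℕ.+_) (descents-+ a b (f ∘ suc)))
  (sym (ℕₚ.+-assoc (indicator (f 1 <? f 0)) (descents a (f ∘ suc)) _))

length-filter-tabulate : ∀ {A : Set} {P : A → Set} (P? : Decidable P) m (h : Fin m → A) f →
  (∀ i → P (h i) ⇔ f (suc (toℕ i)) < f (toℕ i)) → length (filter P? (tabulate h)) ≡ descents m f
length-filter-tabulate P? zero    h f e = refl
length-filter-tabulate P? (suc m) h f e = trans (step (h zero) (tabulate (h ∘ suc)))
  (cong₂ ℕ._+_ (indicator-cong (P? (h zero)) (f 1 <? f 0) (e zero)) (length-filter-tabulate P? m (h ∘ suc) (f ∘ suc) (e ∘ suc)))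
  where
  step : ∀ x xs → length (filter P? (x ∷ xs)) ≡ indicator (P? x) ℕ.+ length (filter P? xs)
  step x xs with P? x
  ... | yes _ = refl
  ... | no  _ = refl

des-at : ∀ {m} (π : Permutation′ (suc m)) → des π ≡ descents m (π at_)
des-at {m} π = length-filter-tabulate (λ i → π ⟨$⟩ʳ suc i Fin.<? π ⟨$⟩ʳ inject₁ i) m id (π at_) λ i → equiv i
  where
  equiv : ∀ i → toℕ (π ⟨$⟩ʳ suc i) < toℕ (π ⟨$⟩ʳ inject₁ i) ⇔ π at suc (toℕ i) < π at toℕ i
  equiv i rewrite sym (at-toℕ π (suc i)) | sym (at-toℕ π (inject₁ i)) | Finₚ.toℕ-inject₁ i = mk⇔ id id

weight : ∀ {n} → Permutation′ n → Poly
weight π = s ^ des π * t ^ ides π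

module _ {j m n k} {π : Permutation′ n} {σ : Permutation′ (suc k)} {α : Permutation′ (suc m)} (S : Substitution j m π σ α) where
  open Substitution S

  -- `collapse` is monotone, so at worst it turns < into equality, and injectivity of σ excludes
  -- this for positions with different images.
  substitution-< : ∀ {x y} → x < n → y < n → collapse j m x ≢ collapse j m y →
    π at x < π at y ⇔ σ at collapse j m x < σ at collapse j m y
  substitution-< {x} {y} x<n y<n cx≢cy = mk⇔
    (λ lt → subst₂ _<_ (outer x<n) (outer y<n) (≤∧≢⇒< (collapse-mono (σ at j) m (<⇒≤ lt))
       λ e → cx≢cy (at-injective σ (trans (sym (outer x<n)) (trans e (outer y<n))))))
    (λ lt → collapse-reflects-< (σ at j) m (subst₂ _<_ (sym (outer x<n)) (sym (outer y<n)) lt))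

  substitution-<-inner : ∀ {y z} → y ≤ m → z ≤ m → π at (j ℕ.+ y) < π at (j ℕ.+ z) ⇔ α at y < α at z
  substitution-<-inner y≤m z≤m = mk⇔
    (λ lt → +-cancelˡ-< (σ at j) _ _ (subst₂ _<_ (inner y≤m) (inner z≤m) lt))
    (λ lt → subst₂ _<_ (sym (inner y≤m)) (sym (inner z≤m)) (+-monoʳ-< (σ at j) lt))

module _ {j m k} {π : Permutation′ (suc (k ℕ.+ m))} {σ : Permutation′ (suc k)} {α : Permutation′ (suc m)}
         (j≤k : j ≤ k) (S : Substitution j m π σ α) where
  open Substitution S

  -- Cut the adjacent pairs into the j pairs up to the start of the block, the m pairs inside it and
  -- the k - j pairs from its end on. The pairs entering and leaving the block compare as in σ,
  -- because the block fills an interval of values.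
  substitution-des : des π ≡ des σ ℕ.+ des α
  substitution-des rewrite des-at π | des-at σ | des-at α with k ∸ j in eq | m+[n∸m]≡n j≤k
  ... | r | refl = begin
      descents (j ℕ.+ r ℕ.+ m) (π at_)
        ≡⟨ cong (λ l → descents l (π at_)) (trans (ℕₚ.+-assoc j r m) (cong (j ℕ.+_) (ℕₚ.+-comm r m))) ⟩
      descents (j ℕ.+ (m ℕ.+ r)) (π at_)
        ≡⟨ descents-+ j (m ℕ.+ r) (π at_) ⟩
      descents j (π at_) ℕ.+ descents (m ℕ.+ r) (λ i → π at (j ℕ.+ i))
        ≡⟨ cong (descents j (π at_) ℕ.+_) (descents-+ m r (λ i → π at (j ℕ.+ i))) ⟩
      descents j (π at_) ℕ.+ (descents m (λ i → π at (j ℕ.+ i)) ℕ.+ descents r (λ i → π at (j ℕ.+ (m ℕ.+ i))))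
        ≡⟨ cong₂ ℕ._+_ (descents-cong j left) (cong₂ ℕ._+_ (descents-cong m middle) (descents-cong r right)) ⟩
      descents j (σ at_) ℕ.+ (descents m (α at_) ℕ.+ descents r (λ i → σ at (j ℕ.+ i)))
        ≡⟨ cong (descents j (σ at_) ℕ.+_) (ℕₚ.+-comm (descents m (α at_)) _) ⟩
      descents j (σ at_) ℕ.+ (descents r (λ i → σ at (j ℕ.+ i)) ℕ.+ descents m (α at_))
        ≡⟨ ℕₚ.+-assoc (descents j (σ at_)) _ _ ⟨
      descents j (σ at_) ℕ.+ descents r (λ i → σ at (j ℕ.+ i)) ℕ.+ descents m (α at_)
        ≡⟨ cong (ℕ._+ descents m (α at_)) (descents-+ j r (σ at_)) ⟨
      descents (j ℕ.+ r) (σ at_) ℕ.+ descents m (α at_) ∎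
    where
    open ≡-Reasoning
    n = suc (j ℕ.+ r ℕ.+ m)
    consecutive : ∀ {x y} → suc x < n → collapse j m x ≡ y → collapse j m (suc x) ≡ suc y →
      π at suc x < π at x ⇔ σ at suc y < σ at y
    consecutive {x} x<n refl e = subst (λ z → π at suc x < π at x ⇔ σ at z < σ at collapse j m x) e
      (substitution-< S x<n (<-trans (n<1+n _) x<n) (λ e′ → 1+n≢n (trans (sym e) e′)))
    left : ∀ {i} → i < j → π at suc i < π at i ⇔ σ at suc i < σ at i
    left i<j = consecutive (s≤s (≤-trans i<j (≤-trans (m≤m+n j r) (m≤m+n _ m)))) (collapse-before j m (<⇒≤ i<j)) (collapse-before j m i<j)
    middle : ∀ {i} → i < m → π at (j ℕ.+ suc i) < π at (j ℕ.+ i) ⇔ α at suc i < α at i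
    middle i<m = substitution-<-inner S i<m (<⇒≤ i<m)
    right : ∀ {i} → i < r → π at (j ℕ.+ (m ℕ.+ suc i)) < π at (j ℕ.+ (m ℕ.+ i)) ⇔ σ at (j ℕ.+ suc i) < σ at (j ℕ.+ i)
    right {i} i<r rewrite sym (ℕₚ.+-assoc j m (suc i)) | sym (ℕₚ.+-assoc j m i) | +-suc (j ℕ.+ m) i | +-suc j i =
      consecutive (s≤s (≤-trans (≤-reflexive (sym (+-suc (j ℕ.+ m) i))) (≤-trans (+-monoʳ-≤ (j ℕ.+ m) i<r)
        (≤-reflexive (trans (ℕₚ.+-assoc j m r) (trans (cong (j ℕ.+_) (ℕₚ.+-comm m r)) (sym (ℕₚ.+-assoc j r m))))))))
        (collapse-after j m i) (trans (cong (collapse j m) (sym (+-suc (j ℕ.+ m) i))) (trans (collapse-after j m (suc i)) (+-suc j i)))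

  substitution-unique : ∀ {π′} → Substitution j m π′ σ α → ∀ {x} → x < suc (k ℕ.+ m) → π at x ≡ π′ at x
  substitution-unique {π′} S′ {x} x<n with collapse j m x ≟ j
  ... | yes e with within-offset j m e
  ...   | e′ , z≤m = subst (λ i → π at i ≡ π′ at i) e′ (trans (inner z≤m) (sym (Substitution.inner S′ z≤m)))
  substitution-unique {π′} S′ {x} x<n | no ¬e = begin
    π at x                                                       ≡⟨ same π outer ⟨
    spread (σ at j) m (σ at collapse j m x)                      ≡⟨ same π′ (Substitution.outer S′) ⟩
    π′ at x ∎
    where
    open ≡-Reasoning
    same : ∀ (ρ : Permutation′ (suc (k ℕ.+ m))) → (∀ {x} → x < suc (k ℕ.+ m) → collapse (σ at j) m (ρ at x) ≡ σ at collapse j m x) →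
      spread (σ at j) m (σ at collapse j m x) ≡ ρ at x
    same ρ out = trans (cong (spread (σ at j) m) (sym (out x<n)))
      (spread-collapse (σ at j) m (ρ at x) λ e → ¬e (at-injective σ (trans (sym (out x<n)) e)))

substitution-ides : ∀ {j m k} {π : Permutation′ (suc (k ℕ.+ m))} {σ : Permutation′ (suc k)} {α : Permutation′ (suc m)} →
  j ≤ k → Substitution j m π σ α → ides π ≡ ides σ ℕ.+ ides α
substitution-ides {π = π} {σ} {α} j≤k S = substitution-des (at-≤ σ j≤k) (Substitution-flip {π = π} {σ} {α} S)

substitution-weight : ∀ {j m k} {π : Permutation′ (suc (k ℕ.+ m))} {σ : Permutation′ (suc k)} {α : Permutation′ (suc m)} →
  j ≤ k → Substitution j m π σ α → weight π ≋ weight σ * weight α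
substitution-weight {π = π} {σ} {α} j≤k S
  rewrite substitution-des j≤k S | substitution-ides {π = π} {σ} {α} j≤k S = ≋-trans
  (*-cong (^-homo s (des σ) (des α)) (^-homo t (ides σ) (ides α)))
  (interchange* (s ^ des σ) (s ^ des α) (t ^ ides σ) (t ^ ides α))
  where open import Algebra.Properties.CommutativeSemigroup (CommutativeSemiring.*-commutativeSemigroup polySemiring) renaming (interchange to interchange*)

module _ {j m k} {π : Permutation′ (suc (k ℕ.+ m))} (j≤k : j ≤ k)
         {σ σ′ : Permutation′ (suc k)} {α α′ : Permutation′ (suc m)}
         (S : Substitution j m π σ α) (S′ : Substitution j m π σ′ α′) where

  private
    -- v is the least value of the block.
    v≤v′ : ∀ {σ σ′ : Permutation′ (suc k)} {α α′ : Permutation′ (suc m)} →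
      Substitution j m π σ α → Substitution j m π σ′ α′ → σ at j ≤ σ′ at j
    v≤v′ {σ} {σ′} {α} {α′} S S′ = begin
      σ at j                        ≤⟨ m≤m+n (σ at j) _ ⟩
      σ at j ℕ.+ α at z             ≡⟨ Substitution.inner S z≤m ⟨
      π at (j ℕ.+ z)                ≡⟨ Substitution.inner S′ z≤m ⟩
      σ′ at j ℕ.+ α′ at z           ≡⟨ cong (σ′ at j ℕ.+_) (at-flip′ α′ 0) ⟩
      σ′ at j ℕ.+ 0                 ≡⟨ ℕₚ.+-identityʳ _ ⟩
      σ′ at j                       ∎
      where
      open ≤-Reasoning
      z = flip α′ at 0
      z≤m = at-≤ (flip α′) z≤n
    v≡v′ : σ at j ≡ σ′ at j
    v≡v′ = ≤-antisym (v≤v′ S S′) (v≤v′ S′ S)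

  substitution-injective : σ Perm.≈ σ′ × α Perm.≈ α′
  substitution-injective =
    at-≈ {π = σ} {σ′} (λ {y} y<k → begin
      σ at y                                             ≡⟨ cong (σ at_) (collapse-spread j m y) ⟨
      σ at collapse j m (spread j m y)                   ≡⟨ Substitution.outer S (s≤s (spread-bound j m (s≤s⁻¹ y<k))) ⟨
      collapse (σ at j) m (π at spread j m y)            ≡⟨ cong (λ v → collapse v m (π at spread j m y)) v≡v′ ⟩
      collapse (σ′ at j) m (π at spread j m y)           ≡⟨ Substitution.outer S′ (s≤s (spread-bound j m (s≤s⁻¹ y<k))) ⟩
      σ′ at collapse j m (spread j m y)                  ≡⟨ cong (σ′ at_) (collapse-spread j m y) ⟩
      σ′ at y                                            ∎) ,
    at-≈ {π = α} {α′} (λ {z} z<m → +-cancelˡ-≡ (σ at j) _ _ (begin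
      σ at j ℕ.+ α at z                                  ≡⟨ Substitution.inner S (s≤s⁻¹ z<m) ⟨
      π at (j ℕ.+ z)                                     ≡⟨ Substitution.inner S′ (s≤s⁻¹ z<m) ⟩
      σ′ at j ℕ.+ α′ at z                                ≡⟨ cong (ℕ._+ α′ at z) v≡v′ ⟨
      σ at j ℕ.+ α′ at z                                 ∎))
    where open ≡-Reasoning

Substitution-resp : ∀ {j m n k} {π π′ : Permutation′ n} {σ σ′ : Permutation′ (suc k)} {α α′ : Permutation′ (suc m)} →
  π Perm.≈ π′ → σ Perm.≈ σ′ → α Perm.≈ α′ → Substitution j m π σ α → Substitution j m π′ σ′ α′
Substitution-resp {j} {m} {π = π} {π′} {σ} {σ′} {α} {α′} e₁ e₂ e₃ S = record
  { outer = λ {x} x<n → trans (cong₂ (λ v w → collapse v m w) (sym (σ≡ j)) (sym (π≡ x))) (trans (outer x<n) (σ≡ (collapse j m x)))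
  ; inner = λ {z} z≤m → trans (sym (π≡ _)) (trans (inner z≤m) (cong₂ ℕ._+_ (σ≡ j) (≈-at {π = α} {α′} e₃ z)))
  }
  where
  open Substitution S
  π≡ = ≈-at {π = π} {π′} e₁
  σ≡ = ≈-at {π = σ} {σ′} e₂

-- Blocks

record Enumeration (n : ℕ) (xs : List (Permutation′ n)) : Set where
  field
    complete : ∀ (π : Permutation′ n) → ∃ λ ρ → ρ ∈ xs × ρ Perm.≈ π
    unique   : AllPairs (λ π ρ → ¬ π Perm.≈ ρ) xs

permutations-enumeration : ∀ n → Enumeration n (permutations n)
permutations-enumeration n = record
  { complete = λ π → find (permutations-complete n π)
  ; unique   = permutations-unique n
  }

≈-sym : ∀ {n} {π ρ : Permutation′ n} → π Perm.≈ ρ → ρ Perm.≈ π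
≈-sym e i = sym (e i)

Inside : ℕ → ℕ → ℕ → Set
Inside i i′ x = i ≤ x × x ≤ i′

inside? : ∀ i i′ x → Dec (Inside i i′ x)
inside? i i′ x = i ≤? x ×-dec x ≤? i′

-- An interval of positions is a block iff no value outside separates two values inside.
Convex : ∀ {n} → Permutation′ n → ℕ → ℕ → Set
Convex {n} π i i′ = ∀ {x} → x < n → ∀ {y} → y < n → ∀ {z} → z < n →
  Inside i i′ x → Inside i i′ y → ¬ Inside i i′ z → π at z < π at x → π at z < π at y

opaque
  convex? : ∀ {n} (π : Permutation′ n) i i′ → Dec (Convex π i i′)
  convex? {n} π i i′ = allUpTo? (λ x → allUpTo? (λ y → allUpTo? (λ z →
    inside? i i′ x →-dec (inside? i i′ y →-dec (¬? (inside? i i′ z) →-dec (π at z <? π at x →-dec π at z <? π at y)))) n) n) n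

argmin : ∀ (f : ℕ → ℕ) m → ∃ λ z₀ → z₀ ≤ m × ∀ {z} → z ≤ m → f z₀ ≤ f z
argmin f zero    = 0 , z≤n , λ { z≤n → ≤-refl }
argmin f (suc m) with argmin f m
... | z₀ , z₀≤m , least with f z₀ ≤? f (suc m)
...   | yes le = z₀ , m≤n⇒m≤1+n z₀≤m , λ z≤ → case-≤ z≤
  where
  case-≤ : ∀ {z} → z ≤ suc m → f z₀ ≤ f z
  case-≤ {z} z≤ with m≤n⇒m<n∨m≡n z≤
  ... | inj₁ z<   = least (s≤s⁻¹ z<)
  ... | inj₂ refl = le
...   | no nle = suc m , ≤-refl , λ z≤ → case-≤ z≤
  where
  case-≤ : ∀ {z} → z ≤ suc m → f (suc m) ≤ f z
  case-≤ {z} z≤ with m≤n⇒m<n∨m≡n z≤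
  ... | inj₁ z<   = ≤-trans (<⇒≤ (≰⇒> nle)) (least (s≤s⁻¹ z<))
  ... | inj₂ refl = ≤-refl

argmax : ∀ (f : ℕ → ℕ) m → ∃ λ z₁ → z₁ ≤ m × ∀ {z} → z ≤ m → f z ≤ f z₁
argmax f zero    = 0 , z≤n , λ { z≤n → ≤-refl }
argmax f (suc m) with argmax f m
... | z₁ , z₁≤m , greatest with f (suc m) ≤? f z₁
...   | yes le = z₁ , m≤n⇒m≤1+n z₁≤m , λ z≤ → case-≤ z≤
  where
  case-≤ : ∀ {z} → z ≤ suc m → f z ≤ f z₁
  case-≤ {z} z≤ with m≤n⇒m<n∨m≡n z≤
  ... | inj₁ z<   = greatest (s≤s⁻¹ z<)
  ... | inj₂ refl = le
...   | no nle = suc m , ≤-refl , λ z≤ → case-≤ z≤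
  where
  case-≤ : ∀ {z} → z ≤ suc m → f z ≤ f (suc m)
  case-≤ {z} z≤ with m≤n⇒m<n∨m≡n z≤
  ... | inj₁ z<   = ≤-trans (greatest (s≤s⁻¹ z<)) (<⇒≤ (≰⇒> nle))
  ... | inj₂ refl = ≤-refl

pigeonhole-≤ : ∀ {a b} (f : ℕ → ℕ) → (∀ {x} → x ≤ a → f x ≤ b) →
  (∀ {x y} → x ≤ a → y ≤ a → f x ≡ f y → x ≡ y) → a ≤ b
pigeonhole-≤ {a} {b} f f≤ f-inj = s≤s⁻¹ (Finₚ.injective⇒≤ {f = g} λ {x} {y} e → Finₚ.toℕ-injective
  (f-inj (s≤s⁻¹ (Finₚ.toℕ<n x)) (s≤s⁻¹ (Finₚ.toℕ<n y))
    (trans (sym (Finₚ.toℕ-fromℕ< _)) (trans (cong toℕ e) (Finₚ.toℕ-fromℕ< _)))))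
  where
  g : Fin (suc a) → Fin (suc b)
  g i = fromℕ< (s≤s (f≤ (s≤s⁻¹ (Finₚ.toℕ<n i))))

abstract
  -- Let lo and hi be the least and the greatest value in the block. A value between them taken
  -- outside the block would be below hi, hence by convexity below lo. So the positions of the block
  -- and the values from lo to hi inject into each other, which gives hi = lo + m.
  convex⇒intervalBlock : ∀ {j m k} → j ≤ k → (π : Permutation′ (suc (k ℕ.+ m))) → Convex π j (j ℕ.+ m) →
    ∃ λ v → v ≤ k × IntervalBlock j v m π
  convex⇒intervalBlock {j} {m} {k} j≤k π convex with argmin (λ z → π at (j ℕ.+ z)) m | argmax (λ z → π at (j ℕ.+ z)) m
  ... | z₀ , z₀≤m , least | z₁ , z₁≤m , greatest = lo , lo≤k , λ {x} x<n → into x<n , onto x<n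
    where
    n lo hi : ℕ
    n = suc (k ℕ.+ m)
    lo = π at (j ℕ.+ z₀)
    hi = π at (j ℕ.+ z₁)
    pos< : ∀ {z} → z ≤ m → j ℕ.+ z < n
    pos< z≤m = s≤s (+-mono-≤ j≤k z≤m)
    ins : ∀ {z} → z ≤ m → Inside j (j ℕ.+ m) (j ℕ.+ z)
    ins z≤m = m≤m+n j _ , +-monoʳ-≤ j z≤m
    between : ∀ {w} → lo ≤ w → w ≤ hi → Inside j (j ℕ.+ m) (flip π at w)
    between {w} lo≤w w≤hi with inside? j (j ℕ.+ m) (flip π at w)
    ... | yes i = i
    ... | no ¬i = ⊥-elim (<⇒≱ below lo≤w)
      where
      w<n : w < n
      w<n = ≤-<-trans w≤hi (at-< π (pos< z₁≤m))
      w≢hi : w ≢ hi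
      w≢hi refl = ¬i (subst (Inside j (j ℕ.+ m)) (sym (at-flip π _)) (ins z₁≤m))
      below : w < lo
      below = subst (_< lo) (at-flip′ π w) (convex (pos< z₁≤m) (pos< z₀≤m) (at-< (flip π) w<n) (ins z₁≤m) (ins z₀≤m) ¬i
        (subst (_< hi) (sym (at-flip′ π w)) (≤∧≢⇒< w≤hi w≢hi)))
    lo≤hi : lo ≤ hi
    lo≤hi = least z₁≤m
    hi∸lo≤m : hi ∸ lo ≤ m
    hi∸lo≤m = pigeonhole-≤ (λ i → flip π at (lo ℕ.+ i) ∸ j)
      (λ i≤ → m≤n+o⇒m∸n≤o _ j (proj₂ (bt i≤)))
      (λ {x} {y} x≤ y≤ e → +-cancelˡ-≡ lo x y (at-injective (flip π) (∸-cancelʳ-≡ (proj₁ (bt x≤)) (proj₁ (bt y≤)) e)))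
      where
      bt : ∀ {i} → i ≤ hi ∸ lo → Inside j (j ℕ.+ m) (flip π at (lo ℕ.+ i))
      bt {i} i≤ = between (m≤m+n lo i) (≤-trans (+-monoʳ-≤ lo i≤) (≤-reflexive (m+[n∸m]≡n lo≤hi)))
    m≤hi∸lo : m ≤ hi ∸ lo
    m≤hi∸lo = pigeonhole-≤ (λ z → π at (j ℕ.+ z) ∸ lo) (λ z≤ → ∸-monoˡ-≤ lo (greatest z≤))
      (λ {x} {y} x≤ y≤ e → +-cancelˡ-≡ j x y (at-injective π (∸-cancelʳ-≡ (least x≤) (least y≤) e)))
    hi≡ : lo ℕ.+ m ≡ hi
    hi≡ = trans (cong (lo ℕ.+_) (≤-antisym m≤hi∸lo hi∸lo≤m)) (m+[n∸m]≡n lo≤hi)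
    lo≤k : lo ≤ k
    lo≤k = +-cancelʳ-≤ m lo k (≤-trans (≤-reflexive hi≡) (s≤s⁻¹ (at-< π (pos< z₁≤m))))
    into : ∀ {x} → x < n → collapse j m x ≡ j → collapse lo m (π at x) ≡ lo
    into {x} x<n e with within-offset j m e
    ... | e′ , z≤m = subst (λ i → collapse lo m (π at i) ≡ lo) e′
      (within⇒collapse≡ lo m (least z≤m) (≤-trans (greatest z≤m) (≤-reflexive (sym hi≡))))
    onto : ∀ {x} → x < n → collapse lo m (π at x) ≡ lo → collapse j m x ≡ j
    onto {x} x<n e with collapse≡⇒within lo m e
    ... | lo≤ , ≤lo+m with subst (Inside j (j ℕ.+ m)) (at-flip π x) (between lo≤ (≤-trans ≤lo+m (≤-reflexive hi≡)))
    ... | j≤x , x≤j+m = within⇒collapse≡ j m j≤x x≤j+m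

opaque
  weightSum : ∀ {n} {P : Permutation′ n → Set} → Decidable P → Poly
  weightSum {n} P? = ∑ (filter P? (permutations n)) weight

module _ {j m k} (j≤k : j ≤ k) {P : Permutation′ (suc (k ℕ.+ m)) → Set} {Q : Permutation′ (suc k) → Set} {T : Permutation′ (suc m) → Set}
  (P? : Decidable P) (Q? : Decidable Q) (T? : Decidable T)
  (convex : ∀ {π} → P π → Convex π j (j ℕ.+ m))
  (P⇒ : ∀ {π σ α} → Substitution j m π σ α → P π → Q σ × T α)
  (⇒P : ∀ {π σ α} → Substitution j m π σ α → Q σ → T α → P π) where

  -- All convolution identities are instances of this one bijection between π and pairs (σ, α):
  -- `convex` provides the block to contract, and `P⇒` and `⇒P` match the classes. The permutations
  -- constructed on either side are replaced by their listed representatives.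
  ∑-substitution : ∀ {xs ys zs} → Enumeration _ xs → Enumeration _ ys → Enumeration _ zs →
    ∑ (filter P? xs) weight ≋ ∑ (filter Q? ys) weight * ∑ (filter T? zs) weight
  ∑-substitution {xs} {ys} {zs} X Y Z = ≋-trans
    (∑-bijection R (filter P? xs) (cartesianProduct (filter Q? ys) (filter T? zs))
      (AllPairs.map (λ {π} {π′} π≉π′ (σ , α) S S′ → π≉π′ (at-≈ {π = π} {π′} (substitution-unique j≤k S S′)))
        (AllPairsₚ.filter⁺ P? (unique X)))
      (AllPairs.map distinct (allPairs-cartesianProduct (AllPairsₚ.filter⁺ Q? (unique Y)) (AllPairsₚ.filter⁺ T? (unique Z))))
      total surjective (λ {π} {(σ , α)} S → substitution-weight {π = π} {σ} {α} j≤k S))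
    (∑-product (filter Q? ys) (filter T? zs) weight weight)
    where
    open Enumeration
    R : Permutation′ (suc (k ℕ.+ m)) → Permutation′ (suc k) × Permutation′ (suc m) → Set
    R π (σ , α) = Substitution j m π σ α
    distinct : ∀ {σα σα′ : Permutation′ (suc k) × Permutation′ (suc m)} →
      ¬ proj₁ σα Perm.≈ proj₁ σα′ ⊎ ¬ proj₂ σα Perm.≈ proj₂ σα′ → ∀ π → R π σα → ¬ R π σα′
    distinct (inj₁ σ≉) π S S′ = σ≉ (proj₁ (substitution-injective j≤k S S′))
    distinct (inj₂ α≉) π S S′ = α≉ (proj₂ (substitution-injective j≤k S S′))
    total : ∀ {π} → π ∈ filter P? xs →
      ∃ λ σα → σα ∈ cartesianProduct (filter Q? ys) (filter T? zs) × R π σα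
    total {π} π∈ with ∈-filter⁻ P? {xs = xs} π∈
    ... | _ , Pπ with convex⇒intervalBlock j≤k π (convex Pπ)
    ... | v , v≤k , B with decompose v≤k j≤k π B
    ... | σ , α , S with complete Y σ | complete Z α
    ... | σ′ , σ′∈ , σ′≈σ | α′ , α′∈ , α′≈α = (σ′ , α′) ,
      ∈-cartesianProduct⁺ (∈-filter⁺ Q? σ′∈ (proj₁ (P⇒ S′ Pπ))) (∈-filter⁺ T? α′∈ (proj₂ (P⇒ S′ Pπ))) , S′
      where
      S′ : Substitution j m π σ′ α′
      S′ = Substitution-resp {π = π} {π} {σ} {σ′} {α} {α′} (λ _ → refl) (≈-sym {π = σ′} {σ} σ′≈σ) (≈-sym {π = α′} {α} α′≈α) S
    surjective : ∀ {σα} → σα ∈ cartesianProduct (filter Q? ys) (filter T? zs) →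
      ∃ λ π → π ∈ filter P? xs × R π σα
    surjective {σ , α} σα∈ with ∈-cartesianProduct⁻ (filter Q? ys) (filter T? zs) σα∈
    ... | σ∈ , α∈ with substitute j≤k σ α
    ... | π , S with complete X π
    ... | π′ , π′∈ , π′≈π = π′ , ∈-filter⁺ P? π′∈
        (⇒P S′ (proj₂ (∈-filter⁻ Q? {xs = ys} σ∈)) (proj₂ (∈-filter⁻ T? {xs = zs} α∈))) , S′
      where
      S′ : Substitution j m π′ σ α
      S′ = Substitution-resp {π = π} {π′} {σ} {σ} {α} {α} (≈-sym {π = π′} {π} π′≈π) (λ _ → refl) (λ _ → refl) S

  opaque
    unfolding weightSum
    weightSum-substitution : weightSum P? ≋ weightSum Q? * weightSum T?
    weightSum-substitution = ∑-substitution (permutations-enumeration _) (permutations-enumeration _) (permutations-enumeration _)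

-- Direct and skew sums

module _ (j m : ℕ) where

  -- With the next lemma: `spread` is left adjoint to `collapse`. So the positions before
  -- `spread j m a` are exactly those collapsed to positions before `a`, which carries cuts and
  -- intervals from σ to π and back.
  collapse-<⇒<-spread : ∀ {x a} → collapse j m x < a → x < spread j m a
  collapse-<⇒<-spread {x} {a} cx<a = ≰⇒> λ sa≤x → <⇒≱ cx<a (subst (_≤ collapse j m x) (collapse-spread j m a) (collapse-mono j m sa≤x))

  <-spread⇒collapse-< : ∀ {x a} → x < spread j m a → collapse j m x < a
  <-spread⇒collapse-< {x} {a} x<sa with a ≟ j
  ... | yes refl = subst (_< j) (sym (collapse-before j m (<⇒≤ x<j))) x<j
    where x<j = subst (x <_) (spread-before j m ≤-refl) x<sa
  ... | no a≢j = ≤∧≢⇒< (subst (collapse j m x ≤_) (collapse-spread j m a) (collapse-mono j m (<⇒≤ x<sa)))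
    λ e → <⇒≢ x<sa (trans (sym (spread-collapse j m x (λ e′ → a≢j (trans (sym e) e′)))) (cong (spread j m) e))

  spread-<⇒< : ∀ {x a} → spread j m x < spread j m a → x < a
  spread-<⇒< {x} lt = subst (_< _) (collapse-spread j m x) (<-spread⇒collapse-< lt)

  spread-mono-< : ∀ {x a} → x < a → spread j m x < spread j m a
  spread-mono-< {x} x<a = collapse-<⇒<-spread (subst (_< _) (sym (collapse-spread j m x)) x<a)

  spread-mono-≤ : ∀ {x a} → x ≤ a → spread j m x ≤ spread j m a
  spread-mono-≤ x≤a = ≮⇒≥ λ lt → <⇒≱ (spread-<⇒< lt) x≤a

  spread-≤⇒≤-collapse : ∀ {x a} → spread j m a ≤ x → a ≤ collapse j m x
  spread-≤⇒≤-collapse le = ≮⇒≥ λ lt → <⇒≱ (collapse-<⇒<-spread lt) le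

  opaque
    unfolding spread
    y≤spread : ∀ y → y ≤ spread j m y
    y≤spread y with y ≤? j
    ... | yes _ = ≤-refl
    ... | no  _ = m≤m+n y m

data Direction : Set where
  ascending descending : Direction

Below : Direction → ℕ → ℕ → Set
Below ascending  a b = a < b
Below descending a b = b < a

below? : ∀ d a b → Dec (Below d a b)
below? ascending  a b = a <? b
below? descending a b = b <? a

-- π is a direct sum (ascending) or a skew sum (descending) whose first summand has length a.
Split : ∀ {n} → Direction → Permutation′ n → ℕ → Set
Split {n} d π a = ∀ {x} → x < a → ∀ {y} → y < n → a ≤ y → Below d (π at x) (π at y)

opaque
  split? : ∀ {n} d (π : Permutation′ n) a → Dec (Split d π a)
  split? {n} d π a = allUpTo? (λ x → allUpTo? (λ y → a ≤? y →-dec below? d (π at x) (π at y)) n) a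

Decomposable : ∀ {n} → Direction → Permutation′ n → Set
Decomposable {n} d π = ∃ λ a → a < n × 0 < a × Split d π a

opaque
  decomposable? : ∀ {n} d → Decidable (Decomposable {n} d)
  decomposable? {n} d π = anyUpTo? (λ a → 0 <? a ×-dec split? d π a) n

module _ {j m n k} {π : Permutation′ n} {σ : Permutation′ (suc k)} {α : Permutation′ (suc m)} (S : Substitution j m π σ α) where

  substitution-Below : ∀ d {x y} → x < n → y < n → collapse j m x ≢ collapse j m y →
    Below d (π at x) (π at y) ⇔ Below d (σ at collapse j m x) (σ at collapse j m y)
  substitution-Below ascending  x<n y<n cx≢cy = substitution-< S x<n y<n cx≢cy
  substitution-Below descending x<n y<n cx≢cy = substitution-< S y<n x<n (cx≢cy ∘ sym)

  substitution-Below-inner : ∀ d {y z} → y ≤ m → z ≤ m →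
    Below d (π at (j ℕ.+ y)) (π at (j ℕ.+ z)) ⇔ Below d (α at y) (α at z)
  substitution-Below-inner ascending  y≤m z≤m = substitution-<-inner S y≤m z≤m
  substitution-Below-inner descending y≤m z≤m = substitution-<-inner S z≤m y≤m

Below-subst : ∀ d {a b c e} → Below d a b → a ≡ c → b ≡ e → Below d c e
Below-subst d lt refl refl = lt

convex-prefix : ∀ {n} d (π : Permutation′ n) {a} → Split d π (suc a) → Convex π 0 a
convex-prefix ascending  π split x<n y<n z<n (_ , x≤a) (_ , y≤a) z∉ πz<πx = ⊥-elim (<-asym πz<πx (split (s≤s x≤a) z<n (≰⇒> λ z≤a → z∉ (z≤n , z≤a))))
convex-prefix descending π split x<n y<n z<n (_ , x≤a) (_ , y≤a) z∉ πz<πx = split (s≤s y≤a) z<n (≰⇒> λ z≤a → z∉ (z≤n , z≤a))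

convex-suffix : ∀ {m} d (π : Permutation′ (suc m)) {a} → Split d π a → Convex π a m
convex-suffix ascending  π {a} split x<n y<n z<n (a≤x , _) (a≤y , _) z∉ πz<πx = split (≰⇒> λ a≤z → z∉ (a≤z , s≤s⁻¹ z<n)) y<n a≤y
convex-suffix descending π {a} split x<n y<n z<n (a≤x , _) (a≤y , _) z∉ πz<πx = ⊥-elim (<-asym πz<πx (split (≰⇒> λ a≤z → z∉ (a≤z , s≤s⁻¹ z<n)) x<n a≤x))

FirstSplit : ∀ {n} → Direction → ℕ → Permutation′ n → Set
FirstSplit {n} d a π = a < n × (0 < a × Split d π a) × (∀ {b} → b < a → ¬ (0 < b × Split d π b))

opaque
  firstSplit? : ∀ {n} d a → Decidable (FirstSplit {n} d a)
  firstSplit? {n} d a π = a <? n ×-dec (0 <? a ×-dec split? d π a) ×-dec allUpTo? (λ b → ¬? (0 <? b ×-dec split? d π b)) a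

Indivisible : ∀ {n} → Direction → Permutation′ n → Set
Indivisible d π = ¬ Decomposable d π

indivisible? : ∀ {n} d → Decidable (Indivisible {n} d)
indivisible? d π = ¬? (decomposable? d π)

-- Contract the first summand. The cut behind it becomes the cut of σ after its first entry. An
-- earlier cut of π is the same as a cut of α, since everything behind the block lies on the right
-- side anyway.
firstSplitSum : ∀ d m k → 1 ≤ k →
  weightSum {suc (k ℕ.+ m)} (firstSplit? d (suc m)) ≋ weightSum {suc k} (λ σ → split? d σ 1) * weightSum {suc m} (indivisible? d)
firstSplitSum d m k 1≤k = weightSum-substitution {0} {m} {k} z≤n (firstSplit? d (suc m)) (λ σ → split? d σ 1) (indivisible? d)
  (λ {π} (_ , (_ , split) , _) → convex-prefix d π split) to from
  where
  n = suc (k ℕ.+ m)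
  to : ∀ {π σ α} → Substitution 0 m {n} {k} π σ α → FirstSplit d (suc m) π → Split d σ 1 × Indivisible d α
  to {π} {σ} {α} S (_ , (_ , split) , first) = splitσ , λ (b , b< , 0<b , splitα) → first b< (0<b , lift b< splitα)
    where
    splitσ : Split d σ 1
    splitσ {zero} (s≤s z≤n) {y} y<k 1≤y = Below-subst d
      (Equivalence.to (substitution-Below {π = π} {σ} {α} S d (s≤s z≤n) (s≤s (spread-bound 0 m (s≤s⁻¹ y<k)))
        λ e → <⇒≢ 1≤y (trans (sym (collapse-before 0 m z≤n)) (trans e (collapse-spread 0 m y))))
        (split (s≤s z≤n) (s≤s (spread-bound 0 m (s≤s⁻¹ y<k))) (≤-trans (+-monoˡ-≤ m 1≤y) (≤-reflexive (sym (spread-after 0 m 1≤y))))))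
      (cong (σ at_) (collapse-before 0 m z≤n)) (cong (σ at_) (collapse-spread 0 m y))
    lift : ∀ {b} → b < suc m → Split d α b → Split d π b
    lift b< splitα {x} x<b {y} y<n b≤y with y ≤? m
    ... | yes y≤m = Equivalence.from (substitution-Below-inner {π = π} {σ} {α} S d (<⇒≤ (<-≤-trans x<b (s≤s⁻¹ b<))) y≤m) (splitα x<b (s≤s y≤m) b≤y)
    ... | no  y≰m = split (<-trans x<b b<) y<n (≰⇒> y≰m)
  from : ∀ {π σ α} → Substitution 0 m {n} {k} π σ α → Split d σ 1 → Indivisible d α → FirstSplit d (suc m) π
  from {π} {σ} {α} S splitσ indec = s≤s (+-monoˡ-≤ m 1≤k) , (s≤s z≤n , splitπ) , λ {b} b< (0<b , split) → indec (b , b< , 0<b , restrict b< split)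
    where
    splitπ : Split d π (suc m)
    splitπ {x} x<a {y} y<n a≤y = Equivalence.from (substitution-Below {π = π} {σ} {α} S d (<-trans x<a (≤-<-trans a≤y y<n)) y<n (<⇒≢ cx<cy))
      (splitσ cx<1 (s≤s (collapse-bound 0 m z≤n (s≤s⁻¹ y<n))) 1≤cy)
      where
      cx<1 : collapse 0 m x < 1
      cx<1 = <-spread⇒collapse-< 0 m (subst (x <_) (sym (spread-after 0 m (s≤s z≤n))) x<a)
      1≤cy : 1 ≤ collapse 0 m y
      1≤cy = spread-≤⇒≤-collapse 0 m (subst (_≤ y) (sym (spread-after 0 m (s≤s z≤n))) a≤y)
      cx<cy = <-≤-trans cx<1 1≤cy
    restrict : ∀ {b} → b < suc m → Split d π b → Split d α b
    restrict b< split x<b y<m b≤y = Equivalence.to (substitution-Below-inner {π = π} {σ} {α} S d (<⇒≤ (<-≤-trans x<b (s≤s⁻¹ b<))) (s≤s⁻¹ y<m))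
      (split x<b (<-≤-trans y<m (s≤s (m≤n+m m k))) b≤y)

any? : ∀ {n} → Decidable {A = Permutation′ n} (λ _ → ⊤)
any? π = yes tt

-- All positions from 1 on form a block; contracting it leaves 12 or 21, and the block itself is
-- arbitrary.
afterFirstSum : ∀ d m → weightSum {suc (suc m)} (λ σ → split? d σ 1) ≋ weightSum {2} (λ σ → split? d σ 1) * weightSum {suc m} any?
afterFirstSum d m = weightSum-substitution {1} {m} {1} ≤-refl (λ σ → split? d σ 1) (λ σ → split? d σ 1) any?
  (λ {π} split → convex-suffix d π split) to from
  where
  n = suc (suc m)
  c1 : ∀ {y} → y < n → 1 ≤ y → collapse 1 m y ≡ 1
  c1 y<n 1≤y = within⇒collapse≡ 1 m 1≤y (s≤s⁻¹ y<n)
  ≢ : ∀ {y} → y < n → 1 ≤ y → collapse 1 m 0 ≢ collapse 1 m y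
  ≢ y<n 1≤y e = 0≢1+n (trans (trans (sym (collapse-before 1 m z≤n)) e) (c1 y<n 1≤y))
  to : ∀ {π σ α} → Substitution 1 m {n} {1} π σ α → Split d π 1 → Split d σ 1 × ⊤
  to {π} {σ} {α} S split = splitσ , tt
    where
    splitσ : Split d σ 1
    splitσ {zero} (s≤s z≤n) {suc zero} (s≤s (s≤s z≤n)) (s≤s z≤n) = Below-subst d
      (Equivalence.to (substitution-Below {π = π} {σ} {α} S d (s≤s z≤n) (s≤s (s≤s z≤n)) (≢ (s≤s (s≤s z≤n)) ≤-refl))
        (split (s≤s z≤n) (s≤s (s≤s z≤n)) ≤-refl))
      (cong (σ at_) (collapse-before 1 m z≤n)) (cong (σ at_) (c1 (s≤s (s≤s z≤n)) ≤-refl))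
  from : ∀ {π σ α} → Substitution 1 m {n} {1} π σ α → Split d σ 1 → ⊤ → Split d π 1
  from {π} {σ} {α} S split _ {zero} (s≤s z≤n) {y} y<n 1≤y =
    Equivalence.from (substitution-Below {π = π} {σ} {α} S d (s≤s z≤n) y<n (≢ y<n 1≤y))
      (Below-subst d (split (s≤s z≤n) (s≤s (s≤s z≤n)) ≤-refl) (cong (σ at_) (sym (collapse-before 1 m z≤n))) (cong (σ at_) (sym (c1 y<n 1≤y))))

-- The weight of 12 or 21: what the junction between two summands contributes.
linkWeight : Direction → Poly
linkWeight ascending  = 1#
linkWeight descending = s * t

opaque
  unfolding _at_ weightSum split?
  linkSum : ∀ d → weightSum {2} (λ σ → split? d σ 1) ≋ linkWeight d
  linkSum ascending  = mk≋ λ _ _ → refl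
  linkSum descending = mk≋ λ _ _ → refl

opaque
  unfolding weightSum
  anySum : ∀ n → weightSum {n} any? ≡ twoSidedEulerian n
  anySum n = cong (λ xs → ∑ xs weight) (filter-all any? (All.universal (λ _ → tt) (permutations n)))

-- Contracting a maximal block

Proper : ∀ {n} → Permutation′ n → ℕ → ℕ → Set
Proper {n} π i i′ = i < i′ × ¬ (i ≡ 0 × suc i′ ≡ n) × Convex π i i′

opaque
  proper? : ∀ {n} (π : Permutation′ n) i i′ → Dec (Proper π i i′)
  proper? {n} π i i′ = i <? i′ ×-dec ¬? (i ≟ 0 ×-dec suc i′ ≟ n) ×-dec convex? π i i′

ProperFrom : ∀ {n} → ℕ → Permutation′ n → Set
ProperFrom {n} j π = ∀ {i} → i < n → ∀ {i′} → i′ < n → i < j → ¬ Proper π i i′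

opaque
  properFrom? : ∀ {n} j → Decidable (ProperFrom {n} j)
  properFrom? {n} j π = allUpTo? (λ i → allUpTo? (λ i′ → i <? j →-dec ¬? (proper? π i i′)) n) n

Connected : ∀ {n} → Permutation′ n → Set
Connected π = ∀ d → Indivisible d π

opaque
  connected? : ∀ {n} → Decidable (Connected {n})
  connected? π = map′ (λ { (u , v) ascending → u ; (u , v) descending → v }) (λ f → f ascending , f descending)
    (indivisible? ascending π ×-dec indivisible? descending π)

-- The class whose weight sum is D j in the overview.
Reduced : ∀ {n} → ℕ → Permutation′ n → Set
Reduced j π = Connected π × ProperFrom j π

opaque
  reduced? : ∀ {n} j → Decidable (Reduced {n} j)
  reduced? j π = connected? π ×-dec properFrom? j π

-- Unlike `Proper` this admits m = 0: the singleton is the largest block at j if no proper block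
-- starts there, so from size 2 on a largest one always exists.
BlockAt : ∀ {n} → ℕ → ℕ → Permutation′ n → Set
BlockAt {n} j m π = j ℕ.+ m < n × ¬ (j ≡ 0 × suc (j ℕ.+ m) ≡ n) × Convex π j (j ℕ.+ m)

opaque
  blockAt? : ∀ {n} j m → Decidable (BlockAt {n} j m)
  blockAt? {n} j m π = j ℕ.+ m <? n ×-dec ¬? (j ≟ 0 ×-dec suc (j ℕ.+ m) ≟ n) ×-dec convex? π j (j ℕ.+ m)

-- The largest block other than the whole permutation that starts at position j has length m + 1.
MaximalBlock : ∀ {n} → ℕ → ℕ → Permutation′ n → Set
MaximalBlock {n} j m π = Reduced j π × BlockAt j m π × (∀ {i′} → i′ < n → j ℕ.+ m < i′ → ¬ Proper π j i′)

opaque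
  maximalBlock? : ∀ {n} j m → Decidable (MaximalBlock {n} j m)
  maximalBlock? {n} j m π = reduced? j π ×-dec blockAt? j m π ×-dec allUpTo? (λ i′ → j ℕ.+ m <? i′ →-dec ¬? (proper? π j i′)) n

module _ {j m k} (j≤k : j ≤ k) {π : Permutation′ (suc (k ℕ.+ m))} {σ : Permutation′ (suc k)} {α : Permutation′ (suc m)}
         (S : Substitution j m π σ α) where

  private
    n : ℕ
    n = suc (k ℕ.+ m)

    c e : ℕ → ℕ
    c = collapse j m
    e = spread j m

    spread-< : ∀ {y} → y < suc k → e y < n
    spread-< y<k = s≤s (spread-bound j m (s≤s⁻¹ y<k))

    collapse-< : ∀ {x} → x < n → c x < suc k
    collapse-< x<n = s≤s (collapse-bound j m j≤k (s≤s⁻¹ x<n))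

    spread-total : e (suc k) ≡ n
    spread-total = spread-after j m (s≤s j≤k)

    below : ∀ d {x y x₀ y₀} → x < n → y < n → c x ≡ x₀ → c y ≡ y₀ → x₀ ≢ y₀ →
      Below d (π at x) (π at y) ⇔ Below d (σ at x₀) (σ at y₀)
    below d x<n y<n refl refl ≢ = substitution-Below {π = π} {σ} {α} S d x<n y<n ≢

  pull-split : ∀ d {a} → Split d σ a → Split d π (e a)
  pull-split d {a} split {x} x<ea {y} y<n ea≤y = Equivalence.from
    (below d (<-≤-trans x<ea (≤-trans ea≤y (<⇒≤ y<n))) y<n refl refl (<⇒≢ (<-≤-trans cx<a a≤cy)))
    (split cx<a (collapse-< y<n) a≤cy)
    where
    cx<a = <-spread⇒collapse-< j m x<ea
    a≤cy = spread-≤⇒≤-collapse j m ea≤y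

  pull-decomposable : ∀ d → Decomposable d σ → Decomposable d π
  pull-decomposable d (a , a<k , 0<a , split) = e a , spread-< a<k , ≤-trans 0<a (y≤spread j m a) , pull-split d split

  push-split : ∀ d {a} → Split d π (e a) → Split d σ a
  push-split d {a} split {x} x<a {y} y<k a≤y = Equivalence.to
    (below d (<-trans (spread-mono-< j m x<a) (≤-<-trans (spread-mono-≤ j m a≤y) (spread-< y<k))) (spread-< y<k)
      (collapse-spread j m x) (collapse-spread j m y) (<⇒≢ (<-≤-trans x<a a≤y)))
    (split (spread-mono-< j m x<a) (spread-< y<k) (spread-mono-≤ j m a≤y))

  -- If the cut of π lies inside the block, then σ has a cut next to position j on either side.
  push-decomposable : ∀ d → 1 ≤ k → Decomposable d π → Decomposable d σ
  push-decomposable d 1≤k (a , a<n , 0<a , split) with e (c a) ≟ a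
  ... | yes ea≡a = c a , collapse-< a<n , 0<ca , push-split d (subst (Split d π) (sym ea≡a) split)
    where
    0<ca : 0 < c a
    0<ca = n≢0⇒n>0 λ ca≡0 → <⇒≢ 0<a (trans (sym (spread-before j m z≤n)) (trans (cong e (sym ca≡0)) ea≡a))
  ... | no ea≢a with c a ≟ j
  ...   | no ca≢j = ⊥-elim (ea≢a (spread-collapse j m a ca≢j))
  ...   | yes ca≡j with collapse≡⇒within j m ca≡j
  ...     | j≤a , a≤j+m with j ≟ 0
  ...       | no j≢0 = j , s≤s j≤k , n≢0⇒n>0 j≢0 , splitσ
    where
    splitσ : Split d σ j
    splitσ {x} x<j {y} y<k j≤y with m≤n⇒m<n∨m≡n j≤y
    ... | inj₁ j<y = Equivalence.to (below d x<n (spread-< y<k) (collapse-before j m (<⇒≤ x<j)) (collapse-spread j m y) (<⇒≢ (<-trans x<j j<y)))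
        (split (<-≤-trans x<j j≤a) (spread-< y<k) (≤-trans a≤j+m (≤-trans (+-monoˡ-≤ m j≤y) (≤-reflexive (sym (spread-after j m j<y))))))
      where x<n = ≤-trans x<j (≤-trans j≤k (≤-trans (m≤m+n k m) (n≤1+n _)))
    ... | inj₂ refl = Equivalence.to (below d x<n (s≤s (+-monoˡ-≤ m j≤k)) (collapse-before j m (<⇒≤ x<j)) (collapse-within j m ≤-refl) (<⇒≢ x<j))
        (split (<-≤-trans x<j j≤a) (s≤s (+-monoˡ-≤ m j≤k)) a≤j+m)
      where x<n = ≤-trans x<j (≤-trans j≤k (≤-trans (m≤m+n k m) (n≤1+n _)))
  ...       | yes refl = 1 , s≤s 1≤k , s≤s z≤n , splitσ
    where
    splitσ : Split d σ 1
    splitσ {zero} (s≤s z≤n) {y} y<k 1≤y = Equivalence.to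
      (below d (s≤s z≤n) (spread-< y<k) (collapse-before 0 m z≤n) (collapse-spread 0 m y) (<⇒≢ 1≤y))
      (split 0<a (spread-< y<k) (≤-trans a≤j+m (≤-trans (m≤n+m m y) (≤-reflexive (sym (spread-after 0 m 1≤y))))))

  module _ {i i₀ i′} (i≤j : i ≤ j) (last : e (suc i₀) ≡ suc i′) where

    private
      e-i : e i ≡ i
      e-i = spread-before j m i≤j

    -- Right ends are matched as exclusive bounds because `e j` is the first position of the block:
    -- for `i₀ ≡ j` the interval in π has to run to the last position of the block, and `e (suc j)`
    -- is the position after that.
    inside-collapse : ∀ {x} → Inside i i′ x ⇔ Inside i i₀ (c x)
    inside-collapse {x} = mk⇔
      (λ (i≤x , x≤i′) → spread-≤⇒≤-collapse j m (subst (_≤ x) (sym e-i) i≤x) ,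
        s≤s⁻¹ (<-spread⇒collapse-< j m (subst (x <_) (sym last) (s≤s x≤i′))))
      (λ (i≤cx , cx≤i₀) → ≮⇒≥ (λ x<i → <⇒≱ (<-spread⇒collapse-< j m (subst (x <_) (sym e-i) x<i)) i≤cx) ,
        s≤s⁻¹ (subst (x <_) last (collapse-<⇒<-spread j m (s≤s cx≤i₀))))

    pull-convex : Convex σ i i₀ → Convex π i i′
    pull-convex convex {x} x<n {y} y<n {z} z<n x∈ y∈ z∉ πz<πx =
      Equivalence.from (below ascending z<n y<n refl refl (λ e → cz∉ (subst (Inside i i₀) (sym e) (to y∈))))
        (convex (collapse-< x<n) (collapse-< y<n) (collapse-< z<n) (to x∈) (to y∈) cz∉
          (Equivalence.to (below ascending z<n x<n refl refl (λ e → cz∉ (subst (Inside i i₀) (sym e) (to x∈)))) πz<πx))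
      where
      to : ∀ {x} → Inside i i′ x → Inside i i₀ (c x)
      to = Equivalence.to inside-collapse
      cz∉ : ¬ Inside i i₀ (c z)
      cz∉ cz∈ = z∉ (Equivalence.from inside-collapse cz∈)

    push-convex : Convex π i i′ → Convex σ i i₀
    push-convex convex {x} x<k {y} y<k {z} z<k x∈ y∈ z∉ σz<σx =
      Equivalence.to (below ascending (spread-< z<k) (spread-< y<k) (collapse-spread j m z) (collapse-spread j m y) (λ e → z∉ (subst (Inside i i₀) (sym e) y∈)))
        (convex (spread-< x<k) (spread-< y<k) (spread-< z<k) (from x∈) (from y∈) ez∉
          (Equivalence.from (below ascending (spread-< z<k) (spread-< x<k) (collapse-spread j m z) (collapse-spread j m x) (λ e → z∉ (subst (Inside i i₀) (sym e) x∈))) σz<σx))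
      where
      from : ∀ {x} → Inside i i₀ x → Inside i i′ (e x)
      from {x} x∈ = Equivalence.from inside-collapse (subst (Inside i i₀) (sym (collapse-spread j m x)) x∈)
      ez∉ : ¬ Inside i i′ (e z)
      ez∉ ez∈ = z∉ (subst (Inside i i₀) (collapse-spread j m z) (Equivalence.to inside-collapse ez∈))

    whole⇔ : suc i₀ ≡ suc k ⇔ suc i′ ≡ n
    whole⇔ = mk⇔
      (λ eq → trans (sym last) (trans (cong e eq) spread-total))
      (λ eq → trans (sym (collapse-spread j m (suc i₀))) (trans (cong c (trans last (trans eq (sym spread-total)))) (collapse-spread j m (suc k))))

    pull-proper : Proper σ i i₀ → Proper π i i′
    pull-proper (i<i₀ , ¬whole , convex) =
      <-≤-trans i<i₀ (s≤s⁻¹ (≤-trans (y≤spread j m (suc i₀)) (≤-reflexive last))) ,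
      (λ (i≡0 , eq) → ¬whole (i≡0 , Equivalence.from whole⇔ eq)) , pull-convex convex

    push-proper : i < i₀ → Proper π i i′ → Proper σ i i₀
    push-proper i<i₀ (_ , ¬whole , convex) = i<i₀ , (λ (i≡0 , eq) → ¬whole (i≡0 , Equivalence.to whole⇔ eq)) , push-convex convex

  maximal⇒reduced : MaximalBlock j m π → Reduced (suc j) σ
  maximal⇒reduced ((connected , properFrom) , _ , maximal) = (λ d dec → connected d (pull-decomposable d dec)) , from
    where
    from : ProperFrom (suc j) σ
    from {i} i<k {i₀} i₀<k i<1+j proper with e (suc i₀) in last | y≤spread j m (suc i₀) | spread-mono-≤ j m i₀<k
    ... | suc i′ | s≤s i₀≤i′ | i′≤ with m≤n⇒m<n∨m≡n (s≤s⁻¹ i<1+j)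
    ...   | inj₁ i<j  = properFrom (<-≤-trans i<j (≤-trans j≤k (≤-trans (m≤m+n k m) (n≤1+n _)))) i′<n i<j (pull-proper (<⇒≤ i<j) last proper)
      where i′<n = ≤-trans i′≤ (≤-reflexive spread-total)
    -- A block of σ that starts at j and has at least two entries pulls back to a block of π longer
    -- than the contracted one.
    ...   | inj₂ refl = maximal i′<n (s≤s⁻¹ (≤-trans (s≤s (+-monoˡ-≤ m (proj₁ proper))) (≤-reflexive (trans (sym (spread-after j m (m≤n⇒m≤1+n (proj₁ proper)))) last)))) (pull-proper ≤-refl last proper)
      where i′<n = ≤-trans i′≤ (≤-reflexive spread-total)

  private
    convex-block : Convex π j (j ℕ.+ m)
    convex-block {x} x<n {y} y<n {z} z<n x∈ y∈ z∉ πz<πx =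
      Equivalence.from (below ascending z<n y<n refl (in-block y∈) cz≢j)
        (Equivalence.to (below ascending z<n x<n refl (in-block x∈) cz≢j) πz<πx)
      where
      in-block : ∀ {x} → Inside j (j ℕ.+ m) x → c x ≡ j
      in-block (j≤x , x≤) = within⇒collapse≡ j m j≤x x≤
      cz≢j : c z ≢ j
      cz≢j eq = z∉ (collapse≡⇒within j m eq)

    -- The interval from i to i′ enters the inflated block but stops short of its end. For positions
    -- x of σ from i to j, the representative `e x` lies in this interval, and for all other
    -- positions outside it, so convexity restricts to the representatives.
    push-overlap : ∀ {i i′} → i < j → j ≤ i′ → i′ < j ℕ.+ m → Convex π i i′ → Convex σ i j
    push-overlap {i} {i′} i<j j≤i′ i′<j+m convex {x} x<k {y} y<k {z} z<k x∈ y∈ z∉ σz<σx =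
      Equivalence.to (below ascending (spread-< z<k) (spread-< y<k) (collapse-spread j m z) (collapse-spread j m y) (λ e → z∉ (subst (Inside i j) (sym e) y∈)))
        (convex (spread-< x<k) (spread-< y<k) (spread-< z<k) (in-B x∈) (in-B y∈) out
          (Equivalence.from (below ascending (spread-< z<k) (spread-< x<k) (collapse-spread j m z) (collapse-spread j m x) (λ e → z∉ (subst (Inside i j) (sym e) x∈))) σz<σx))
      where
      in-B : ∀ {x} → Inside i j x → Inside i i′ (e x)
      in-B (i≤x , x≤j) rewrite spread-before j m x≤j = i≤x , ≤-trans x≤j j≤i′
      out : ¬ Inside i i′ (e z)
      out (i≤ez , ez≤i′) with z ≤? j
      ... | yes z≤j = z∉ (subst (i ≤_) (spread-before j m z≤j) i≤ez , z≤j)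
      ... | no  z≰j = <⇒≱ (<-trans i′<j+m (+-monoˡ-< m (≰⇒> z≰j))) (subst (_≤ i′) (spread-after j m (≰⇒> z≰j)) ez≤i′)

    -- Here the last value of the block lies on one side of all values of the prefix, so σ is
    -- cut at its last position.
    push-overlap-whole : ∀ {i′} → 0 < k → j ≡ k → i′ < j ℕ.+ m → j ≤ i′ → Convex π 0 i′ → ∃ λ d → Decomposable d σ
    push-overlap-whole {i′} 0<k refl i′<j+m j≤i′ convex with π at (j ℕ.+ m) <? π at 0
    ... | yes lt = descending , j , ≤-refl , 0<k , split
      where
      split : Split descending σ j
      split {x} x<j {y} y<k j≤y with refl ← ≤-antisym j≤y (s≤s⁻¹ y<k) = Equivalence.to
        (below descending (≤-trans x<j (≤-trans (m≤m+n j m) (n≤1+n _))) ≤-refl (collapse-before j m (<⇒≤ x<j)) (collapse-within j m ≤-refl) (<⇒≢ x<j))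
        (convex (s≤s z≤n) (≤-trans x<j (≤-trans (m≤m+n j m) (n≤1+n _))) ≤-refl (z≤n , z≤n) (z≤n , ≤-trans (<⇒≤ x<j) j≤i′) (λ (_ , le) → <⇒≱ i′<j+m le) lt)
    ... | no ¬lt = ascending , j , ≤-refl , 0<k , split
      where
      split : Split ascending σ j
      split {x} x<j {y} y<k j≤y with refl ← ≤-antisym j≤y (s≤s⁻¹ y<k) = Equivalence.to
        (below ascending x<n ≤-refl (collapse-before j m (<⇒≤ x<j)) (collapse-within j m ≤-refl) (<⇒≢ x<j))
        (≤∧≢⇒< (≮⇒≥ λ lt → ¬lt (convex x<n (s≤s z≤n) ≤-refl (z≤n , ≤-trans (<⇒≤ x<j) j≤i′) (z≤n , z≤n) (λ (_ , le) → <⇒≱ i′<j+m le) lt))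
          λ eq → <⇒≢ (<-≤-trans x<j (m≤m+n j m)) (at-injective π eq))
        where x<n = ≤-trans x<j (≤-trans (m≤m+n j m) (n≤1+n _))

    last-of : ∀ {i′} → j ℕ.+ m ≤ i′ → ∃ λ i₀ → e (suc i₀) ≡ suc i′ × i′ ≡ i₀ ℕ.+ m × j ≤ i₀
    last-of {i′} le with i′ ∸ (j ℕ.+ m) | m+[n∸m]≡n le
    ... | y | refl = j ℕ.+ y , trans (spread-after j m (s≤s (m≤m+n j y))) (cong suc eq) , sym eq , m≤m+n j y
      where
      eq : j ℕ.+ y ℕ.+ m ≡ j ℕ.+ m ℕ.+ y
      eq = trans (ℕₚ.+-assoc j y m) (trans (cong (j ℕ.+_) (ℕₚ.+-comm y m)) (sym (ℕₚ.+-assoc j m y)))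

    bound₀ : ∀ {i₀ i′} → e (suc i₀) ≡ suc i′ → i′ < n → i₀ < suc k
    bound₀ {i₀} last i′<n = s≤s⁻¹ (spread-<⇒< j m (≤-<-trans (≤-trans (≤-reflexive last) i′<n) n<e))
      where
      n<e : n < e (suc (suc k))
      n<e = subst (suc (k ℕ.+ m) <_) (sym (spread-after j m (m≤n⇒m≤1+n (s≤s j≤k)))) ≤-refl

  -- A proper block of π that starts before j ends before j, or contains the inflated block, or ends
  -- inside it. In the first two cases it comes from a proper block of σ. In the third, the
  -- positions from i to j form a block of σ, which is proper unless it is all of σ, and then σ is a
  -- direct or skew sum. By `1 ≤ k` the inflated block is not all of π.
  reduced⇒maximal : 1 ≤ k → Reduced (suc j) σ → MaximalBlock j m π
  reduced⇒maximal 1≤k (connected , properFrom) =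
    ((λ d dec → connected d (push-decomposable d 1≤k dec)) , from) ,
    (s≤s (+-monoˡ-≤ m j≤k) , (λ { (refl , eq) → <⇒≢ (≤-<-trans (≤-reflexive refl) (s≤s (+-monoˡ-≤ m 1≤k))) (cong suc (suc-injective eq)) }) , convex-block) , maximal
    where
    maximal : ∀ {i′} → i′ < n → j ℕ.+ m < i′ → ¬ Proper π j i′
    maximal {i′} i′<n lt proper with last-of (<⇒≤ lt)
    ... | i₀ , last , refl , _ = properFrom (s≤s j≤k) (bound₀ last i′<n) ≤-refl (push-proper ≤-refl last (+-cancelʳ-< m j i₀ lt) proper)
    from : ProperFrom j π
    from {i} i<n {i′} i′<n i<j proper@(i<i′ , ¬whole , convex) with i′ <? j
    ... | yes i′<j = properFrom (<-trans i<j (s≤s j≤k)) (bound₀ last i′<n) (m≤n⇒m≤1+n i<j) (push-proper (<⇒≤ i<j) last i<i′ proper)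
      where
      last : e (suc i′) ≡ suc i′
      last = spread-before j m i′<j
    ... | no i′≮j with i′ <? j ℕ.+ m
    ...   | no i′≮j+m with last-of (≮⇒≥ i′≮j+m)
    ...     | i₀ , last , _ , j≤i₀ = properFrom (<-trans i<j (s≤s j≤k)) (bound₀ last i′<n) (m≤n⇒m≤1+n i<j) (push-proper (<⇒≤ i<j) last (<-≤-trans i<j j≤i₀) proper)
    from {i} i<n {i′} i′<n i<j proper@(i<i′ , ¬whole , convex) | no i′≮j | yes i′<j+m with i ≟ 0 ×-dec suc j ≟ suc k
    ... | yes (refl , j≡k) with push-overlap-whole (<-≤-trans i<j j≤k) (suc-injective j≡k) i′<j+m (≮⇒≥ i′≮j) convex
    ...   | d , dec = connected d dec
    from {i} i<n {i′} i′<n i<j proper@(i<i′ , ¬whole , convex) | no i′≮j | yes i′<j+m | no ¬w =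
      properFrom (<-trans i<j (s≤s j≤k)) (s≤s j≤k) (m≤n⇒m≤1+n i<j) (i<j , ¬w , push-overlap i<j (≮⇒≥ i′≮j) i′<j+m convex)

maximalBlockSum : ∀ {j m k} → j ≤ k → 1 ≤ k →
  weightSum {suc (k ℕ.+ m)} (maximalBlock? j m) ≋ weightSum {suc k} (reduced? (suc j)) * weightSum {suc m} any?
maximalBlockSum {j} {m} {k} j≤k 1≤k = weightSum-substitution j≤k (maximalBlock? j m) (reduced? (suc j)) any?
  (λ (_ , (_ , _ , convex) , _) → convex)
  (λ {π} {σ} {α} S max → maximal⇒reduced j≤k {π} {σ} {α} S max , tt)
  (λ {π} {σ} {α} S red _ → reduced⇒maximal j≤k {π} {σ} {α} S 1≤k red)

-- Weighted sums over classes of permutations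

when : ∀ {P : Set} → Dec P → Poly → Poly
when P? f = if does P? then f else []

when-yes : ∀ {P : Set} (P? : Dec P) {f} → P → when P? f ≋ f
when-yes (yes _) _ = ≋-refl
when-yes (no ¬p) p = ⊥-elim (¬p p)

when-no : ∀ {P : Set} (P? : Dec P) {f} → ¬ P → when P? f ≋ []
when-no (yes p) ¬p = ⊥-elim (¬p p)
when-no (no _)  _  = ≋-refl

module _ {A : Set} where

  ∑-filter : ∀ {P : A → Set} (P? : Decidable P) xs (f : A → Poly) → ∑ (filter P? xs) f ≋ ∑ xs (λ x → when (P? x) (f x))
  ∑-filter P? []       f = ≋-refl
  ∑-filter P? (x ∷ xs) f with P? x
  ... | yes _ = +-cong (≋-refl {f x}) (∑-filter P? xs f)
  ... | no  _ = ∑-filter P? xs f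

  ∑-swap : ∀ {B : Set} (xs : List A) (ys : List B) (h : A → B → Poly) →
    ∑ xs (λ x → ∑ ys (h x)) ≋ ∑ ys (λ y → ∑ xs (λ x → h x y))
  ∑-swap []       ys h = ≋-sym (∑-zero ys λ _ _ → ≋-refl)
  ∑-swap (x ∷ xs) ys h = ≋-trans (+-cong (≋-refl {∑ ys (h x)}) (∑-swap xs ys h)) (≋-sym (∑-+ ys (h x) (λ y → ∑ xs (λ x → h x y))))

  -- With filters replaced by `when`, the order of summation can be exchanged; `cover` and
  -- `disjoint` leave exactly one class for each entry.
  ∑-partition : ∀ {I : Set} {P : A → Set} {E : I → A → Set} (P? : Decidable P) (E? : ∀ m → Decidable (E m)) {ms} → Unique ms →
    (∀ {x} → P x → ∃ λ m → m ∈ ms × E m x) → (∀ {m x} → E m x → P x) → (∀ {m m′ x} → E m x → E m′ x → m ≡ m′) →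
    ∀ xs (f : A → Poly) → ∑ (filter P? xs) f ≋ ∑ ms (λ m → ∑ (filter (E? m) xs) f)
  ∑-partition P? E? {ms} unique cover sound disjoint xs f = ≋-trans (∑-filter P? xs f) (≋-trans
    (∑-cong xs λ x _ → pointwise x) (≋-trans
    (∑-swap xs ms (λ x m → when (E? m x) (f x)))
    (∑-cong ms λ m _ → ≋-sym (∑-filter (E? m) xs f))))
    where
    pointwise : ∀ x → when (P? x) (f x) ≋ ∑ ms (λ m → when (E? m x) (f x))
    pointwise x with P? x
    ... | no ¬p = ≋-sym (∑-zero ms λ m _ → when-no (E? m x) (¬p ∘ sound))
    ... | yes p with cover p
    ...   | m , m∈ , Emx = ≋-sym (≋-trans
      (∑-single {f = λ m → when (E? m x) (f x)} unique m∈ λ m′ m′≢m → when-no (E? m′ x) λ Em′x → m′≢m (disjoint Em′x Emx))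
      (when-yes (E? m x) Emx))

  ∑-filter-⊎ : ∀ {P Q R : A → Set} (P? : Decidable P) (Q? : Decidable Q) (R? : Decidable R) →
    (∀ {x} → P x → Q x ⊎ R x) → (∀ {x} → Q x → P x) → (∀ {x} → R x → P x) → (∀ {x} → Q x → ¬ R x) →
    ∀ xs (f : A → Poly) → ∑ (filter P? xs) f ≋ ∑ (filter Q? xs) f + ∑ (filter R? xs) f
  ∑-filter-⊎ P? Q? R? P⇒ Q⇒P R⇒P Q⇒¬R xs f = ≋-trans (∑-filter P? xs f) (≋-trans
    (∑-cong xs λ x _ → pointwise x) (≋-trans
    (∑-+ xs (λ x → when (Q? x) (f x)) (λ x → when (R? x) (f x)))
    (≋-sym (+-cong (∑-filter Q? xs f) (∑-filter R? xs f)))))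
    where
    pointwise : ∀ x → when (P? x) (f x) ≋ when (Q? x) (f x) + when (R? x) (f x)
    pointwise x with P? x
    ... | no ¬p = ≋-sym (+-cong (when-no (Q? x) (¬p ∘ Q⇒P)) (when-no (R? x) (¬p ∘ R⇒P)))
    ... | yes p with P⇒ p
    ...   | inj₁ q = ≋-sym (≋-trans (+-cong (when-yes (Q? x) q) (when-no (R? x) (Q⇒¬R q))) (Polyₛ.+-identityʳ (f x)))
    ...   | inj₂ r = ≋-sym (+-cong (when-no (Q? x) (λ q → Q⇒¬R q r)) (when-yes (R? x) r))

  ∑-filter-none : ∀ {P : A → Set} (P? : Decidable P) → (∀ x → ¬ P x) → ∀ xs (f : A → Poly) → ∑ (filter P? xs) f ≋ []
  ∑-filter-none P? none xs f = ≋-trans (∑-filter P? xs f) (∑-zero xs λ x _ → when-no (P? x) (none x))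

  ∑-filter-⇔ : ∀ {P Q : A → Set} (P? : Decidable P) (Q? : Decidable Q) → (∀ x → P x ⇔ Q x) →
    ∀ xs (f : A → Poly) → ∑ (filter P? xs) f ≋ ∑ (filter Q? xs) f
  ∑-filter-⇔ P? Q? P⇔Q xs f = ≋-trans (∑-filter P? xs f) (≋-trans (∑-cong xs λ x _ → pointwise x) (≋-sym (∑-filter Q? xs f)))
    where
    pointwise : ∀ x → when (P? x) (f x) ≋ when (Q? x) (f x)
    pointwise x with P? x
    ... | yes p = ≋-sym (when-yes (Q? x) (Equivalence.to (P⇔Q x) p))
    ... | no ¬p = ≋-sym (when-no (Q? x) (¬p ∘ Equivalence.from (P⇔Q x)))

opaque
  unfolding weightSum

  weightSum-none : ∀ {n} {P : Permutation′ n → Set} (P? : Decidable P) → (∀ π → ¬ P π) → weightSum P? ≋ []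
  weightSum-none {n} P? none = ∑-filter-none P? none (permutations n) weight

  weightSum-⇔ : ∀ {n} {P Q : Permutation′ n → Set} (P? : Decidable P) (Q? : Decidable Q) →
    (∀ π → P π ⇔ Q π) → weightSum P? ≋ weightSum Q?
  weightSum-⇔ {n} P? Q? P⇔Q = ∑-filter-⇔ P? Q? P⇔Q (permutations n) weight

  weightSum-⊎ : ∀ {n} {P Q R : Permutation′ n → Set} (P? : Decidable P) (Q? : Decidable Q) (R? : Decidable R) →
    (∀ {π} → P π → Q π ⊎ R π) → (∀ {π} → Q π → P π) → (∀ {π} → R π → P π) → (∀ {π} → Q π → ¬ R π) →
    weightSum P? ≋ weightSum Q? + weightSum R?
  weightSum-⊎ {n} P? Q? R? P⇒ Q⇒P R⇒P Q⇒¬R = ∑-filter-⊎ P? Q? R? P⇒ Q⇒P R⇒P Q⇒¬R (permutations n) weight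

  weightSum-partition : ∀ {n} {I : Set} {P : Permutation′ n → Set} {E : I → Permutation′ n → Set}
    (P? : Decidable P) (E? : ∀ m → Decidable (E m)) {ms} → Unique ms →
    (∀ {π} → P π → ∃ λ m → m ∈ ms × E m π) → (∀ {m π} → E m π → P π) → (∀ {m m′ π} → E m π → E m′ π → m ≡ m′) →
    weightSum P? ≋ ∑ ms (λ m → weightSum (E? m))
  weightSum-partition {n} P? E? unique cover sound disjoint = ∑-partition P? E? unique cover sound disjoint (permutations n) weight

  simpleSum : ℕ → Poly
  simpleSum n = weightSum {n} simple?

  simpleSum-simp : ∀ n → simpleSum n ≡ simp n
  simpleSum-simp n = refl

  simpleSum-⇔ : ∀ {n} {P : Permutation′ n → Set} (P? : Decidable P) → (∀ π → P π ⇔ Simple π) → weightSum P? ≋ simpleSum n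
  simpleSum-⇔ P? P⇔Simple = weightSum-⇔ P? simple? P⇔Simple

∑-scale : ∀ {A : Set} (xs : List A) g (f : A → Poly) → ∑ xs (λ x → g * f x) ≋ g * ∑ xs f
∑-scale []       g f = ≋-reflexive (sym (*-zeroʳ g))
∑-scale (x ∷ xs) g f = ≋-trans (+-cong (≋-refl {g * f x}) (∑-scale xs g f)) (≋-sym (Polyₛ.distribˡ g (f x) (∑ xs f)))

cone-cast : ∀ {N M f} → N ≡ M → GammaCone N f → GammaCone M f
cone-cast refl c = c

cone-∑ : ∀ {A : Set} {N} (xs : List A) {f : A → Poly} → (∀ x → x ∈ xs → GammaCone N (f x)) → GammaCone N (∑ xs f)
cone-∑ []       c = cone-0
cone-∑ (x ∷ xs) c = cone-+ (c x (here refl)) (cone-∑ xs λ y y∈ → c y (there y∈))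

-- Convolution identities for the generating polynomials

allSum connectedSum : ℕ → Poly
allSum n       = weightSum {n} any?
connectedSum n = weightSum {n} connected?

decomposableSum indivisibleSum : Direction → ℕ → Poly
decomposableSum d n = weightSum {n} (decomposable? d)
indivisibleSum  d n = weightSum {n} (indivisible? d)

-- The first entry is below the last one in a direct sum and above it in a skew sum.
not-both : ∀ {n} {π : Permutation′ n} → Decomposable ascending π → ¬ Decomposable descending π
not-both {suc n} (a , a<n , 0<a , split) (b , b<n , 0<b , split′) =
  <-asym (split 0<a ≤-refl (s≤s⁻¹ a<n)) (split′ 0<b ≤-refl (s≤s⁻¹ b<n))

opposite : Direction → Direction
opposite ascending  = descending
opposite descending = ascending

indivisibleSum-+ : ∀ d n → indivisibleSum d n ≋ connectedSum n + decomposableSum (opposite d) n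
indivisibleSum-+ d n = weightSum-⊎ (indivisible? d) connected? (decomposable? (opposite d))
  (λ {π} ¬dec → cases d π ¬dec) (λ conn → conn d) (λ {π} → excl d) (λ conn → conn (opposite d))
  where
  cases : ∀ d π → Indivisible d π → Connected π ⊎ Decomposable (opposite d) π
  cases d π ¬dec with decomposable? (opposite d) π
  ... | yes dec  = inj₂ dec
  ... | no  ¬dec′ = inj₁ (both d ¬dec ¬dec′)
    where
    both : ∀ d → Indivisible d π → Indivisible (opposite d) π → Connected π
    both ascending  u v ascending  = u
    both ascending  u v descending = v
    both descending u v ascending  = v
    both descending u v descending = u
  excl : ∀ d {π : Permutation′ n} → Decomposable (opposite d) π → Indivisible d π
  excl ascending  dec dec′ = not-both dec′ dec
  excl descending dec dec′ = not-both dec dec′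

allSum-+ : ∀ n → allSum n ≋ connectedSum n + (decomposableSum ascending n + decomposableSum descending n)
allSum-+ n = ≋-trans
  (weightSum-⊎ any? (indivisible? ascending) (decomposable? ascending) (λ {π} _ → cases π) _ _ (λ ¬dec dec → ¬dec dec))
  (≋-trans (+-cong (indivisibleSum-+ ascending n) (≋-refl {decomposableSum ascending n}))
    (≋-trans (Polyₛ.+-assoc (connectedSum n) (decomposableSum descending n) (decomposableSum ascending n))
      (+-cong (≋-refl {connectedSum n}) (+-comm (decomposableSum descending n) (decomposableSum ascending n)))))
  where
  cases : ∀ π → Indivisible ascending π ⊎ Decomposable ascending π
  cases π with decomposable? ascending π
  ... | yes dec  = inj₂ dec
  ... | no  ¬dec = inj₁ ¬dec

least : ∀ {Q : ℕ → Set} → Decidable Q → ∀ {a} → Q a → ∃ λ a₀ → a₀ ≤ a × Q a₀ × (∀ {b} → b < a₀ → ¬ Q b)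
least {Q} Q? {a} qa = <-rec (λ a → Q a → ∃ λ a₀ → a₀ ≤ a × Q a₀ × (∀ {b} → b < a₀ → ¬ Q b)) step a qa
  where
  step : ∀ a → (∀ {b} → b < a → Q b → ∃ λ a₀ → a₀ ≤ b × Q a₀ × (∀ {c} → c < a₀ → ¬ Q c)) → Q a → ∃ λ a₀ → a₀ ≤ a × Q a₀ × (∀ {b} → b < a₀ → ¬ Q b)
  step a rec qa with anyUpTo? Q? a
  ... | no none = a , ≤-refl , qa , λ {b} b<a qb → none (b , b<a , qb)
  ... | yes (b , b<a , qb) with rec b<a qb
  ...   | a₀ , a₀≤b , q , min = a₀ , ≤-trans a₀≤b (<⇒≤ b<a) , q , min

greatest : ∀ {Q : ℕ → Set} → Decidable Q → ∀ N → Q 0 → ∃ λ a₀ → a₀ ≤ N × Q a₀ × (∀ {b} → b ≤ N → a₀ < b → ¬ Q b)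
greatest Q? zero    q₀ = 0 , z≤n , q₀ , λ b≤0 0<b → ⊥-elim (<⇒≱ 0<b b≤0)
greatest Q? (suc N) q₀ with Q? (suc N)
... | yes q = suc N , ≤-refl , q , λ b≤ lt → ⊥-elim (<⇒≱ lt b≤)
... | no ¬q with greatest Q? N q₀
...   | a₀ , a₀≤N , q , max = a₀ , m≤n⇒m≤1+n a₀≤N , q , λ b≤ lt qb → case b≤ lt qb (m≤n⇒m<n∨m≡n b≤)
  where
  case : ∀ {b} → b ≤ suc N → a₀ < b → _ → b < suc N ⊎ b ≡ suc N → ⊥
  case b≤ lt qb (inj₁ b<)   = max (s≤s⁻¹ b<) lt qb
  case b≤ lt qb (inj₂ refl) = ¬q qb

-- Sort by the length m + 1 of the first summand. Two contractions, of this summand and then of all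
-- that follows it, leave a permutation of size 2 with weight `linkWeight d`.
decomposableSum-first : ∀ d n → decomposableSum d (suc n) ≋ ∑ (upTo n) (λ m → linkWeight d * allSum (n ∸ m) * indivisibleSum d (suc m))
decomposableSum-first d n = ≋-trans
  (weightSum-partition (decomposable? d) (λ m → firstSplit? d (suc m)) (Uniqueₚ.upTo⁺ n) cover
    (λ { {m} (a<n , (0<a , split) , _) → suc m , a<n , 0<a , split }) disjoint)
  (∑-cong (upTo n) λ m m∈ → term m (∈-upTo⁻ m∈))
  where
  cover : ∀ {π : Permutation′ (suc n)} → Decomposable d π → ∃ λ m → m ∈ upTo n × FirstSplit d (suc m) π
  cover {π} (a , a<n , 0<a , split) with least (λ a → 0 <? a ×-dec split? d π a) (0<a , split)
  ... | suc m , m<a , q , min = m , ∈-upTo⁺ (<-≤-trans m<a (s≤s⁻¹ a<n)) , ≤-<-trans m<a a<n , q , min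
  disjoint : ∀ {m m′} {π : Permutation′ (suc n)} → FirstSplit d (suc m) π → FirstSplit d (suc m′) π → m ≡ m′
  disjoint {m} {m′} (_ , q , min) (_ , q′ , min′) with <-cmp m m′
  ... | tri< lt _ _ = ⊥-elim (min′ (s≤s lt) q)
  ... | tri≈ _ eq _ = eq
  ... | tri> _ _ gt = ⊥-elim (min (s≤s gt) q′)
  term : ∀ m → m < n → weightSum {suc n} (firstSplit? d (suc m)) ≋ linkWeight d * allSum (n ∸ m) * indivisibleSum d (suc m)
  term m m<n with n ∸ m | m∸n+n≡m (<⇒≤ m<n) | m<n⇒0<n∸m m<n
  ... | suc k | refl | _ = ≋-trans (firstSplitSum d m (suc k) (s≤s z≤n))
    (*-cong (≋-trans (afterFirstSum d k) (*-cong (linkSum d) (≋-refl {allSum (suc k)}))) (≋-refl {indivisibleSum d (suc m)}))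

reducedSum-maximal : ∀ {n j} → 1 ≤ n → j < suc n → weightSum {suc n} (reduced? j) ≋ ∑ (upTo n) (λ m → weightSum {suc n} (maximalBlock? j m))
reducedSum-maximal {n} {j} 1≤n j<n = weightSum-partition (reduced? j) (maximalBlock? j) (Uniqueₚ.upTo⁺ n) cover proj₁ disjoint
  where
  block₀ : ∀ (π : Permutation′ (suc n)) → BlockAt j 0 π
  block₀ π rewrite ℕₚ.+-identityʳ j = j<n , (λ (j≡0 , eq) → <⇒≢ 1≤n (trans (sym j≡0) (suc-injective eq))) ,
    λ x<n y<n z<n (j≤x , x≤j) (j≤y , y≤j) _ → subst (λ i → _ < π at i) (trans (≤-antisym x≤j j≤x) (≤-antisym j≤y y≤j))
  cover : ∀ {π : Permutation′ (suc n)} → Reduced j π → ∃ λ m → m ∈ upTo n × MaximalBlock j m π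
  cover {π} red with greatest (λ m → blockAt? j m π) n (block₀ π)
  ... | m , m≤n , block@(j+m<n , ¬whole , _) , max = m , ∈-upTo⁺ (≤∧≢⇒< m≤n m≢n) , red , block , maximal
    where
    -- Length n + 1 would force j = 0 and give the whole permutation.
    m≢n : m ≢ n
    m≢n refl with n≤0⇒n≡0 (+-cancelʳ-≤ m j 0 (s≤s⁻¹ j+m<n))
    ... | refl = ¬whole (refl , refl)
    maximal : ∀ {i′} → i′ < suc n → j ℕ.+ m < i′ → ¬ Proper π j i′
    maximal {i′} i′<n lt (j<i′ , ¬w , convex) with i′ ∸ j | m+[n∸m]≡n (<⇒≤ j<i′)
    ... | b | refl = max (≤-trans (m≤n+m b j) (s≤s⁻¹ i′<n)) (+-cancelˡ-< j m b lt) (i′<n , ¬w , convex)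
  disjoint : ∀ {m m′} {π : Permutation′ (suc n)} → MaximalBlock j m π → MaximalBlock j m′ π → m ≡ m′
  disjoint {m} {m′} (_ , (b< , ¬w , c) , max) (_ , (b<′ , ¬w′ , c′) , max′) with <-cmp m m′
  ... | tri≈ _ eq _ = eq
  ... | tri< lt _ _ = ⊥-elim (max b<′ (+-monoʳ-< j lt) (m<m+n j (≤-<-trans z≤n lt) , ¬w′ , c′))
  ... | tri> _ _ gt = ⊥-elim (max′ b< (+-monoʳ-< j gt) (m<m+n j (≤-<-trans z≤n gt) , ¬w , c))

-- Simple permutations and the gamma-positive cone

-- A value below one in the block but not below `l` lies between `l` and `u`, so it is taken inside
-- the block. Hence a position outside whose value is below some value of the block has a value
-- below `l`, and so below all of them.
block⇒convex : ∀ {n} {π : Permutation′ n} {i i′} → Block π i i′ → Convex π (toℕ i) (toℕ i′)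
block⇒convex {n} {π} {i} {i′} (_ , l , u , into , onto) {x} x<n {y} y<n {z} z<n x∈ y∈ z∉ πz<πx
  with toℕ l ≤? π at z
... | no l≰πz = <-≤-trans (≰⇒> l≰πz) (subst (toℕ l ≤_) (sym (at-fromℕ< π y<n)) (proj₁ (into (fromℕ< y<n) (inside y<n y∈))))
  where
  inside : ∀ {x} (x<n : x < n) → Inside (toℕ i) (toℕ i′) x → toℕ i ≤ toℕ (fromℕ< x<n) × toℕ (fromℕ< x<n) ≤ toℕ i′
  inside x<n x∈ = subst (Inside (toℕ i) (toℕ i′)) (sym (Finₚ.toℕ-fromℕ< x<n)) x∈
... | yes l≤πz with onto (π ⟨$⟩ʳ fromℕ< z<n)
      (subst (toℕ l ≤_) (at-fromℕ< π z<n) l≤πz ,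
       subst (_≤ toℕ u) (at-fromℕ< π z<n) (≤-trans (<⇒≤ πz<πx) (subst (_≤ toℕ u) (sym (at-fromℕ< π x<n)) (proj₂ (into (fromℕ< x<n) (inside x<n x∈))))))
  where
  inside : ∀ {x} (x<n : x < n) → Inside (toℕ i) (toℕ i′) x → toℕ i ≤ toℕ (fromℕ< x<n) × toℕ (fromℕ< x<n) ≤ toℕ i′
  inside x<n x∈ = subst (Inside (toℕ i) (toℕ i′)) (sym (Finₚ.toℕ-fromℕ< x<n)) x∈
...   | w , w∈ , πw≡πz = ⊥-elim (z∉ (subst (Inside (toℕ i) (toℕ i′)) w≡z w∈))
  where
  w≡z : toℕ w ≡ z
  w≡z = at-injective π (trans (at-toℕ π w) (trans (cong toℕ πw≡πz) (sym (at-fromℕ< π z<n))))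

convex⇒block : ∀ {j m k} → j ≤ k → (π : Permutation′ (suc (k ℕ.+ m))) → Convex π j (j ℕ.+ m) →
  ∀ i i′ → toℕ i ≡ j → toℕ i′ ≡ j ℕ.+ m → Block π i i′
convex⇒block {j} {m} {k} j≤k π convex i i′ i≡ i′≡ with convex⇒intervalBlock j≤k π convex
... | v , v≤k , B = subst₂ _≤_ (sym i≡) (sym i′≡) (m≤m+n j m) , fromℕ< l<n , fromℕ< u<n , into , onto
  where
  l<n : v < suc (k ℕ.+ m)
  l<n = s≤s (≤-trans v≤k (m≤m+n k m))
  u<n : v ℕ.+ m < suc (k ℕ.+ m)
  u<n = s≤s (+-monoˡ-≤ m v≤k)
  into : ∀ x → toℕ i ≤ toℕ x × toℕ x ≤ toℕ i′ → toℕ (fromℕ< l<n) ≤ toℕ (π ⟨$⟩ʳ x) × toℕ (π ⟨$⟩ʳ x) ≤ toℕ (fromℕ< u<n)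
  into x (i≤x , x≤i′) rewrite Finₚ.toℕ-fromℕ< l<n | Finₚ.toℕ-fromℕ< u<n | sym (at-toℕ π x) =
    collapse≡⇒within v m (proj₁ (B (Finₚ.toℕ<n x)) (within⇒collapse≡ j m (subst (_≤ toℕ x) i≡ i≤x) (subst (toℕ x ≤_) i′≡ x≤i′)))
  onto : ∀ w → toℕ (fromℕ< l<n) ≤ toℕ w × toℕ w ≤ toℕ (fromℕ< u<n) → ∃ λ x → (toℕ i ≤ toℕ x × toℕ x ≤ toℕ i′) × π ⟨$⟩ʳ x ≡ w
  onto w (l≤w , w≤u) rewrite Finₚ.toℕ-fromℕ< l<n | Finₚ.toℕ-fromℕ< u<n =
    x , subst₂ (λ a b → a ≤ toℕ x × toℕ x ≤ b) (sym i≡) (sym i′≡) (collapse≡⇒within j m (proj₂ (B (Finₚ.toℕ<n x))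
      (within⇒collapse≡ v m (subst (v ≤_) (sym πx≡w) l≤w) (subst (_≤ v ℕ.+ m) (sym πx≡w) w≤u)))) , Perm.inverseʳ π
    where
    x = flip π ⟨$⟩ʳ w
    πx≡w : π at toℕ x ≡ toℕ w
    πx≡w = trans (at-toℕ π x) (cong toℕ (Perm.inverseʳ π))

properBlock⇒proper : ∀ {n} {π : Permutation′ n} {i i′} → ProperBlock π i i′ → Proper π (toℕ i) (toℕ i′)
properBlock⇒proper {π = π} (block , i≢i′ , ¬whole) =
  ≤∧≢⇒< (proj₁ block) (i≢i′ ∘ Finₚ.toℕ-injective) , ¬whole , block⇒convex {π = π} block

proper⇒properBlock : ∀ {n} (π : Permutation′ n) {i i′} (i<n : i < n) (i′<n : i′ < n) → Proper π i i′ → ProperBlock π (fromℕ< i<n) (fromℕ< i′<n)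
proper⇒properBlock {suc n} π {i} {i′} i<n i′<n (i<i′ , ¬whole , convex) =
  isBlock , (λ eq → <⇒≢ i<i′ (trans (sym (Finₚ.toℕ-fromℕ< i<n)) (trans (cong toℕ eq) (Finₚ.toℕ-fromℕ< i′<n)))) ,
  λ (i≡0 , eq) → ¬whole (trans (sym (Finₚ.toℕ-fromℕ< i<n)) i≡0 , trans (cong suc (sym (Finₚ.toℕ-fromℕ< i′<n))) eq)
  where
  convert : ∀ m k → i ℕ.+ m ≡ i′ → k ℕ.+ m ≡ n → Block π (fromℕ< i<n) (fromℕ< i′<n)
  convert m k refl refl = convex⇒block (+-cancelʳ-≤ m i k (s≤s⁻¹ i′<n)) π convex _ _ (Finₚ.toℕ-fromℕ< i<n) (Finₚ.toℕ-fromℕ< i′<n)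
  isBlock : Block π (fromℕ< i<n) (fromℕ< i′<n)
  isBlock = convert (i′ ∸ i) (n ∸ (i′ ∸ i)) (m+[n∸m]≡n (<⇒≤ i<i′)) (m∸n+n≡m (≤-trans (m∸n≤m i′ i) (s≤s⁻¹ i′<n)))

simple⇒¬proper : ∀ {n} {π : Permutation′ n} → Simple π → ∀ {i i′} → i < n → i′ < n → ¬ Proper π i i′
simple⇒¬proper {π = π} simple i<n i′<n proper = simple _ _ (proper⇒properBlock π i<n i′<n proper)

-- A cut after two or more entries makes the prefix a proper block; a cut after the first entry
-- makes the rest one, which has at least two entries from size 3 on. The simple permutations 12 and
-- 21 are themselves sums.
simple⇒connected : ∀ {n} {π : Permutation′ (suc (suc (suc n)))} → Simple π → Connected π
simple⇒connected {n} {π} simple d (suc zero , 1<n , _ , split) = simple⇒¬proper {π = π} simple 1<n ≤-refl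
  (s≤s (s≤s z≤n) , (λ ()) , convex-suffix d π split)
simple⇒connected {n} {π} simple d (suc (suc a) , a<n , _ , split) = simple⇒¬proper {π = π} simple (s≤s z≤n) (<⇒≤ a<n)
  (s≤s z≤n , (λ (_ , eq) → <⇒≢ a<n eq) , convex-prefix d π split)

reduced⇔simple : ∀ n (π : Permutation′ (suc (suc (suc n)))) → Reduced (suc (suc (suc n))) π ⇔ Simple π
reduced⇔simple n π = mk⇔
  (λ (_ , properFrom) i i′ block → properFrom (Finₚ.toℕ<n i) (Finₚ.toℕ<n i′) (Finₚ.toℕ<n i) (properBlock⇒proper {π = π} block))
  (λ simple → simple⇒connected {π = π} simple , λ {i} i<n {i′} i′<n _ → simple⇒¬proper {π = π} simple i<n i′<n)

¬connected₂ : (π : Permutation′ 2) → ¬ Connected π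
¬connected₂ π connected with <-cmp (π at 0) (π at 1)
... | tri< lt _ _ = connected ascending (1 , ≤-refl , ≤-refl , λ { (s≤s z≤n) (s≤s (s≤s z≤n)) (s≤s z≤n) → lt })
... | tri> _ _ gt = connected descending (1 , ≤-refl , ≤-refl , λ { (s≤s z≤n) (s≤s (s≤s z≤n)) (s≤s z≤n) → gt })
... | tri≈ _ eq _ = 0≢1+n (at-injective π eq)

reducedSum-0 : ∀ n → weightSum {n} (reduced? 0) ≋ connectedSum n
reducedSum-0 n = weightSum-⇔ (reduced? 0) connected? (λ π → mk⇔ proj₁ (λ conn → conn , λ {i} _ {i′} _ ()))

opaque
  unfolding weightSum _at_ connected? decomposable? split?
  connectedSum-1 : connectedSum 1 ≋ 1#
  connectedSum-1 = mk≋ λ _ _ → refl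

module _ (simple-cone : ∀ n → GammaCone (suc (suc n)) (simpleSum (suc (suc (suc n))))) where

  cone-reduced-base : ∀ n → 1 ≤ n → GammaCone n (weightSum {suc n} (reduced? (suc n)))
  -- At size 2 the recursion ends in the zero polynomial and not in `simp 2`, because 12 and 21 are
  -- not connected.
  cone-reduced-base (suc zero) _ = cone-≋ (≋-sym (weightSum-none {2} (reduced? 2) (λ π (conn , _) → ¬connected₂ π conn))) cone-0
  cone-reduced-base (suc (suc n)) _ = cone-≋
    (≋-sym (simpleSum-⇔ {suc (suc (suc n))} (reduced? (suc (suc (suc n)))) (reduced⇔simple n)))
    (simple-cone n)

  module _ {N} (all-cone : ∀ {m} → m < N → GammaCone m (allSum (suc m))) where

    -- `fuel` bounds the size minus j. A contraction raises j by one and never enlarges the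
    -- permutation, and the factor split off has size at most n, where `all-cone` applies. Once j
    -- equals the size, every proper block is excluded.
    cone-reduced : ∀ fuel {n j} → 1 ≤ n → n ≤ N → j ≤ suc n → suc n ≤ j ℕ.+ fuel → GammaCone n (weightSum {suc n} (reduced? j))
    cone-reduced fuel {n} {j} 1≤n n≤N j≤ ≤fuel with m≤n⇒m<n∨m≡n j≤
    ... | inj₂ refl = cone-reduced-base n 1≤n
    cone-reduced zero       {n} {j} 1≤n n≤N j≤ ≤fuel | inj₁ j< = ⊥-elim (<⇒≱ j< (≤-trans ≤fuel (≤-reflexive (ℕₚ.+-identityʳ j))))
    cone-reduced (suc fuel) {n} {j} 1≤n n≤N j≤ ≤fuel | inj₁ j< = cone-≋ (≋-sym (reducedSum-maximal 1≤n j<))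
      (cone-∑ (upTo n) {λ m → weightSum {suc n} (maximalBlock? j m)} λ m m∈ → term m (n ∸ m) (∈-upTo⁻ m∈) (m∸n+n≡m (<⇒≤ (∈-upTo⁻ m∈))) n≤N ≤fuel)
      where
      term : ∀ m k {n} → m < n → k ℕ.+ m ≡ n → n ≤ N → suc n ≤ j ℕ.+ suc fuel → GammaCone n (weightSum {suc n} (maximalBlock? j m))
      term m k m<n refl n≤N ≤fuel with j ≤? k
      -- A block of length m + 1 starting at j does not fit into size k + m + 1.
      ... | no j≰k = cone-≋ (≋-sym (weightSum-none {suc (k ℕ.+ m)} (maximalBlock? j m)
              λ { π (_ , (j+m<n , _) , _) → j≰k (+-cancelʳ-≤ m j k (s≤s⁻¹ j+m<n)) })) cone-0
      ... | yes j≤k = cone-≋ (≋-sym (maximalBlockSum {j} {m} {k} j≤k 1≤k))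
              (cone-* {f = weightSum {suc k} (reduced? (suc j))} {weightSum {suc m} any?} (cone-reduced fuel {k} {suc j} 1≤k (≤-trans (m≤m+n k m) n≤N) (s≤s j≤k)
                         (s≤s (≤-trans (m≤m+n k m) (s≤s⁻¹ (≤-trans ≤fuel (≤-reflexive (+-suc j fuel)))))))
                      (all-cone (≤-trans m<n n≤N)))
        where
        1≤k : 1 ≤ k
        1≤k = +-cancelʳ-< m 0 k m<n

  -- Size 1 is treated apart: its only position is already the whole permutation, so there is no
  -- block to contract. Otherwise start at j = 0 with `fuel` equal to the size.
  cone-connected : ∀ n → (∀ {m} → m < n → GammaCone m (allSum (suc m))) → GammaCone n (connectedSum (suc n))
  cone-connected zero    _        = cone-≋ (≋-sym connectedSum-1) cone-1
  cone-connected (suc n) all-cone = cone-≋ (reducedSum-0 _) (cone-reduced all-cone (suc (suc n)) (s≤s z≤n) ≤-refl z≤n ≤-refl)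

  U V : ℕ → Poly
  U n = decomposableSum ascending n + decomposableSum descending n
  V n = decomposableSum descending n + s * t * decomposableSum ascending n

  module _ (n : ℕ) where

    private
      first : Direction → ℕ → Poly
      first d m = linkWeight d * allSum (n ∸ m) * indivisibleSum d (suc m)

      expand-first : ∀ d m → first d m ≋ linkWeight d * allSum (n ∸ m) * (connectedSum (suc m) + decomposableSum (opposite d) (suc m))
      expand-first d m = *-congˡ (linkWeight d * allSum (n ∸ m)) (indivisibleSum-+ d (suc m))

    U-recurrence : U (suc n) ≋ ∑ (upTo n) (λ m → allSum (n ∸ m) * ((1# + s * t) * connectedSum (suc m) + V (suc m)))
    U-recurrence = ≋-trans (+-cong (decomposableSum-first ascending n) (decomposableSum-first descending n))
      (≋-trans (≋-sym (∑-+ (upTo n) (first ascending) (first descending)))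
        (∑-cong (upTo n) λ m _ → ≋-trans (+-cong (expand-first ascending m) (expand-first descending m))
          (algebra (s * t) (allSum (n ∸ m)) (connectedSum (suc m)) (decomposableSum ascending (suc m)) (decomposableSum descending (suc m)))))
      where
      algebra : ∀ p a c u d → 1# * a * (c + d) + p * a * (c + u) ≋ a * ((1# + p) * c + (d + p * u))
      algebra = solve 5 (λ p a c u d → con 1 :* a :* (c :+ d) :+ p :* a :* (c :+ u) := a :* ((con 1 :+ p) :* c :+ (d :+ p :* u))) ≋-refl
        where open import Algebra.Solver.Ring.NaturalCoefficients.Default polySemiring

    V-recurrence : V (suc n) ≋ ∑ (upTo n) (λ m → allSum (n ∸ m) * (s * t * (connectedSum (suc m) + connectedSum (suc m) + U (suc m))))
    V-recurrence = ≋-trans (+-cong (decomposableSum-first descending n) (≋-trans (*-congˡ (s * t) (decomposableSum-first ascending n)) (≋-sym (∑-scale (upTo n) (s * t) (first ascending)))))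
      (≋-trans (≋-sym (∑-+ (upTo n) (first descending) (λ m → s * t * first ascending m)))
        (∑-cong (upTo n) λ m _ → ≋-trans (+-cong (expand-first descending m) (*-congˡ (s * t) (expand-first ascending m)))
          (algebra (s * t) (allSum (n ∸ m)) (connectedSum (suc m)) (decomposableSum ascending (suc m)) (decomposableSum descending (suc m)))))
      where
      algebra : ∀ p a c u d → p * a * (c + u) + p * (1# * a * (c + d)) ≋ a * (p * (c + c + (u + d)))
      algebra = solve 5 (λ p a c u d → p :* a :* (c :+ u) :+ p :* (con 1 :* a :* (c :+ d)) := a :* (p :* (c :+ c :+ (u :+ d)))) ≋-refl
        where open import Algebra.Solver.Ring.NaturalCoefficients.Default polySemiring

  -- The three are proved together, since at smaller sizes U needs V, V needs U, both need C, and
  -- all of them need A.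
  record Cones (n : ℕ) : Set where
    field
      connected-cone : GammaCone n (connectedSum (suc n))
      U-cone         : GammaCone n (U (suc n))
      V-cone         : GammaCone (suc n) (V (suc n))

    all-cone : GammaCone n (allSum (suc n))
    all-cone = cone-≋ (≋-sym (allSum-+ (suc n))) (cone-+ connected-cone U-cone)

  cones : ∀ n → Cones n
  cones = <-rec Cones step
    where
    open Cones
    step : ∀ n → (∀ {m} → m < n → Cones m) → Cones n
    step n rec = record
      { connected-cone = cone-connected n λ m<n → all-cone (rec m<n)
      ; U-cone = cone-≋ (≋-sym (U-recurrence n)) (cone-∑ (upTo n) λ m m∈ → let m<n = ∈-upTo⁻ m∈ in
          -- Darga n - m - 1 comes from `allSum (n ∸ m)` and m + 1 from the second factor, where 1 +
          -- st supplies the one that a convolution lacks.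
          cone-cast (m∸n+n≡m m<n)
            (cone-* (prefix m<n) (cone-+ (cone-* cone-1+st (connected-cone (rec m<n))) (V-cone (rec m<n)))))
      ; V-cone = cone-≋ (≋-sym (V-recurrence n)) (cone-∑ (upTo n) λ m m∈ → let m<n = ∈-upTo⁻ m∈ in
          -- Here st contributes 2, which makes the total n + 1.
          cone-cast (trans (+-suc (n ∸ suc m) (suc m)) (cong suc (m∸n+n≡m m<n)))
            (cone-* (prefix m<n) (cone-* cone-st (cone-+ (cone-+ (connected-cone (rec m<n)) (connected-cone (rec m<n))) (U-cone (rec m<n))))))
      }
      where
      prefix : ∀ {m} → m < n → GammaCone (n ∸ suc m) (allSum (n ∸ m))
      prefix {m} m<n = subst (λ l → GammaCone (n ∸ suc m) (allSum l)) (sym (+-∸-assoc 1 m<n))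
        (all-cone (rec (∸-monoʳ-< {n} (s≤s z≤n) m<n)))

integer-twoSidedEulerian : ∀ n → IntegerPoly (twoSidedEulerian n)
integer-twoSidedEulerian n = integer-∑ (permutations n) λ π → integer-* (integer-^ (des π) integer-s) (integer-^ (ides π) integer-t)

theorem4p1 : (∀ n → 1 ≤ n → GammaPositive (n ∸ 1) (simp n)) →
    ∀ n → 1 ≤ n →
    ∃ λ (γ : ℕ → ℕ → ℕ) →
    twoSidedEulerian n ≈ gammaExpansion (n ∸ 1) (λ i j → fromℕ (γ i j))
theorem4p1 simp-γ (suc n) _ = integral-expansion
  (subst (GammaCone n) (anySum (suc n)) (Cones.all-cone (cones simple-cone n)))
  (integer-twoSidedEulerian (suc n))
  where
  simple-cone : ∀ n → GammaCone (suc (suc n)) (simpleSum (suc (suc (suc n))))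
  simple-cone n = subst (GammaCone (suc (suc n))) (sym (simpleSum-simp (suc (suc (suc n)))))
    (gammaPositive⇒cone (simp-γ (suc (suc (suc n))) (s≤s z≤n)))
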